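{- For every $\varepsilon>0$ there exists $m_0$ such that the following holds. Let $D$ be a digraph with $m\ge m_0$ arcs and minimum outdegree at least $4$. Then there is a bipartition $V(D)=V_1\cup V_2$ with $$\min\{e(V_1,V_2),\,e(V_2,V_1)\}\ \ge\ \left(\tfrac{3}{14}-\varepsilon\right)m .$$ (Equivalently, in the paper's notation: every digraph $D$ with $m$ arcs and minimum outdegree at least $4$ admits a bipartition $V(D)=V_1\cup V_2$ with $\min\{e(V_1,V_2),e(V_2,V_1)\}\ge (3/14+o(1))m$, where $o(1)\to 0$ as $m\to\infty$.)
   Context: All digraphs are finite and have no loops and no two parallel arcs in the same direction (two arcs in opposite directions between the same pair of vertices are allowed). For a digraph $D$ and $A,B\subseteq V(D)$, $e(A,B)$ denotes the number of arcs of $D$ directed from a vertex of $A$ to a vertex of $B$. The outdegree of a vertex is the number of arcs directed away from it. -}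

module Defs where

open import Data.Nat using (ℕ; zero; suc; _+_)
open import Data.Fin using (Fin; zero; suc)
open import Data.Bool using (Bool; true; false; if_then_else_)
open import Relation.Binary.PropositionalEquality using (_≡_)

sumFin : (n : ℕ) → (Fin n → ℕ) → ℕ
sumFin zero    f = 0
sumFin (suc n) f = f zero + sumFin n (λ i → f (suc i))

-- A digraph on vertex set Fin n: adj u v = true iff there is an arc u → v.
-- At most one arc per ordered pair (no parallel arcs in the same direction);
-- opposite arcs allowed. Loops are excluded by the field noLoops.
record Digraph (n : ℕ) : Set where
  field
    adj     : Fin n → Fin n → Bool
    noLoops : ∀ v → adj v v ≡ false
open Digraph public

b2n : Bool → ℕ
b2n true  = 1
b2n false = 0

outdeg : ∀ {n} → Digraph n → Fin n → ℕ
outdeg {n} D u = sumFin n (λ v → b2n (adj D u v))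

arcs : ∀ {n} → Digraph n → ℕ
arcs {n} D = sumFin n (λ u → outdeg D u)

sameB : Bool → Bool → Bool
sameB true  true  = true
sameB false false = true
sameB _     _     = false

-- A bipartition V(D) = V₁ ∪ V₂ given by side : Fin n → Bool (true = V₁, false = V₂).
-- eSides D side a b = number of arcs from a vertex with side a to a vertex with side b.
eSides : ∀ {n} → Digraph n → (Fin n → Bool) → Bool → Bool → ℕ
eSides {n} D side a b =
  sumFin n (λ u → sumFin n (λ v →
    if sameB (side u) a then (if sameB (side v) b then b2n (adj D u v) else 0) else 0))

{-# OPTIONS --safe #-}
-- For a side function with signs s_v = ±1, four times each of the two crossing numbers equals
-- m ∓ ∑ b_v s_v - ∑ s_u s_v (sum over arcs), with b_v = outdegree - indegree.  The boundedly many
-- vertices of large degree ("big") get prescribed signs; the others get random signs, made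
-- independent between the stars of a partition into stars and opposite along the edges of a star.
-- A second moment bound keeps ∑ b_v s_v near its mean, so only expectations matter.
--
-- Let y_v = indegree - outdegree for big v, T = ∑ y_v, and n₁ the number of other vertices with an
-- arc to a big one.  A maximum matching yields stars gaining ∑ min(3, outdegree) / 14, and since
-- outdegrees are at least 4 this suffices with unbiased signs as soon as the big vertices can be
-- signed with 7 |∑ ± y_v| ≤ 7 n + n₁ - T, n being the number of other vertices.  If T ≤ n₁ greedy
-- signs do.  If T > n₁, cut the sequence of the y_v at the item that passes T / 2: either the item
-- alone, or together with all earlier ones, against the rest is good enough, or the items fall into
-- three groups of sum between 0 and T / 2.  In that case one group is placed against the other two
-- and all other vertices are biased so that the two crossing numbers have equal means; the three
-- resulting costs have the form α_i κ_i with ∑ α_i ∑ κ_i = m T², so one of them is at most m T² / 9.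
module Submission where

open import Defs
open import Data.Bool using (Bool; true; false; not; _∧_; _∨_; _xor_; if_then_else_)
import Data.Bool.Properties as 𝔹ₚ
open import Data.Empty using (⊥; ⊥-elim)
import Data.Fin as Fin
open import Data.Fin using (Fin; zero; suc)
import Data.Fin.Properties as Fₚ
open import Data.Fin.Properties using (_≟_; _<?_; all?; any?)
open import Data.Integer as ℤ using (ℤ; +_; 0ℤ; 1ℤ; _+_; _*_; _-_; -_; _≤_; _<_; +≤+; -≤+; +<+)
import Data.Integer.Properties as ℤₚ
open import Data.Integer.Properties
  using (+-mono-≤; *-comm; *-zeroʳ; *-identityˡ; 0≤i-j⇒j≤i; i≤j⇒0≤j-i; ≤-trans; ≤-refl; ≤-reflexive)
open import Data.Integer.Tactic.RingSolver using (solve-∀)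
open import Data.Nat as ℕ using (ℕ; zero; suc)
import Data.Nat.Properties as ℕₚ
open import Data.Product using (Σ; ∃; _×_; _,_; proj₁; proj₂)
open import Data.Rational as ℚ using (ℚ; mkℚ; Positive; _/_; toℚᵘ)
import Data.Rational.Properties as ℚₚ
import Data.Rational.Unnormalised as ℚᵘ
open import Data.Rational.Unnormalised using (mkℚᵘ; *≤*)
import Data.Rational.Unnormalised.Properties as ℚᵘₚ
open import Data.Sum using (_⊎_; inj₁; inj₂)
open import Data.Vec using (Vec; []; _∷_; lookup; tabulate)
open import Data.Vec.Properties using (lookup∘tabulate)
open import Function using (_∘_)
open import Relation.Binary.Definitions using (Tri; tri<; tri≈; tri>)
open import Relation.Binary.PropositionalEquality
open import Relation.Nullary using (¬_; Dec; yes; no; does; contradiction)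
open import Relation.Nullary.Decidable using (_×-dec_; _→-dec_)

-- The constant: once the mean of ∑ s_u s_v + |∑ b_v s_v| is at most m / 7, each crossing number is
-- about (6/7)(m/4) = 3m/14. The 7 on the star side comes from outdegree 4: a vertex with x arcs to
-- ordinary and z arcs to big vertices, x + z ≥ 4, satisfies min(3, x) + (x + z) + z ≥ 7, and even ≥
-- 8 if z ≥ 1, which is why n₁ appears. The obstacle for the stars is an unmatched vertex whose
-- neighbours come in matched pairs: it forms triangles with these edges and cannot be attached to
-- any of them in an induced star. The cap 3 on demands leaves each matching edge a surplus 14 - 6 -
-- 6 = 2 that such a vertex may collect. Where this is not enough, its outdegree exceeds its
-- indegree, and exchanges along alternating paths pass the defect on to all out-neighbours, so
-- counting arcs rules it out. Big vertices cannot be random, since one of them may shift ∑ b_v s_v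
-- by a positive fraction of m. Vertices between small and big are too few for their unserved
-- demands to matter.

-- Finite sums

-- A linear inequality follows from a combination p of hypotheses and a ring identity.
lin : ∀ {a b l r} → l ≤ r → b + l ≡ a + r → a ≤ b
lin {a} {b} {l} {r} p eq = 0≤i-j⇒j≤i (subst (0ℤ ≤_) (e eq) (i≤j⇒0≤j-i p))
  where
  r₁ : ∀ a b l r → (b + l) - a - l ≡ b - a
  r₁ = solve-∀
  r₂ : ∀ a r l → (a + r) - a - l ≡ r - l
  r₂ = solve-∀
  e : b + l ≡ a + r → r - l ≡ b - a
  e q = trans (sym (r₂ a r l)) (trans (cong (λ t → t - a - l) (sym q)) (r₁ a b l r))

infixr 5 _⊕_
_⊕_ : ∀ {a b c d} → a ≤ b → c ≤ d → a + c ≤ b + d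
_⊕_ = +-mono-≤

infixr 6 _⊛_
_⊛_ : ∀ k {a b} → a ≤ b → + k * a ≤ + k * b
k ⊛ p = ℤₚ.*-monoˡ-≤-nonNeg (+ k) p

*-nonneg : ∀ {a b} → 0ℤ ≤ a → 0ℤ ≤ b → 0ℤ ≤ a * b
*-nonneg {+ a} {b} _ q = subst (_≤ + a * b) (*-zeroʳ (+ a)) (a ⊛ q)

*-monoˡ : ∀ {k a b} → 0ℤ ≤ k → a ≤ b → k * a ≤ k * b
*-monoˡ {+ k} _ p = k ⊛ p

square-nonneg : ∀ a → 0ℤ ≤ a * a
square-nonneg (+ a)        = *-nonneg {+ a} {+ a} (+≤+ ℕ.z≤n) (+≤+ ℕ.z≤n)
square-nonneg (ℤ.-[1+ a ]) = +≤+ ℕ.z≤n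

*-cancelˡ : ∀ {k a b} → 0ℤ < k → k * a ≤ k * b → a ≤ b
*-cancelˡ {+ suc k} {a} {b} _ p = ℤₚ.*-cancelˡ-≤-pos a b (+ suc k) p
*-cancelˡ {+ 0} (+<+ ())

0≤+ : ∀ {k} → 0ℤ ≤ + k
0≤+ = +≤+ ℕ.z≤n

≰⇒≥ : ∀ {a b} → ¬ (a ≤ b) → b ≤ a
≰⇒≥ p = ℤₚ.<⇒≤ (ℤₚ.≰⇒> p)

suc-≤ : ∀ {a b} → a < b → a + 1ℤ ≤ b
suc-≤ {a} {b} p = subst (_≤ b) (ℤₚ.+-comm 1ℤ a) (ℤₚ.i<j⇒suc[i]≤j p)

<-suc : ∀ {a b} → a + 1ℤ ≤ b → a < b
<-suc {a} {b} p = ℤₚ.suc[i]≤j⇒i<j (subst (_≤ b) (ℤₚ.+-comm a 1ℤ) p)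

≰⇒suc≤ : ∀ {a b} → ¬ (a ≤ b) → b + 1ℤ ≤ a
≰⇒suc≤ p = suc-≤ (ℤₚ.≰⇒> p)

suc≰ : ∀ {a} → ¬ (a + 1ℤ ≤ a)
suc≰ p = ℤₚ.<-irrefl refl (<-suc p)

∥_∥ : ℤ → ℤ
∥ a ∥ = + ℤ.∣ a ∣

a≤∥a∥ : ∀ a → a ≤ ∥ a ∥
a≤∥a∥ (+ a)        = ≤-refl
a≤∥a∥ (ℤ.-[1+ a ]) = -≤+

-a≤∥a∥ : ∀ a → - a ≤ ∥ a ∥
-a≤∥a∥ a = subst (λ t → - a ≤ + t) (ℤₚ.∣-i∣≡∣i∣ a) (a≤∥a∥ (- a))

∥a∥-cases : ∀ a → ∥ a ∥ ≡ a ⊎ ∥ a ∥ ≡ - a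
∥a∥-cases (+ a)        = inj₁ refl
∥a∥-cases (ℤ.-[1+ a ]) = inj₂ refl

∥a∥≤ : ∀ {a b} → a ≤ b → - a ≤ b → ∥ a ∥ ≤ b
∥a∥≤ {a} p q with ∥a∥-cases a
... | inj₁ e = subst (_≤ _) (sym e) p
... | inj₂ e = subst (_≤ _) (sym e) q

opaque
  ∑ : ∀ {n} → (Fin n → ℤ) → ℤ
  ∑ {zero}  f = 0ℤ
  ∑ {suc n} f = f zero + ∑ (f ∘ suc)

opaque
  unfolding ∑

  ∑-zero : ∀ {f : Fin 0 → ℤ} → ∑ f ≡ 0ℤ
  ∑-zero = refl

  ∑-suc : ∀ {n} (f : Fin (suc n) → ℤ) → ∑ f ≡ f zero + ∑ (f ∘ suc)
  ∑-suc f = refl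

  ∑-cong : ∀ {n} {f g : Fin n → ℤ} → (∀ i → f i ≡ g i) → ∑ f ≡ ∑ g
  ∑-cong {zero}  e = refl
  ∑-cong {suc n} e = cong₂ _+_ (e zero) (∑-cong (e ∘ suc))

  ∑-mono : ∀ {n} {f g : Fin n → ℤ} → (∀ i → f i ≤ g i) → ∑ f ≤ ∑ g
  ∑-mono {zero}  e = ≤-refl
  ∑-mono {suc n} e = e zero ⊕ ∑-mono (e ∘ suc)

  ∑-0 : ∀ {n} → ∑ {n} (λ _ → 0ℤ) ≡ 0ℤ
  ∑-0 {zero}  = refl
  ∑-0 {suc n} = trans (ℤₚ.+-identityˡ _) (∑-0 {n})

  ∑-+ : ∀ {n} (f g : Fin n → ℤ) → ∑ (λ i → f i + g i) ≡ ∑ f + ∑ g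
  ∑-+ {zero}  f g = refl
  ∑-+ {suc n} f g = trans (cong (λ t → f zero + g zero + t) (∑-+ (f ∘ suc) (g ∘ suc)))
                          (r (f zero) (g zero) (∑ (f ∘ suc)) (∑ (g ∘ suc)))
    where
    r : ∀ a b c d → (a + b) + (c + d) ≡ (a + c) + (b + d)
    r = solve-∀

  ∑-* : ∀ {n} c (f : Fin n → ℤ) → ∑ (λ i → c * f i) ≡ c * ∑ f
  ∑-* {zero}  c f = sym (*-zeroʳ c)
  ∑-* {suc n} c f = trans (cong (λ t → c * f zero + t) (∑-* c (f ∘ suc)))
                          (sym (ℤₚ.*-distribˡ-+ c (f zero) (∑ (f ∘ suc))))

  ∑-swap : ∀ {m n} (f : Fin m → Fin n → ℤ) → ∑ (λ i → ∑ (f i)) ≡ ∑ (λ j → ∑ (λ i → f i j))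
  ∑-swap {zero} {n} f = sym (∑-0 {n})
  ∑-swap {suc m} f = trans (cong (λ t → ∑ (f zero) + t) (∑-swap (f ∘ suc))) (sym (∑-+ (f zero) _))

∑-*ʳ : ∀ {n} c (f : Fin n → ℤ) → ∑ (λ i → f i * c) ≡ ∑ f * c
∑-*ʳ c f = trans (∑-cong (λ i → *-comm (f i) c)) (trans (∑-* c f) (*-comm c (∑ f)))

∑-neg : ∀ {n} (f : Fin n → ℤ) → ∑ (λ i → - f i) ≡ - ∑ f
∑-neg f = trans (∑-cong (λ i → r (f i))) (trans (∑-* (- 1ℤ) f) (sym (r (∑ f))))
  where
  r : ∀ a → - a ≡ - 1ℤ * a
  r = solve-∀

∑-nonneg : ∀ {n} {f : Fin n → ℤ} → (∀ i → 0ℤ ≤ f i) → 0ℤ ≤ ∑ f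
∑-nonneg {n} {f} p = subst (_≤ ∑ f) (∑-0 {n}) (∑-mono p)

⟦_⟧ : Bool → ℤ
⟦ true ⟧  = 1ℤ
⟦ false ⟧ = 0ℤ

0≤⟦_⟧ : ∀ b → 0ℤ ≤ ⟦ b ⟧
0≤⟦ true ⟧  = 0≤+
0≤⟦ false ⟧ = 0≤+

⟦_⟧≤1 : ∀ b → ⟦ b ⟧ ≤ 1ℤ
⟦ true ⟧≤1  = ≤-refl
⟦ false ⟧≤1 = 0≤+

_==_ : ∀ {n} → Fin n → Fin n → Bool
i == j = does (i ≟ j)

==-refl : ∀ {n} (i : Fin n) → (i == i) ≡ true
==-refl i with i ≟ i
... | yes _ = refl
... | no ¬p = contradiction refl ¬p

==-neq : ∀ {n} {i j : Fin n} → i ≢ j → (i == j) ≡ false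
==-neq {i = i} {j} p with i ≟ j
... | yes e = contradiction e p
... | no _  = refl

==-sound : ∀ {n} {i j : Fin n} → (i == j) ≡ true → i ≡ j
==-sound {i = i} {j} p with i ≟ j
... | yes e = e
==-sound {i = i} {j} () | no _

opaque
  unfolding ∑

  ∑-δ : ∀ {n} (i : Fin n) (f : Fin n → ℤ) → ∑ (λ j → ⟦ i == j ⟧ * f j) ≡ f i
  ∑-δ {suc n} zero f = trans (cong₂ _+_ (*-identityˡ (f zero)) (∑-0 {n})) (ℤₚ.+-identityʳ (f zero))
  ∑-δ {suc n} (suc i) f = trans (ℤₚ.+-identityˡ _) (∑-δ i (f ∘ suc))

∑-fibre : ∀ {m n} (f : Fin m → Fin n) (w : Fin m → ℤ) (x : Fin n → ℤ) →
  ∑ (λ j → ∑ (λ i → ⟦ f i == j ⟧ * w i) * x j) ≡ ∑ (λ i → w i * x (f i))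
∑-fibre f w x = begin
  ∑ (λ j → ∑ (λ i → ⟦ f i == j ⟧ * w i) * x j)
    ≡⟨ ∑-cong (λ j → sym (∑-*ʳ (x j) (λ i → ⟦ f i == j ⟧ * w i))) ⟩
  ∑ (λ j → ∑ (λ i → ⟦ f i == j ⟧ * w i * x j))
    ≡⟨ ∑-swap (λ j i → ⟦ f i == j ⟧ * w i * x j) ⟩
  ∑ (λ i → ∑ (λ j → ⟦ f i == j ⟧ * w i * x j))
    ≡⟨ ∑-cong (λ i → ∑-cong (λ j → r ⟦ f i == j ⟧ (w i) (x j))) ⟩
  ∑ (λ i → ∑ (λ j → w i * (⟦ f i == j ⟧ * x j)))
    ≡⟨ ∑-cong (λ i → trans (∑-* (w i) (λ j → ⟦ f i == j ⟧ * x j)) (cong (w i *_) (∑-δ (f i) x))) ⟩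
  ∑ (λ i → w i * x (f i)) ∎
  where
  open ≡-Reasoning
  r : ∀ a b c → a * b * c ≡ b * (a * c)
  r = solve-∀

∑-term≤ : ∀ {n} {f : Fin n → ℤ} → (∀ i → 0ℤ ≤ f i) → ∀ i → f i ≤ ∑ f
∑-term≤ {f = f} p i = subst (_≤ ∑ f) (∑-δ i f)
  (∑-mono (λ j → lem (i == j) (p j)))
  where
  lem : ∀ b {a} → 0ℤ ≤ a → ⟦ b ⟧ * a ≤ a
  lem true  {a} q = ≤-reflexive (*-identityˡ a)
  lem false {a} q = q

∑-update : ∀ {n} (u : Fin n) (f : Fin n → ℤ) →
  ∑ f ≡ f u + ∑ (λ v → (1ℤ - ⟦ u == v ⟧) * f v)
∑-update u f = begin
  ∑ f ≡⟨ ∑-cong (λ v → r ⟦ u == v ⟧ (f v)) ⟩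
  ∑ (λ v → ⟦ u == v ⟧ * f v + (1ℤ - ⟦ u == v ⟧) * f v)
    ≡⟨ ∑-+ (λ v → ⟦ u == v ⟧ * f v) _ ⟩
  ∑ (λ v → ⟦ u == v ⟧ * f v) + ∑ (λ v → (1ℤ - ⟦ u == v ⟧) * f v)
    ≡⟨ cong (λ t → t + ∑ (λ v → (1ℤ - ⟦ u == v ⟧) * f v)) (∑-δ u f) ⟩
  f u + ∑ (λ v → (1ℤ - ⟦ u == v ⟧) * f v) ∎
  where
  open ≡-Reasoning
  r : ∀ b x → x ≡ b * x + (1ℤ - b) * x
  r = solve-∀

-- Exchanging a matching edge changes the status of two vertices only: their terms are kept exact,
-- all others need just a pointwise bound.
∑-mono-except : ∀ {n} {u x : Fin n} (f g : Fin n → ℤ) → u ≢ x →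
  (∀ v → v ≢ u → v ≢ x → f v ≤ g v) → ∑ f + (g u + g x) ≤ ∑ g + (f u + f x)
∑-mono-except {n} {u} {x} f g u≢x p = lin (∑-mono q) (begin
  ∑ g + (f u + f x) + ∑ (out f)   ≡⟨ cong (λ t → t + (f u + f x) + ∑ (out f)) (split g) ⟩
  g u + (g x + ∑ (out g)) + (f u + f x) + ∑ (out f) ≡⟨ r (g u) (g x) (∑ (out g)) (f u) (f x) (∑ (out f)) ⟩
  (f u + (f x + ∑ (out f))) + (g u + g x) + ∑ (out g) ≡⟨ cong (λ t → t + (g u + g x) + ∑ (out g)) (sym (split f)) ⟩
  ∑ f + (g u + g x) + ∑ (out g) ∎)
  where
  open ≡-Reasoning
  out : (Fin n → ℤ) → Fin n → ℤ
  out h v = (1ℤ - ⟦ x == v ⟧) * ((1ℤ - ⟦ u == v ⟧) * h v)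
  split : ∀ h → ∑ h ≡ h u + (h x + ∑ (out h))
  split h = trans (∑-update u h) (cong (λ t → h u + t)
    (trans (∑-update x (λ v → (1ℤ - ⟦ u == v ⟧) * h v))
      (cong (λ t → t + ∑ (out h)) (trans (cong (λ b → (1ℤ - ⟦ b ⟧) * h x) (==-neq u≢x)) (*-identityˡ (h x))))))
  q : ∀ v → out f v ≤ out g v
  q v with x ≟ v | u ≟ v
  ... | yes _ | _     = ≤-refl
  ... | no _  | yes _ = ≤-refl
  ... | no a  | no b  = *-monoˡ (0≤+ {1}) (*-monoˡ (0≤+ {1}) (p v (b ∘ sym) (a ∘ sym)))
  r : ∀ a b c d e f → a + (b + c) + (d + e) + f ≡ (d + (e + f)) + (a + b) + c
  r = solve-∀

-- Independent random signs

sgn : Bool → ℤ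
sgn true  = 1ℤ
sgn false = - 1ℤ

infixr 5 _◂_
_◂_ : ∀ {n} → Bool → (Fin n → Bool) → Fin (suc n) → Bool
(b ◂ s) zero    = b
(b ◂ s) (suc i) = s i

-- The sum of F over all sign vectors s, weighted by ∏ (W ± d i): up to the
-- factor (2W)ⁿ this is an expectation for independent signs of mean d i / W.
𝔼 : ∀ {n} → ℤ → (Fin n → ℤ) → ((Fin n → Bool) → ℤ) → ℤ
𝔼 {zero}  W d F = F (λ ())
𝔼 {suc n} W d F = (W + d zero) * 𝔼 W (d ∘ suc) (λ s → F (true ◂ s))
                + (W - d zero) * 𝔼 W (d ∘ suc) (λ s → F (false ◂ s))

mass : ℕ → ℤ → ℤ
mass zero    W = 1ℤ
mass (suc n) W = + 2 * W * mass n W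

𝔼-const : ∀ {n} W (d : Fin n → ℤ) c → 𝔼 W d (λ _ → c) ≡ mass n W * c
𝔼-const {zero}  W d c = sym (*-identityˡ c)
𝔼-const {suc n} W d c rewrite 𝔼-const W (d ∘ suc) c = r W (d zero) (mass n W) c
  where
  r : ∀ W d M c → (W + d) * (M * c) + (W - d) * (M * c) ≡ + 2 * W * M * c
  r = solve-∀

𝔼-cong : ∀ {n} W (d : Fin n → ℤ) {F G : (Fin n → Bool) → ℤ} →
  (∀ s → F s ≡ G s) → 𝔼 W d F ≡ 𝔼 W d G
𝔼-cong {zero}  W d e = e (λ ())
𝔼-cong {suc n} W d e = cong₂ (λ a b → (W + d zero) * a + (W - d zero) * b)
  (𝔼-cong W (d ∘ suc) (λ s → e (true ◂ s))) (𝔼-cong W (d ∘ suc) (λ s → e (false ◂ s)))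

𝔼-+ : ∀ {n} W (d : Fin n → ℤ) (F G : (Fin n → Bool) → ℤ) →
  𝔼 W d (λ s → F s + G s) ≡ 𝔼 W d F + 𝔼 W d G
𝔼-+ {zero}  W d F G = refl
𝔼-+ {suc n} W d F G
  rewrite 𝔼-+ W (d ∘ suc) (λ s → F (true ◂ s)) (λ s → G (true ◂ s))
        | 𝔼-+ W (d ∘ suc) (λ s → F (false ◂ s)) (λ s → G (false ◂ s)) =
  r (W + d zero) (W - d zero) _ _ _ _
  where
  r : ∀ p q a b c e → p * (a + b) + q * (c + e) ≡ p * a + q * c + (p * b + q * e)
  r = solve-∀

𝔼-* : ∀ {n} W (d : Fin n → ℤ) c (F : (Fin n → Bool) → ℤ) →
  𝔼 W d (λ s → c * F s) ≡ c * 𝔼 W d F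
𝔼-* {zero}  W d c F = refl
𝔼-* {suc n} W d c F
  rewrite 𝔼-* W (d ∘ suc) c (λ s → F (true ◂ s))
        | 𝔼-* W (d ∘ suc) c (λ s → F (false ◂ s)) =
  r (W + d zero) (W - d zero) c _ _
  where
  r : ∀ p q c a b → p * (c * a) + q * (c * b) ≡ c * (p * a + q * b)
  r = solve-∀

opaque
  unfolding ∑

  𝔼-∑ : ∀ {n k} W (d : Fin n → ℤ) (F : Fin k → (Fin n → Bool) → ℤ) →
    𝔼 W d (λ s → ∑ (λ i → F i s)) ≡ ∑ (λ i → 𝔼 W d (F i))
  𝔼-∑ {n} {zero}  W d F = trans (𝔼-const W d 0ℤ) (*-zeroʳ (mass n W))
  𝔼-∑ {n} {suc k} W d F = trans (𝔼-+ W d (F zero) _)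
    (cong (λ t → 𝔼 W d (F zero) + t) (𝔼-∑ W d (F ∘ suc)))

𝔼-sgn : ∀ {n} W (d : Fin n → ℤ) i → W * 𝔼 W d (λ s → sgn (s i)) ≡ mass n W * d i
𝔼-sgn {suc n} W d zero
  rewrite 𝔼-const W (d ∘ suc) 1ℤ | 𝔼-const W (d ∘ suc) (- 1ℤ) = r W (d zero) (mass n W)
  where
  r : ∀ W d M → W * ((W + d) * (M * 1ℤ) + (W - d) * (M * - 1ℤ)) ≡ + 2 * W * M * d
  r = solve-∀
𝔼-sgn {suc n} W d (suc i) =
  trans (r₁ W (d zero) _) (trans (cong (+ 2 * W *_) (𝔼-sgn W (d ∘ suc) i)) (r₂ W (mass n W) (d (suc i))))
  where
  r₁ : ∀ W d e → W * ((W + d) * e + (W - d) * e) ≡ + 2 * W * (W * e)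
  r₁ = solve-∀
  r₂ : ∀ W M d → + 2 * W * (M * d) ≡ + 2 * W * M * d
  r₂ = solve-∀

𝔼-sgn-sgn : ∀ {n} W (d : Fin n → ℤ) i j → i ≢ j →
  W * W * 𝔼 W d (λ s → sgn (s i) * sgn (s j)) ≡ mass n W * (d i * d j)
𝔼-sgn-sgn W d zero zero p = contradiction refl p
𝔼-sgn-sgn {suc n} W d zero (suc j) p
  rewrite 𝔼-* W (d ∘ suc) 1ℤ (λ s → sgn (s j)) | 𝔼-* W (d ∘ suc) (- 1ℤ) (λ s → sgn (s j)) =
  trans (r₁ W (d zero) _) (trans (cong (+ 2 * W * d zero *_) (𝔼-sgn W (d ∘ suc) j)) (r₂ W (d zero) (mass n W) _))
  where
  r₁ : ∀ W d e → W * W * ((W + d) * (1ℤ * e) + (W - d) * (- 1ℤ * e)) ≡ + 2 * W * d * (W * e)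
  r₁ = solve-∀
  r₂ : ∀ W d M e → + 2 * W * d * (M * e) ≡ + 2 * W * M * (d * e)
  r₂ = solve-∀
𝔼-sgn-sgn {suc n} W d (suc i) zero p = trans
  (cong (W * W *_) (𝔼-cong W d (λ s → *-comm (sgn (s (suc i))) (sgn (s zero)))))
  (trans (𝔼-sgn-sgn W d zero (suc i) (p ∘ sym)) (cong (mass (suc n) W *_) (*-comm (d zero) (d (suc i)))))
𝔼-sgn-sgn {suc n} W d (suc i) (suc j) p =
  trans (r₁ W (d zero) _) (trans (cong (+ 2 * W *_) (𝔼-sgn-sgn W (d ∘ suc) i j (p ∘ cong suc))) (r₂ W (mass n W) (d (suc i)) (d (suc j))))
  where
  r₁ : ∀ W d e → W * W * ((W + d) * e + (W - d) * e) ≡ + 2 * W * (W * W * e)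
  r₁ = solve-∀
  r₂ : ∀ W M d e → + 2 * W * (M * (d * e)) ≡ + 2 * W * M * (d * e)
  r₂ = solve-∀

sgn² : ∀ b → sgn b * sgn b ≡ 1ℤ
sgn² true  = refl
sgn² false = refl

opaque
  unfolding ∑

  -- Induction on the first sign: each outcome is absorbed into the constant, hence the general `c`,
  -- and the cross terms cancel because `W * sgn - d` has weighted sum zero.
  𝔼-variance : ∀ {n} W (d β : Fin n → ℤ) c →
    𝔼 W d (λ s → (c + ∑ (λ i → β i * (W * sgn (s i) - d i))) * (c + ∑ (λ i → β i * (W * sgn (s i) - d i))))
      ≡ mass n W * (c * c + ∑ (λ i → β i * β i * (W * W - d i * d i)))
  𝔼-variance {zero} W d β c = r c
    where
    r : ∀ c → (c + 0ℤ) * (c + 0ℤ) ≡ 1ℤ * (c * c + 0ℤ)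
    r = solve-∀
  𝔼-variance {suc n} W d β c = begin
    _ ≡⟨ cong₂ (λ a b → (W + d zero) * a + (W - d zero) * b)
          (𝔼-cong W (d ∘ suc) (λ s → sq (β zero * (W * 1ℤ - d zero)) (rest s)))
          (𝔼-cong W (d ∘ suc) (λ s → sq (β zero * (W * - 1ℤ - d zero)) (rest s))) ⟩
    _ ≡⟨ cong₂ (λ a b → (W + d zero) * a + (W - d zero) * b)
          (𝔼-variance W (d ∘ suc) (β ∘ suc) (c + β zero * (W * 1ℤ - d zero)))
          (𝔼-variance W (d ∘ suc) (β ∘ suc) (c + β zero * (W * - 1ℤ - d zero))) ⟩
    _ ≡⟨ r W (d zero) (β zero) c (mass n W) _ ⟩
    _ ∎
    where
    open ≡-Reasoning
    rest : (Fin n → Bool) → ℤ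
    rest s = ∑ (λ i → β (suc i) * (W * sgn (s i) - d (suc i)))
    sq : ∀ t x → (c + (t + x)) * (c + (t + x)) ≡ (c + t + x) * (c + t + x)
    sq t x = cong (λ y → y * y) (sym (ℤₚ.+-assoc c t x))
    r : ∀ W d β c M V →
      (W + d) * (M * ((c + β * (W * 1ℤ - d)) * (c + β * (W * 1ℤ - d)) + V))
        + (W - d) * (M * ((c + β * (W * - 1ℤ - d)) * (c + β * (W * - 1ℤ - d)) + V))
      ≡ + 2 * W * M * (c * c + (β * β * (W * W - d * d) + V))
    r = solve-∀

-- Conditional expectations: either value of the first sign has a vector not above its own average,
-- and the better of the two is not above the weighted mean.
𝔼-attained : ∀ {n} W (d : Fin n → ℤ) → (∀ i → 0ℤ ≤ W + d i) → (∀ i → 0ℤ ≤ W - d i) →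
  (F : (Fin n → Bool) → ℤ) → ∃ λ s → mass n W * F s ≤ 𝔼 W d F
𝔼-attained {zero}  W d p q F = (λ ()) , ≤-reflexive (*-identityˡ _)
𝔼-attained {suc n} W d p q F
  with 𝔼-attained W (d ∘ suc) (p ∘ suc) (q ∘ suc) (λ s → F (true ◂ s))
     | 𝔼-attained W (d ∘ suc) (p ∘ suc) (q ∘ suc) (λ s → F (false ◂ s))
... | s , hs | t , ht with mass n W * F (true ◂ s) ℤₚ.≤? mass n W * F (false ◂ t)
... | yes le = (true ◂ s) , lin (*-monoˡ (p zero) hs ⊕ *-monoˡ (q zero) (≤-trans le ht))
                 (r W (d zero) (mass n W) (F (true ◂ s)) _ _)
  where
  r : ∀ W d M a x y → (W + d) * x + (W - d) * y + ((W + d) * (M * a) + (W - d) * (M * a))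
    ≡ + 2 * W * M * a + ((W + d) * x + (W - d) * y)
  r = solve-∀
... | no ¬le = (false ◂ t) , lin (*-monoˡ (p zero) (≤-trans (≰⇒≥ ¬le) hs) ⊕ *-monoˡ (q zero) ht)
                 (r W (d zero) (mass n W) (F (false ◂ t)) _ _)
  where
  r : ∀ W d M a x y → (W + d) * x + (W - d) * y + ((W + d) * (M * a) + (W - d) * (M * a))
    ≡ + 2 * W * M * a + ((W + d) * x + (W - d) * y)
  r = solve-∀

mass-pos : ∀ n {W} → 0ℤ < W → 0ℤ < mass n W
mass-pos zero    p = +<+ (ℕ.s≤s ℕ.z≤n)
mass-pos (suc n) {+ suc w} p with mass n (+ suc w) | mass-pos n p
... | + suc k | _ = +<+ (ℕ.s≤s ℕ.z≤n)
... | + 0 | +<+ ()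
mass-pos (suc n) {+ 0} (+<+ ())

∥a∥² : ∀ a → ∥ a ∥ * ∥ a ∥ ≡ a * a
∥a∥² a with ∥a∥-cases a
... | inj₁ e = cong₂ _*_ e e
... | inj₂ e = trans (cong₂ _*_ e e) (r a)
  where
  r : ∀ a → - a * - a ≡ a * a
  r = solve-∀

2ab≤a²+b² : ∀ a b → + 2 * a * b ≤ a * a + b * b
2ab≤a²+b² a b = lin (square-nonneg (a - b)) (r a b)
  where
  r : ∀ a b → a * a + b * b + 0ℤ ≡ + 2 * a * b + (a - b) * (a - b)
  r = solve-∀

-- Signs that are rigid on each star, and rounding by a second moment

module Spins {n : ℕ} (W : ℤ) (d : Fin n → ℤ) (e : Fin n → Fin n → ℤ)
             (f : Fin n → Fin n) (ε b : Fin n → ℤ) where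

  spin : (Fin n → Bool) → Fin n → ℤ
  spin s v = ε v * sgn (s (f v))

  -- `W * W` times the mean of the product of the two star signs; vertices of one star share theirs.
  kernel : Fin n → Fin n → ℤ
  kernel u v = if f u == f v then W * W else d (f u) * d (f v)

  X : (Fin n → Bool) → ℤ
  X s = ∑ (λ u → ∑ (λ v → e u v * (spin s u * spin s v)))

  X̄ : ℤ
  X̄ = ∑ (λ u → ∑ (λ v → e u v * (ε u * ε v * kernel u v)))

  S : (Fin n → Bool) → ℤ
  S s = ∑ (λ v → b v * spin s v)

  S̄ : ℤ
  S̄ = ∑ (λ v → b v * ε v * d (f v))

  -- Coefficients of `S` in the independent signs. `Z` is `W` times the deviation of `S` from its
  -- mean, and `V` is the mean of its square.
  β : Fin n → ℤ
  β r = ∑ (λ v → ⟦ f v == r ⟧ * (b v * ε v))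

  Z : (Fin n → Bool) → ℤ
  Z s = ∑ (λ r → β r * (W * sgn (s r) - d r))

  V : ℤ
  V = ∑ (λ r → β r * β r * (W * W - d r * d r))

  𝔼-pair : ∀ u v → W * W * 𝔼 W d (λ s → sgn (s (f u)) * sgn (s (f v))) ≡ mass n W * kernel u v
  𝔼-pair u v with f u ≟ f v
  ... | no p  = 𝔼-sgn-sgn W d (f u) (f v) p
  ... | yes p = trans
    (cong (W * W *_) (trans (𝔼-cong W d (λ s → trans (cong (λ i → sgn (s i) * sgn (s (f v))) p) (sgn² (s (f v)))))
                            (𝔼-const W d 1ℤ)))
    (r (W * W) (mass n W))
    where
    r : ∀ a b → a * (b * 1ℤ) ≡ b * a
    r = solve-∀

  𝔼-X : W * W * 𝔼 W d X ≡ mass n W * X̄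
  𝔼-X = begin
    W * W * 𝔼 W d X
      ≡⟨ cong (W * W *_) (𝔼-∑ W d _) ⟩
    W * W * ∑ (λ u → 𝔼 W d (λ s → ∑ (λ v → e u v * (spin s u * spin s v))))
      ≡⟨ sym (∑-* (W * W) _) ⟩
    ∑ (λ u → W * W * 𝔼 W d (λ s → ∑ (λ v → e u v * (spin s u * spin s v))))
      ≡⟨ ∑-cong inner ⟩
    ∑ (λ u → mass n W * ∑ (λ v → e u v * (ε u * ε v * kernel u v)))
      ≡⟨ ∑-* (mass n W) _ ⟩
    mass n W * X̄ ∎
    where
    open ≡-Reasoning
    r₁ : ∀ a x y p q → a * ((x * p) * (y * q)) ≡ a * (x * y) * (p * q)
    r₁ = solve-∀
    r₂ : ∀ w c E → w * (c * E) ≡ c * (w * E)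
    r₂ = solve-∀
    r₃ : ∀ a x y M k → a * (x * y) * (M * k) ≡ M * (a * (x * y * k))
    r₃ = solve-∀
    term : ∀ u v → W * W * 𝔼 W d (λ s → e u v * (spin s u * spin s v))
                 ≡ mass n W * (e u v * (ε u * ε v * kernel u v))
    term u v = begin
      W * W * 𝔼 W d (λ s → e u v * (spin s u * spin s v))
        ≡⟨ cong (W * W *_) (trans (𝔼-cong W d (λ s → r₁ (e u v) (ε u) (ε v) (sgn (s (f u))) (sgn (s (f v)))))
                                  (𝔼-* W d (e u v * (ε u * ε v)) _)) ⟩
      W * W * (e u v * (ε u * ε v) * 𝔼 W d (λ s → sgn (s (f u)) * sgn (s (f v))))
        ≡⟨ r₂ (W * W) (e u v * (ε u * ε v)) _ ⟩
      e u v * (ε u * ε v) * (W * W * 𝔼 W d (λ s → sgn (s (f u)) * sgn (s (f v))))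
        ≡⟨ cong (e u v * (ε u * ε v) *_) (𝔼-pair u v) ⟩
      e u v * (ε u * ε v) * (mass n W * kernel u v)
        ≡⟨ r₃ (e u v) (ε u) (ε v) (mass n W) (kernel u v) ⟩
      mass n W * (e u v * (ε u * ε v * kernel u v)) ∎
    inner : ∀ u → W * W * 𝔼 W d (λ s → ∑ (λ v → e u v * (spin s u * spin s v)))
                ≡ mass n W * ∑ (λ v → e u v * (ε u * ε v * kernel u v))
    inner u = trans (cong (W * W *_) (𝔼-∑ W d _))
      (trans (sym (∑-* (W * W) _)) (trans (∑-cong (term u)) (∑-* (mass n W) _)))

  WS≡Z+S̄ : ∀ s → W * S s ≡ Z s + S̄
  WS≡Z+S̄ s = begin
    W * S s ≡⟨ sym (∑-* W _) ⟩
    ∑ (λ v → W * (b v * spin s v)) ≡⟨ ∑-cong (λ v → r W (b v) (ε v) (sgn (s (f v))) (d (f v))) ⟩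
    ∑ (λ v → b v * ε v * (W * sgn (s (f v)) - d (f v)) + b v * ε v * d (f v)) ≡⟨ ∑-+ _ _ ⟩
    ∑ (λ v → b v * ε v * (W * sgn (s (f v)) - d (f v))) + S̄
      ≡⟨ cong (λ t → t + S̄) (sym (∑-fibre f (λ v → b v * ε v) (λ r → W * sgn (s r) - d r))) ⟩
    Z s + S̄ ∎
    where
    open ≡-Reasoning
    r : ∀ W b ε σ d → W * (b * (ε * σ)) ≡ b * ε * (W * σ - d) + b * ε * d
    r = solve-∀

  𝔼-Z² : 𝔼 W d (λ s → Z s * Z s) ≡ mass n W * V
  𝔼-Z² = trans (𝔼-cong W d (λ s → cong (λ z → z * z) (sym (ℤₚ.+-identityˡ (Z s)))))
    (trans (𝔼-variance W d β 0ℤ) (cong (mass n W *_) (ℤₚ.+-identityˡ V)))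

  -- One potential controls `X` and `∥ S ∥` together: some sign vector does not exceed its mean, and
  -- AM-GM turns the squared deviation back into an absolute value.
  rounding : 0ℤ < W → (∀ i → 0ℤ ≤ W + d i) → (∀ i → 0ℤ ≤ W - d i) →
    ∀ {N M} → 0ℤ ≤ N → 0ℤ < M → N * N * V ≤ M * M * (W * W) →
    ∃ λ s → N * (W * W * (X s + ∥ S s ∥)) ≤ N * (X̄ + W * ∥ S̄ ∥) + M * (W * W)
  rounding W>0 p q {N} {M} 0≤N M>0 small = s , lin (*-monoˡ (*-nonneg 0≤N 0≤W) abs ⊕ main) (r₄ N M W (X s) (∥ S s ∥) X̄ (∥ S̄ ∥) (∥ Z s ∥))
    where
    0≤W : 0ℤ ≤ W
    0≤W = ℤₚ.<⇒≤ W>0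
    F : (Fin n → Bool) → ℤ
    -- The factor 2NM is chosen so that N²Z² ≥ 2NMW|Z| - M²W² gives |Z| a coefficient matching that
    -- of `X`.
    F s = + 2 * N * M * (W * W) * X s + N * N * (Z s * Z s)
    𝔼F : 𝔼 W d F ≡ mass n W * (+ 2 * N * M * X̄ + N * N * V)
    𝔼F = trans (𝔼-+ W d (λ s → + 2 * N * M * (W * W) * X s) _)
      (trans (cong₂ _+_ (trans (𝔼-* W d (+ 2 * N * M * (W * W)) X)
                          (trans (ℤₚ.*-assoc (+ 2 * N * M) (W * W) _) (cong (+ 2 * N * M *_) 𝔼-X)))
                        (trans (𝔼-* W d (N * N) (λ s → Z s * Z s)) (cong (N * N *_) 𝔼-Z²)))
        (r₀ (+ 2 * N * M) (N * N) (mass n W) X̄ V))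
      where
      r₀ : ∀ a b m x v → a * (m * x) + b * (m * v) ≡ m * (a * x + b * v)
      r₀ = solve-∀
    att : ∃ λ s → mass n W * F s ≤ 𝔼 W d F
    att = 𝔼-attained W d p q F
    s : Fin n → Bool
    s = proj₁ att
    potential : F s ≤ + 2 * N * M * X̄ + N * N * V
    potential = *-cancelˡ (mass-pos n W>0) (subst (mass n W * F s ≤_) 𝔼F (proj₂ att))
    r₁ : ∀ N M W z X X̄ Y V → + 2 * M * (N * X̄ + M * (W * W))
      + (+ 2 * (N * z) * (M * W) + ((+ 2 * N * M * (W * W) * X + N * N * Y) + N * N * V))
      ≡ + 2 * M * (N * (W * W * X + W * z))
      + (N * N * Y + M * W * (M * W) + ((+ 2 * N * M * X̄ + N * N * V) + M * M * (W * W)))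
    r₁ = solve-∀
    r₂ : ∀ N z → N * z * (N * z) ≡ N * N * (z * z)
    r₂ = solve-∀
    amgm : + 2 * (N * ∥ Z s ∥) * (M * W) ≤ N * N * (Z s * Z s) + M * W * (M * W)
    amgm = subst (λ t → + 2 * (N * ∥ Z s ∥) * (M * W) ≤ t + M * W * (M * W))
      (trans (r₂ N (∥ Z s ∥)) (cong (N * N *_) (∥a∥² (Z s)))) (2ab≤a²+b² (N * ∥ Z s ∥) (M * W))
    2M>0 : ∀ {M} → 0ℤ < M → 0ℤ < + 2 * M
    2M>0 {+ suc m} _ = +<+ (ℕ.s≤s ℕ.z≤n)
    2M>0 {+ 0} (+<+ ())
    main : N * (W * W * X s + W * ∥ Z s ∥) ≤ N * X̄ + M * (W * W)
    main = *-cancelˡ (2M>0 M>0) (lin (amgm ⊕ potential ⊕ small)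
      (r₁ N M W (∥ Z s ∥) (X s) X̄ (Z s * Z s) V))
    abs : W * ∥ S s ∥ ≤ ∥ Z s ∥ + ∥ S̄ ∥
    abs with ∥a∥-cases (S s)
    ... | inj₁ eq = subst₂ _≤_ (trans (sym (WS≡Z+S̄ s)) (cong (W *_) (sym eq))) refl (a≤∥a∥ (Z s) ⊕ a≤∥a∥ S̄)
    ... | inj₂ eq = subst₂ _≤_ (trans (r₅ (Z s) S̄) (trans (cong -_ (sym (WS≡Z+S̄ s))) (trans (ℤₚ.neg-distribʳ-* W (S s)) (cong (W *_) (sym eq))))) refl
          (-a≤∥a∥ (Z s) ⊕ -a≤∥a∥ S̄)
      where
      r₅ : ∀ a b → - a + - b ≡ - (a + b)
      r₅ = solve-∀
    r₄ : ∀ N M W x y X̄ s̄ z → N * (X̄ + W * s̄) + M * (W * W) + (N * W * (W * y) + N * (W * W * x + W * z))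
       ≡ N * (W * W * (x + y)) + (N * W * (z + s̄) + (N * X̄ + M * (W * W)))
    r₄ = solve-∀

-- Partition of a sparse graph into stars

argmax-Fin : ∀ {n} → Fin n → (F : Fin n → ℤ) → ∃ λ i → ∀ j → F j ≤ F i
argmax-Fin {suc zero} _ F = zero , λ { zero → ≤-refl }
argmax-Fin {suc (suc n)} _ F with argmax-Fin zero (F ∘ suc)
... | i , hi with F zero ℤₚ.≤? F (suc i)
... | yes le = suc i , λ { zero → le ; (suc j) → hi j }
... | no ¬le = zero , λ { zero → ≤-refl ; (suc j) → ≤-trans (hi j) (≰⇒≥ ¬le) }

argmax-Vec : ∀ {n k} → Vec (Fin n) k → (F : Vec (Fin n) k → ℤ) → ∃ λ v → ∀ w → F w ≤ F v
argmax-Vec []       F = [] , λ { [] → ≤-refl }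
argmax-Vec (x ∷ xs) F with argmax-Fin x (λ a → F (a ∷ proj₁ (argmax-Vec xs (λ w → F (a ∷ w)))))
... | a , ha = (a ∷ proj₁ (argmax-Vec xs (λ w → F (a ∷ w)))) ,
  λ { (b ∷ w) → ≤-trans (proj₂ (argmax-Vec xs (λ w → F (b ∷ w))) w) (ha b) }

∑-count : ∀ {n} (u : Fin n) → ∑ (λ v → ⟦ u == v ⟧) ≡ 1ℤ
∑-count u = trans (∑-cong (λ v → sym (ℤₚ.*-identityʳ ⟦ u == v ⟧))) (∑-δ u (λ _ → 1ℤ))

∑-const : ∀ {n} c → ∑ {n} (λ _ → c) ≡ + n * c
∑-const {zero}  c = trans ∑-zero (sym (ℤₚ.*-zeroˡ c))
∑-const {suc n} c = trans (∑-suc (λ _ → c)) (trans (cong (λ t → c + t) (∑-const {n} c)) (sym (r (+ n) c)))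
  where
  r : ∀ m c → (1ℤ + m) * c ≡ c + m * c
  r = solve-∀

∑-unique : ∀ {n} (p : Fin n → Bool) → (∀ u v → p u ≡ true → p v ≡ true → u ≡ v) → ∑ (⟦_⟧ ∘ p) ≤ 1ℤ
∑-unique {n} p uniq with any? (λ u → p u 𝔹ₚ.≟ true)
... | yes (u , pu) = subst (∑ (⟦_⟧ ∘ p) ≤_) (∑-count u) (∑-mono le)
  where
  le : ∀ v → ⟦ p v ⟧ ≤ ⟦ u == v ⟧
  le v with p v in pv
  ... | false = 0≤⟦ u == v ⟧
  ... | true rewrite uniq u v pu pv | ==-refl v = ≤-refl
... | no ¬p = ≤-trans (∑-mono le) (subst (_≤ 1ℤ) (sym (∑-0 {n})) 0≤+)
  where
  le : ∀ v → ⟦ p v ⟧ ≤ 0ℤ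
  le v with p v in pv
  ... | false = ≤-refl
  ... | true  = contradiction (v , pv) ¬p

∑-involution : ∀ {n} (μ : Fin n → Fin n) → (∀ v → μ (μ v) ≡ v) → (x : Fin n → ℤ) →
  ∑ (x ∘ μ) ≡ ∑ x
∑-involution μ inv x = begin
  ∑ (x ∘ μ) ≡⟨ ∑-cong (λ i → sym (*-identityˡ (x (μ i)))) ⟩
  ∑ (λ i → 1ℤ * x (μ i)) ≡⟨ sym (∑-fibre μ (λ _ → 1ℤ) x) ⟩
  ∑ (λ j → ∑ (λ i → ⟦ μ i == j ⟧ * 1ℤ) * x j)
    ≡⟨ ∑-cong (λ j → trans (cong (_* x j) (trans (∑-cong (λ i → trans (ℤₚ.*-identityʳ _) (cong ⟦_⟧ (flip i j)))) (∑-count (μ j))))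
                           (*-identityˡ (x j))) ⟩
  ∑ x ∎
  where
  open ≡-Reasoning
  flip : ∀ i j → (μ i == j) ≡ (μ j == i)
  flip i j with μ i ≟ j | μ j ≟ i
  ... | yes _ | yes _ = refl
  ... | no _  | no _  = refl
  ... | yes p | no q  = contradiction (trans (cong μ (sym p)) (inv i)) q
  ... | no p  | yes q = contradiction (trans (cong μ (sym q)) (inv j)) p

not-does : ∀ {P : Set} (d : Dec P) → ¬ P → does d ≡ false
not-does (yes p) ¬p = contradiction p ¬p
not-does (no _)  _  = refl

does-true : ∀ {P : Set} (d : Dec P) → P → does d ≡ true
does-true (yes _) _ = refl
does-true (no ¬p) p = contradiction p ¬p

true≢false : ∀ {b} → b ≡ true → b ≡ false → ⊥
true≢false refl ()

-- A partition into induced stars: v is the centre of its star if root v ≡ v and a leaf otherwise.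
record IsStarMap {n} (h : Fin n → Fin n → Bool) (small : Fin n → Bool) (root : Fin n → Fin n) : Set where
  field
    root-root   : ∀ {v} → root v ≢ v → root (root v) ≡ root v
    leaf-small  : ∀ {v} → root v ≢ v → small v ≡ true
    leaf-nbr    : ∀ {v} → root v ≢ v → h v (root v) ∨ h (root v) v ≡ true
    independent : ∀ {u v} → root u ≢ u → root v ≢ v → root u ≡ root v → h u v ∨ h v u ≡ false

-- Which end of a matching edge becomes the centre, by priority: an end chosen by an attached leaf,
-- then an end that is not small, then the smaller index.
prefer : Bool → Bool → Bool → Bool → Bool → Bool
prefer true  _     _     _     _ = true
prefer false true  _     _     _ = false
prefer false false true  _     _ = true
prefer false false false true  _ = false
prefer false false false false l = l

prefer-anti : ∀ a b m m′ {l l′} → (a ≡ true → b ≡ true → ⊥) → (m ≡ true → m′ ≡ true → ⊥) →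
  l′ ≡ not l → prefer b a m′ m l′ ≡ not (prefer a b m m′ l)
prefer-anti true  true  _     _     p _ _ = contradiction refl (p refl)
prefer-anti true  false _     _     _ _ _ = refl
prefer-anti false true  _     _     _ _ _ = refl
prefer-anti false false true  true  _ q _ = contradiction refl (q refl)
prefer-anti false false true  false _ _ _ = refl
prefer-anti false false false true  _ _ _ = refl
prefer-anti false false false false _ _ e = e

-- The demands `c` are to be paid by the arcs inside stars, at the rate of `star-bound`. Leaves have
-- to be small so that the total degree of a star stays comparable to that of its centre.
module Stars {n : ℕ} (h : Fin n → Fin n → Bool) (irreflexive : ∀ v → h v v ≡ false)
             (small : Fin n → Bool) (touches : ∀ u v → h u v ≡ true → small u ≡ false → small v ≡ true)
             (c : Fin n → ℤ) (0≤c : ∀ v → 0ℤ ≤ c v) (c≤3 : ∀ v → c v ≤ + 3)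
             (c≤out : ∀ v → c v ≤ ∑ (λ w → ⟦ h v w ⟧))
             (c-small : ∀ v → small v ≡ false → c v ≡ 0ℤ) where

  nbr : Fin n → Fin n → Bool
  nbr u v = h u v ∨ h v u

  nbr-sym : ∀ u v → nbr u v ≡ nbr v u
  nbr-sym u v = 𝔹ₚ.∨-comm (h u v) (h v u)

  nbr-irr : ∀ {u v} → nbr u v ≡ true → u ≢ v
  nbr-irr {u} p refl rewrite irreflexive u = true≢false p refl

  nbr-touches : ∀ u v → nbr u v ≡ true → small u ≡ false → small v ≡ true
  nbr-touches u v p q with h u v in e₁
  ... | true = touches u v e₁ q
  ... | false with small v in e₂
  ... | true  = refl
  ... | false = contradiction (touches v u p e₂) (λ r → true≢false r q)

  a : Fin n → Fin n → ℤ
  a u v = ⟦ h u v ⟧ + ⟦ h v u ⟧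

  a-sym : ∀ u v → a u v ≡ a v u
  a-sym u v = ℤₚ.+-comm ⟦ h u v ⟧ ⟦ h v u ⟧

  a-irr : ∀ v → a v v ≡ 0ℤ
  a-irr v rewrite irreflexive v = refl

  0≤a : ∀ u v → 0ℤ ≤ a u v
  0≤a u v = 0≤⟦ h u v ⟧ ⊕ 0≤⟦ h v u ⟧

  a≤2 : ∀ u v → a u v ≤ + 2
  a≤2 u v = ⟦ h u v ⟧≤1 ⊕ ⟦ h v u ⟧≤1

  nbr⇒1≤a : ∀ u v → nbr u v ≡ true → 1ℤ ≤ a u v
  nbr⇒1≤a u v p with h u v | h v u
  ... | true  | true  = +≤+ (ℕ.s≤s ℕ.z≤n)
  ... | true  | false = ≤-refl
  ... | false | true  = ≤-refl

  ¬nbr⇒a≡0 : ∀ u v → nbr u v ≡ false → a u v ≡ 0ℤ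
  ¬nbr⇒a≡0 u v p with h u v | h v u
  ... | false | false = refl

  -- Matchings and the extremal choice

  record Matching : Set where
    field
      mate : Fin n → Fin n
      invol : ∀ v → mate (mate v) ≡ v
      adjacent : ∀ v → mate v ≢ v → nbr v (mate v) ≡ true
  open Matching

  -- Keeps `f v` only where `f` is mutual along an edge. Every function becomes a matching and
  -- matchings are unchanged, so a search over functions is a search over matchings.
  normalise : (Fin n → Fin n) → Matching
  normalise f = record { mate = m ; invol = inv ; adjacent = adj′ }
    where
    m : Fin n → Fin n
    m v = if nbr v (f v) ∧ (f (f v) == v) then f v else v
    hit : ∀ v → nbr v (f v) ≡ true → f (f v) ≡ v → m v ≡ f v
    hit v p q rewrite p | does-true (f (f v) ≟ v) q = refl
    inv : ∀ v → m (m v) ≡ v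
    inv v with nbr v (f v) in p | f (f v) ≟ v
    ... | false | _ rewrite p = refl
    ... | true | no q rewrite p | not-does (f (f v) ≟ v) q = refl
    ... | true | yes q = trans (hit (f v) (subst (λ t → nbr (f v) t ≡ true) (sym q) (trans (nbr-sym (f v) v) p)) (cong f q)) q
    adj′ : ∀ v → m v ≢ v → nbr v (m v) ≡ true
    adj′ v ne with nbr v (f v) in p | f (f v) ≟ v
    ... | false | _    = contradiction refl ne
    ... | true | no _  = contradiction refl ne
    ... | true | yes q = p

  normalise-mate : ∀ M f → (∀ v → f v ≡ mate M v) → ∀ v → mate (normalise f) v ≡ mate M v
  normalise-mate M f e v with mate M v ≟ v
  ... | no ne rewrite e v | e (mate M v) | adjacent M v ne | does-true (mate M (mate M v) ≟ v) (invol M v) = refl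
  ... | yes q rewrite e v | q | irreflexive v = refl

  Extensional : ((Fin n → Fin n) → ℤ) → Set
  Extensional F = ∀ μ ν → (∀ v → μ v ≡ ν v) → F μ ≡ F ν

  opaque
    argmax : (F : (Fin n → Fin n) → ℤ) → Extensional F → ∃ λ M → ∀ M′ → F (mate M′) ≤ F (mate M)
    argmax F ext with argmax-Vec (tabulate (λ v → v)) (λ w → F (mate (normalise (lookup w))))
    ... | w , hw = normalise (lookup w) , λ M′ →
      subst (_≤ F (mate (normalise (lookup w))))
        (ext _ _ (normalise-mate M′ (lookup (tabulate (mate M′))) (lookup∘tabulate (mate M′))))
        (hw (tabulate (mate M′)))

  matched : (Fin n → Fin n) → Fin n → Bool
  matched μ v = not (μ v == v)

  weight : (Fin n → Fin n) → Fin n → ℤ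
  weight μ v = (+ 2 * + n + 1ℤ) * (⟦ matched μ v ⟧ * ⟦ small v ⟧) + a v (μ v)

  Φ : (Fin n → Fin n) → ℤ
  Φ μ = ∑ (weight μ)

  -- An edge is worth 14 per arc. Each end holds half, `7 * a`, and pays its own demand `2 * c`; the
  -- rest may be claimed by a vertex adjacent to both ends.
  claim : (Fin n → Fin n) → Fin n → Fin n → ℤ
  claim μ u v = ⟦ nbr u v ∧ nbr u (μ v) ⟧ * (+ 7 * a v (μ v) - + 2 * c v)

  Closed : (Fin n → Fin n) → Fin n → Set
  Closed μ u = ∀ v → nbr u v ≡ true → nbr u (μ v) ≡ true

  -- u cannot become a leaf of a star, and the edges it claims have too little surplus to pay for u.
  Bad : (Fin n → Fin n) → Fin n → Set
  Bad μ u = small u ≡ true × μ u ≡ u × Closed μ u × ∑ (claim μ u) + 1ℤ ≤ + 2 * c u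

  opaque
    closed? : ∀ μ u → Dec (Closed μ u)
    closed? μ u = all? (λ v → (nbr u v 𝔹ₚ.≟ true) →-dec (nbr u (μ v) 𝔹ₚ.≟ true))

    bad? : ∀ μ u → Dec (Bad μ u)
    bad? μ u = (small u 𝔹ₚ.≟ true) ×-dec ((μ u ≟ u) ×-dec (closed? μ u ×-dec (∑ (claim μ u) + 1ℤ ℤₚ.≤? + 2 * c u)))

  isBad : (Fin n → Fin n) → Fin n → Bool
  isBad μ u = does (bad? μ u)

  -- Lexicographic: the number of covered small vertices, the number of arcs along the matching
  -- (at most 2n, hence the factor 2n + 1 in weight), and the number of vertices that are not bad.
  Ω : (Fin n → Fin n) → ℤ
  Ω μ = (+ n + 1ℤ) * Φ μ + ∑ (λ u → ⟦ not (isBad μ u) ⟧)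

  -- Badness of `u` sees the matching only at `u` and at its neighbours.
  bad-local : ∀ μ ν u → (μ u ≡ u → ν u ≡ u) → (∀ v → nbr u v ≡ true → μ v ≡ ν v) → Bad μ u → Bad ν u
  bad-local μ ν u fix e (s , m , cl , lt) = s , fix m ,
    (λ v p → subst (λ t → nbr u t ≡ true) (e v p) (cl v p)) ,
    subst (λ t → t + 1ℤ ≤ + 2 * c u) (∑-cong same) lt
    where
    same : ∀ v → claim μ u v ≡ claim ν u v
    same v with nbr u v in p
    ... | false = refl
    ... | true rewrite e v p = refl

  isBad-ext : ∀ μ ν → (∀ v → μ v ≡ ν v) → ∀ u → isBad μ u ≡ isBad ν u
  isBad-ext μ ν e u with bad? μ u | bad? ν u
  ... | yes _ | yes _ = refl
  ... | no _  | no _  = refl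
  ... | yes p | no q  = contradiction (bad-local μ ν u (λ m → trans (sym (e u)) m) (λ v _ → e v) p) q
  ... | no p  | yes q = contradiction (bad-local ν μ u (λ m → trans (e u) m) (λ v _ → sym (e v)) q) p

  Φ-ext : Extensional Φ
  Φ-ext μ ν e = ∑-cong (λ v → cong (λ t → (+ 2 * + n + 1ℤ) * (⟦ not (t == v) ⟧ * ⟦ small v ⟧) + a v t) (e v))

  Ω-ext : Extensional Ω
  Ω-ext μ ν e = cong₂ (λ s t → (+ n + 1ℤ) * s + t) (Φ-ext μ ν e)
    (∑-cong (λ u → cong (⟦_⟧ ∘ not) (isBad-ext μ ν e u)))

  Optimal : Matching → Set
  Optimal M = ∀ M′ → Ω (mate M′) ≤ Ω (mate M)

  -- The number of vertices that are not bad is at most n, below the factor n + 1 of `Φ` in `Ω`.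
  optimal-Φ : ∀ M → Optimal M → ∀ M′ → Φ (mate M′) ≤ Φ (mate M)
  optimal-Φ M opt M′ with Φ (mate M′) ℤₚ.≤? Φ (mate M)
  ... | yes p = p
  ... | no ¬p = contradiction
    (lin (opt M′ ⊕ (suc n ⊛ ≰⇒suc≤ ¬p) ⊕ ∑-nonneg (λ u → 0≤⟦ not (isBad (mate M′) u) ⟧)
          ⊕ subst (∑ (λ u → ⟦ not (isBad (mate M) u) ⟧) ≤_) (∑-const {n} 1ℤ) (∑-mono (λ u → ⟦ not (isBad (mate M) u) ⟧≤1)))
      (r (+ n) (Φ (mate M)) (Φ (mate M′)) _ _))
    (suc≰ {+ n})
    where
    r : ∀ k x y s t → k + ((k + 1ℤ) * y + s + ((1ℤ + k) * (x + 1ℤ) + (0ℤ + t)))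
      ≡ (k + 1ℤ) + ((k + 1ℤ) * x + t + ((1ℤ + k) * y + (s + k * 1ℤ))) 
    r = solve-∀

  -- The only move: the unmatched vertex u takes y, whose former mate becomes free.
  module Steal (M : Matching) (u y : Fin n) (free : mate M u ≡ u) (uy : nbr u y ≡ true) where

    x : Fin n
    x = mate M y

    u≢y : u ≢ y
    u≢y = nbr-irr uy

    x≢u : x ≢ u
    x≢u e = u≢y (trans (sym free) (trans (cong (mate M) (sym e)) (invol M y)))

    opaque
      stolen : Fin n → Fin n
      stolen v with v ≟ u | v ≟ y | v ≟ x
      ... | yes _ | _     | _     = y
      ... | no _  | yes _ | _     = u
      ... | no _  | no _  | yes _ = v
      ... | no _  | no _  | no _  = mate M v

      at-u : stolen u ≡ y
      at-u with u ≟ u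
      ... | yes _ = refl
      ... | no p  = contradiction refl p

      at-y : stolen y ≡ u
      at-y with y ≟ u | y ≟ y
      ... | yes p | _     = contradiction (sym p) u≢y
      ... | no _  | yes _ = refl
      ... | no _  | no p  = contradiction refl p

      at-x : ∀ {v} → v ≡ x → v ≢ y → stolen v ≡ v
      at-x {v} e v≢y with v ≟ u | v ≟ y | v ≟ x
      ... | yes p | _     | _     = contradiction (trans (sym e) p) x≢u
      ... | no _  | yes p | _     = contradiction p v≢y
      ... | no _  | no _  | yes _ = refl
      ... | no _  | no _  | no p  = contradiction e p

      elsewhere : ∀ {v} → v ≢ u → v ≢ y → v ≢ x → stolen v ≡ mate M v
      elsewhere {v} a b c with v ≟ u | v ≟ y | v ≟ x
      ... | yes p | _     | _     = contradiction p a
      ... | no _  | yes p | _     = contradiction p b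
      ... | no _  | no _  | yes p = contradiction p c
      ... | no _  | no _  | no _  = refl

      stolen-invol : ∀ v → stolen (stolen v) ≡ v
      stolen-invol v with v ≟ u | v ≟ y | v ≟ x
      ... | yes p | _     | _     = trans at-y (sym p)
      ... | no _  | yes p | _     = trans at-u (sym p)
      ... | no _  | no q  | yes p = at-x p q
      ... | no p  | no q  | no r  = trans
        (elsewhere (λ e → p (trans (sym (invol M v)) (trans (cong (mate M) e) free)))
                   (λ e → r (trans (sym (invol M v)) (cong (mate M) e)))
                   (λ e → q (trans (sym (invol M v)) (trans (cong (mate M) e) (invol M y)))))
        (invol M v)

      stolen-adjacent : ∀ v → stolen v ≢ v → nbr v (stolen v) ≡ true
      stolen-adjacent v ne with v ≟ u | v ≟ y | v ≟ x
      ... | yes refl | _     | _     = uy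
      ... | no _  | yes refl | _     = trans (nbr-sym y u) uy
      ... | no _  | no _  | yes _ = contradiction refl ne
      ... | no _  | no _  | no _  = adjacent M v ne

    result : Matching
    result = record { mate = stolen ; invol = stolen-invol ; adjacent = stolen-adjacent }

  covers : (Fin n → Fin n) → Fin n → ℤ
  covers μ v = ⟦ matched μ v ⟧ * ⟦ small v ⟧

  ∑-a-mate≤ : (μ : Fin n → Fin n) → ∑ (λ v → a v (μ v)) ≤ + 2 * + n
  ∑-a-mate≤ μ = subst (∑ (λ v → a v (μ v)) ≤_) (trans (∑-const {n} (+ 2)) (*-comm (+ n) (+ 2)))
    (∑-mono (λ v → a≤2 v (μ v)))

  Φ≡ : ∀ μ → Φ μ ≡ (+ 2 * + n + 1ℤ) * ∑ (covers μ) + ∑ (λ v → a v (μ v))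
  Φ≡ μ = trans (∑-+ _ _) (cong (λ t → t + ∑ (λ v → a v (μ v))) (∑-* (+ 2 * + n + 1ℤ) (covers μ)))

  -- One more covered small vertex, worth 2m + 1, outweighs every possible loss of arcs along the
  -- matching.
  lex-absurd : ∀ {m φ φ′ k k′ A A′} → 0ℤ ≤ m → φ ≡ (+ 2 * m + 1ℤ) * k + A → φ′ ≡ (+ 2 * m + 1ℤ) * k′ + A′ →
    φ′ ≤ φ → k + 1ℤ ≤ k′ → 0ℤ ≤ A′ → A ≤ + 2 * m → ⊥
  lex-absurd {m} {k = k} {k′} {A} {A′} 0≤m refl refl p q 0≤A′ A≤ =
    suc≰ {+ 2 * m} (lin (p ⊕ *-monoˡ 0≤K q ⊕ 0≤A′ ⊕ A≤) (r m k k′ A A′))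
    where
    0≤K : 0ℤ ≤ + 2 * m + 1ℤ
    0≤K = (2 ⊛ 0≤m) ⊕ 0≤+ {1}
    r : ∀ m k k′ A A′ → + 2 * m + (((+ 2 * m + 1ℤ) * k′ + A′) + ((+ 2 * m + 1ℤ) * (k + 1ℤ) + (0ℤ + A)))
      ≡ + 2 * m + 1ℤ + (((+ 2 * m + 1ℤ) * k + A) + ((+ 2 * m + 1ℤ) * k′ + (A′ + + 2 * m)))
    r = solve-∀

  no-growth : ∀ M → Optimal M → ∀ M′ u → small u ≡ true → mate M u ≡ u → mate M′ u ≢ u →
    (∀ v → small v ≡ true → mate M v ≢ v → mate M′ v ≢ v) → ⊥
  no-growth M opt M′ u su free taken keep =
    lex-absurd {+ n} {k = ∑ (covers (mate M))} {∑ (covers (mate M′))} 0≤+ (Φ≡ (mate M)) (Φ≡ (mate M′)) (optimal-Φ M opt M′)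
      (subst (_≤ ∑ (covers (mate M′)))
        (trans (∑-+ (covers (mate M)) _) (cong (λ t → ∑ (covers (mate M)) + t) (∑-count u))) (∑-mono le))
      (∑-nonneg (λ v → 0≤a v (mate M′ v))) (∑-a-mate≤ (mate M))
    where
    le : ∀ v → covers (mate M) v + ⟦ u == v ⟧ ≤ covers (mate M′) v
    le v with u ≟ v
    ... | yes refl rewrite su | not-does (mate M′ u ≟ u) taken | does-true (mate M u ≟ u) free = ≤-refl
    ... | no _ with mate M v ≟ v | small v in sv
    ... | yes _ | s     = *-nonneg 0≤⟦ matched (mate M′) v ⟧ 0≤⟦ s ⟧
    ... | no _  | false = *-nonneg 0≤⟦ matched (mate M′) v ⟧ 0≤⟦ false ⟧
    ... | no ne | true rewrite not-does (mate M′ v ≟ v) (keep v sv ne) = ≤-refl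

  Exposed : Matching → Fin n → Set
  Exposed M u = small u ≡ true × mate M u ≡ u

  -- Otherwise letting `u` take `y` would cover `u` and uncover nothing that counts: either `y` has
  -- no mate, or its mate is not small.
  nbr-mate-small : ∀ M → Optimal M → ∀ {u y} → Exposed M u → nbr u y ≡ true →
    mate M y ≢ y × small (mate M y) ≡ true
  nbr-mate-small M opt {u} {y} (su , free) uy = ne , sx
    where
    open Steal M u y free uy
    keep : (∀ v → v ≡ x → v ≢ y → small v ≡ true → mate M v ≢ v → ⊥) →
      ∀ v → small v ≡ true → mate M v ≢ v → stolen v ≢ v
    keep imp v sv mv e with v ≟ u | v ≟ y | v ≟ x
    ... | yes p | _     | _     = mv (trans (cong (mate M) p) (trans free (sym p)))
    ... | no p  | yes q | _     = p (trans (sym e) (trans (cong stolen q) at-y))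
    ... | no _  | no q  | yes r = imp v r q sv mv
    ... | no p  | no q  | no r  = mv (trans (sym (elsewhere p q r)) e)
    grow : (∀ v → v ≡ x → v ≢ y → small v ≡ true → mate M v ≢ v → ⊥) → ⊥
    grow imp = no-growth M opt result u su free (λ e → u≢y (sym (trans (sym at-u) e))) (keep imp)
    ne : mate M y ≢ y
    ne e = grow (λ v p q _ _ → q (trans p e))
    sx : small (mate M y) ≡ true
    sx with small (mate M y) in eq
    ... | true  = refl
    ... | false = contradiction (λ v p _ sv _ → true≢false (subst (λ t → small t ≡ true) p sv) eq) grow

  -- Two exchanges in a row, `u` taking `y` and `w` taking the released mate, cover both ends and
  -- release nobody.
  no-augmenting-path : ∀ M → Optimal M → ∀ {u w y} → u ≢ w → Exposed M u → Exposed M w →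
    nbr u y ≡ true → nbr w (mate M y) ≡ true → ⊥
  no-augmenting-path M opt {u} {w} {y} u≢w (su , fu) (sw , fw) uy wx =
    no-growth M opt S₂.result u su fu (λ e → S₁.u≢y (sym (trans (sym u↦y) e))) keep
    where
    ne : mate M y ≢ y
    ne = proj₁ (nbr-mate-small M opt (su , fu) uy)
    module S₁ = Steal M u y fu uy
    w≢y : w ≢ y
    w≢y e = ne (subst (λ t → mate M t ≡ t) e fw)
    w≢x : w ≢ S₁.x
    w≢x = nbr-irr wx
    module S₂ = Steal S₁.result w (mate M y) (trans (S₁.elsewhere (u≢w ∘ sym) w≢y w≢x) fw) wx
    -- After the first exchange the old mate of `y` is single, so the second one has no former mate
    -- to release.
    free-x : S₂.x ≡ mate M y
    free-x = S₁.at-x refl ne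
    u↦y : S₂.stolen u ≡ y
    u↦y = trans (S₂.elsewhere u≢w (S₁.x≢u ∘ sym) (λ e → S₁.x≢u (sym (trans e free-x)))) S₁.at-u
    keep : ∀ v → small v ≡ true → mate M v ≢ v → S₂.stolen v ≢ v
    keep v sv mv e with v ≟ w | v ≟ S₁.x
    ... | yes refl | _ = mv fw
    ... | no _ | yes refl = w≢x (trans (sym S₂.at-y) e)
    ... | no v≢w | no v≢x with v ≟ y
    ... | yes refl = S₁.u≢y (trans (sym S₁.at-y) (trans (sym (S₂.elsewhere v≢w v≢x (λ e → v≢x (trans e free-x)))) e))
    ... | no v≢y with v ≟ u
    ... | yes refl = mv fu
    ... | no v≢u = mv (trans (sym (S₁.elsewhere v≢u v≢y v≢x))
                        (trans (sym (S₂.elsewhere v≢w v≢x (λ e → v≢x (trans e free-x)))) e))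

  claim-at : (μ : Fin n → Fin n) → ∀ {u v} → nbr u v ≡ true → nbr u (μ v) ≡ true →
    claim μ u v ≡ + 7 * a v (μ v) - + 2 * c v
  claim-at μ p q rewrite p | q = *-identityˡ _

  -- 7 - 2 · 3 = 1: the cap 3 on the demands leaves each end of a matching edge something to give
  -- away.
  claim≥1 : ∀ M → Optimal M → ∀ {u v} → Exposed M u → nbr u v ≡ true → nbr u (mate M v) ≡ true →
    1ℤ ≤ claim (mate M) u v
  claim≥1 M opt {u} {v} ex p q rewrite claim-at (mate M) p q =
    lin ((7 ⊛ nbr⇒1≤a v (mate M v) (adjacent M v (proj₁ (nbr-mate-small M opt ex p)))) ⊕ (2 ⊛ c≤3 v))
      (r (a v (mate M v)) (c v))
    where
    r : ∀ a c → + 7 * a - + 2 * c + (+ 7 * 1ℤ + + 2 * c) ≡ 1ℤ + (+ 7 * a + + 2 * + 3)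
    r = solve-∀

  nbr≤claim : ∀ M → Optimal M → ∀ {u} → Exposed M u → Closed (mate M) u →
    ∀ v → ⟦ nbr u v ⟧ ≤ claim (mate M) u v
  nbr≤claim M opt {u} ex cl v with nbr u v in p
  ... | false = ≤-refl
  ... | true  = subst (1ℤ ≤_) (cong (λ t → ⟦ t ∧ nbr u (mate M v) ⟧ * (+ 7 * a v (mate M v) - + 2 * c v)) p)
                  (claim≥1 M opt ex p (cl v p))

  Bad⇒Exposed : ∀ M {u} → Bad (mate M) u → Exposed M u
  Bad⇒Exposed M (su , free , _) = su , free

  K : ℤ
  K = + 2 * + n + 1ℤ

  weight-matched : ∀ μ {v} → μ v ≢ v → small v ≡ true → weight μ v ≡ K + a v (μ v)
  weight-matched μ {v} ne sv rewrite ==-neq ne | sv = cong (λ t → t + a v (μ v)) (ℤₚ.*-identityʳ K)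

  weight-free : ∀ μ {v} → μ v ≡ v → weight μ v ≡ 0ℤ
  weight-free μ {v} e rewrite e | ==-refl v | a-irr v = trans (ℤₚ.+-identityʳ _) (*-zeroʳ K)

  weight≤ : ∀ μ v → weight μ v ≤ K + a v (μ v)
  weight≤ μ v = subst (λ t → K * (⟦ matched μ v ⟧ * ⟦ small v ⟧) ≤ t) (ℤₚ.*-identityʳ K)
      (*-monoˡ {K} ((2 ⊛ 0≤+ {n}) ⊕ 0≤+ {1}) (bit (matched μ v) (small v)))
    ⊕ ≤-refl {a v (μ v)}
    where
    bit : ∀ p q → ⟦ p ⟧ * ⟦ q ⟧ ≤ 1ℤ
    bit true  q = subst (_≤ 1ℤ) (sym (*-identityˡ ⟦ q ⟧)) ⟦ q ⟧≤1
    bit false q = 0≤+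

  -- Rotation of a bad vertex along an alternating path of length two

  module Rotation (M : Matching) (opt : Optimal M) (u y : Fin n) (bad : Bad (mate M) u) (uy : nbr u y ≡ true) where

    free : mate M u ≡ u
    free = proj₁ (proj₂ bad)

    closed : Closed (mate M) u
    closed = proj₁ (proj₂ (proj₂ bad))

    open Steal M u y free uy public

    exposed : Exposed M u
    exposed = Bad⇒Exposed M bad

    x≢y : x ≢ y
    x≢y = proj₁ (nbr-mate-small M opt exposed uy)

    ux : nbr u x ≡ true
    ux = closed y uy

    -- A pair of opposite arcs would alone give `u` a claim of at least 14 - 6 = 8, above its demand
    -- of at most 6.
    xy-simple : a x y ≤ 1ℤ
    xy-simple with a x y ℤₚ.≤? 1ℤ
    ... | yes p = p
    ... | no ¬p = contradiction
      (lin {+ 3} {0ℤ} (proj₂ (proj₂ (proj₂ bad)) ⊕ ∑-term≤ (λ v → ≤-trans 0≤⟦ nbr u v ⟧ (nbr≤claim M opt exposed closed v)) y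
            ⊕ ≤-reflexive (sym (claim-at (mate M) uy ux)) ⊕ (7 ⊛ subst (+ 2 ≤_) (a-sym x y) (≰⇒suc≤ ¬p)) ⊕ (2 ⊛ c≤3 u) ⊕ (2 ⊛ c≤3 y))
        (r (∑ (claim (mate M) u)) (claim (mate M) u y) (a y x) (c u) (c y)))
      λ { (+≤+ ()) }
      where
      r : ∀ s t a u y → 0ℤ + (s + 1ℤ + (t + ((+ 7 * a - + 2 * y) + (+ 7 * + 2 + (+ 2 * u + + 2 * y)))))
          ≡ + 3 + (+ 2 * u + (s + (t + (+ 7 * a + (+ 2 * + 3 + + 2 * + 3)))))
      r = solve-∀

    -- The small vertex `u` earns the covering bonus `K` that `x` may lose. The hypothesis serves at
    -- `y`, whose own term then does not drop.
    rotate-weight : a x y ≤ a u y → Φ (mate M) + a u y ≤ Φ stolen + a x y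
    rotate-weight le = lin (∑-mono-except (weight (mate M)) (weight stolen) (x≢u ∘ sym) pointwise
        ⊕ w′u ⊕ wx ⊕ ≤-reflexive (sym (weight-free stolen (at-x refl x≢y))) ⊕ ≤-reflexive (weight-free (mate M) free))
      (r (Φ (mate M)) (Φ stolen) (weight stolen u) (weight stolen x) (weight (mate M) u) (weight (mate M) x) K (a u y) (a x y))
      where
      r : ∀ p q w′u w′x wu wx K uy xy → q + xy + (p + (w′u + w′x) + (K + uy + (wx + (0ℤ + wu))))
        ≡ p + uy + (q + (wu + wx) + (w′u + (K + xy + (w′x + 0ℤ))))
      r = solve-∀
      w′u : K + a u y ≤ weight stolen u
      w′u = ≤-reflexive (sym (trans (weight-matched stolen (λ e → u≢y (trans (sym e) at-u)) (proj₁ bad)) (cong (λ t → K + a u t) at-u)))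
      wx : weight (mate M) x ≤ K + a x y
      wx = subst (λ t → weight (mate M) x ≤ K + a x t) (invol M y) (weight≤ (mate M) x)
      pointwise : ∀ v → v ≢ u → v ≢ x → weight (mate M) v ≤ weight stolen v
      pointwise v v≢u v≢x with v ≟ y
      ... | no v≢y = ≤-reflexive (cong (λ t → (+ 2 * + n + 1ℤ) * (⟦ not (t == v) ⟧ * ⟦ small v ⟧) + a v t)
                       (sym (elsewhere v≢u v≢y v≢x)))
      ... | yes refl rewrite at-y | ==-neq u≢y | ==-neq x≢y =
        ≤-refl {K * (1ℤ * ⟦ small y ⟧)} ⊕ subst₂ _≤_ (a-sym x y) (a-sym u y) le

    xy≤uy : a x y ≤ a u y
    xy≤uy = ≤-trans xy-simple (nbr⇒1≤a u y uy)

    uy-simple : a u y ≤ 1ℤ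
    uy-simple = lin (rotate-weight xy≤uy ⊕ optimal-Φ M opt result ⊕ xy-simple) (r (a u y) (a x y) (Φ (mate M)) (Φ stolen))
      where
      r : ∀ uy xy p q → 1ℤ + (p + uy + (q + xy)) ≡ uy + (q + xy + (p + 1ℤ))
      r = solve-∀

    -- An exposed vertex other than `u` that is adjacent to `x` or `y` would complete an augmenting
    -- path through the edge `x y`, so the rotation is invisible to it.
    others : ∀ v → v ≢ u → v ≢ x → Bad stolen v → Bad (mate M) v
    others v v≢u v≢x b = bad-local stolen (mate M) v (λ e → trans (sym (same e)) e) local b
      where
      free-v : stolen v ≡ v
      free-v = proj₁ (proj₂ b)
      v≢y : v ≢ y
      v≢y refl = u≢y (trans (sym at-y) free-v)
      same : stolen v ≡ v → stolen v ≡ mate M v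
      same _ = elsewhere v≢u v≢y v≢x
      ex : Exposed M v
      ex = proj₁ b , trans (sym (same free-v)) free-v
      local : ∀ w → nbr v w ≡ true → stolen w ≡ mate M w
      local w vw = elsewhere w≢u w≢y w≢x
        where
        w≢u : w ≢ u
        w≢u refl = proj₁ (nbr-mate-small M opt ex vw) free
        w≢y : w ≢ y
        w≢y refl = no-augmenting-path M opt v≢u ex exposed vw ux
        w≢x : w ≢ x
        w≢x refl = no-augmenting-path M opt v≢u ex exposed vw (subst (λ t → nbr u t ≡ true) (sym (invol M y)) uy)

    good : (Fin n → Fin n) → Fin n → ℤ
    good μ v = ⟦ not (isBad μ v) ⟧

    isBad-no : ∀ μ {v} → ¬ Bad μ v → isBad μ v ≡ false
    isBad-no μ {v} = not-does (bad? μ v)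

    count-good : ∑ (good (mate M)) + good stolen x ≤ ∑ (good stolen)
    count-good = lin (∑-mono-except (good (mate M)) (good stolen) (x≢u ∘ sym) pointwise
        ⊕ ≤-reflexive (sym gu) ⊕ ≤-reflexive fu ⊕ ⟦ not (isBad (mate M) x) ⟧≤1)
      (r (∑ (good (mate M))) (∑ (good stolen)) (good stolen u) (good stolen x) (good (mate M) u) (good (mate M) x))
      where
      r : ∀ p q gu gx fu fx → q + (p + (gu + gx) + (1ℤ + (fu + fx))) ≡ p + gx + (q + (fu + fx) + (gu + (0ℤ + 1ℤ)))
      r = solve-∀
      gu : good stolen u ≡ 1ℤ
      gu = cong (⟦_⟧ ∘ not) (isBad-no stolen (λ b → u≢y (trans (sym (proj₁ (proj₂ b))) at-u)))
      fu : good (mate M) u ≡ 0ℤ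
      fu = cong (⟦_⟧ ∘ not) (does-true (bad? (mate M) u) bad)
      pointwise : ∀ v → v ≢ u → v ≢ x → good (mate M) v ≤ good stolen v
      pointwise v v≢u v≢x with bad? (mate M) v | bad? stolen v
      ... | yes _ | yes _ = ≤-refl
      ... | yes _ | no _  = 0≤+
      ... | no _  | no _  = ≤-refl
      ... | no p  | yes q = contradiction (others v v≢u v≢x q) p

    Φ-kept : Φ (mate M) ≤ Φ stolen
    Φ-kept = lin (rotate-weight xy≤uy ⊕ xy≤uy) (r (a u y) (a x y) (Φ (mate M)) (Φ stolen))
      where
      r : ∀ uy xy p q → q + (p + uy + xy) ≡ p + (q + xy + uy)
      r = solve-∀

    Ω-gain : Ω (mate M) + good stolen x ≤ Ω stolen
    Ω-gain = lin ((suc n ⊛ Φ-kept) ⊕ count-good) (r (+ n) (Φ (mate M)) (Φ stolen) (∑ (good (mate M))) (∑ (good stolen)) (good stolen x))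
      where
      r : ∀ k p q f g x → (k + 1ℤ) * q + g + ((1ℤ + k) * p + (f + x)) ≡ (k + 1ℤ) * p + f + x + ((1ℤ + k) * q + g)
      r = solve-∀

    -- `Φ` is kept, `u` ceases to be bad and no vertex outside `u` and `x` turns bad; if `x` were
    -- not bad either, `Ω` would grow.
    bad-x : Bad stolen x
    bad-x with bad? stolen x in eq
    ... | yes b = b
    ... | no ¬b = contradiction
      (≤-trans (subst (λ t → Ω (mate M) + t ≤ Ω stolen) (cong (⟦_⟧ ∘ not) (isBad-no stolen ¬b)) Ω-gain) (opt result))
      suc≰

    optimal-result : Optimal result
    optimal-result M′ = ≤-trans (opt M′) (lin (Ω-gain ⊕ 0≤⟦ not (isBad stolen x) ⟧) (r (Ω (mate M)) (Ω stolen) (good stolen x)))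
      where
      r : ∀ p q g → q + (p + g + 0ℤ) ≡ p + (q + g)
      r = solve-∀

  outdegree indegree : Fin n → ℤ
  outdegree v = ∑ (λ w → ⟦ h v w ⟧)
  indegree v = ∑ (λ w → ⟦ h w v ⟧)

  -- All edges at `u` are single arcs, so outdegree plus indegree counts neighbours. Each neighbour
  -- yields a claim of at least 1, and the claims total less than `2 * c u`, hence less than twice
  -- the outdegree.
  bad⇒in<out : ∀ M → Optimal M → ∀ {u} → Bad (mate M) u → indegree u + 1ℤ ≤ outdegree u
  bad⇒in<out M opt {u} bad = lin
    (≤-reflexive (sym (∑-+ (λ w → ⟦ h u w ⟧) (λ w → ⟦ h w u ⟧))) ⊕ ∑-mono {f = a u} simple
      ⊕ ∑-mono (nbr≤claim M opt (Bad⇒Exposed M bad) (proj₁ (proj₂ (proj₂ bad))))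
      ⊕ proj₂ (proj₂ (proj₂ bad)) ⊕ (2 ⊛ c≤out u))
    (r (outdegree u) (indegree u) (∑ (a u)) (∑ (λ v → ⟦ nbr u v ⟧)) (∑ (claim (mate M) u)) (c u))
    where
    simple : ∀ v → a u v ≤ ⟦ nbr u v ⟧
    simple v with nbr u v in p
    ... | true  = Rotation.uy-simple M opt u v bad p
    ... | false = ≤-reflexive (¬nbr⇒a≡0 u v p)
    r : ∀ o i s t k c → o + (o + i + (s + (t + (k + 1ℤ + + 2 * c)))) ≡ i + 1ℤ + (s + (t + (k + (+ 2 * c + + 2 * o))))
    r = solve-∀

  opaque
    best : Matching
    best = proj₁ (argmax Ω Ω-ext)

    best-optimal : Optimal best
    best-optimal = proj₂ (argmax Ω Ω-ext)

  -- Rotation closes this set under out-neighbours, but indegree < outdegree on it, so it is empty.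
  Critical : Fin n → Set
  Critical v = ∃ λ M → Optimal M × Bad (mate M) v

  -- The factor 2 makes badness of `v` a mere tie-breaker, so one maximiser decides whether `v` is
  -- bad in some optimal matching.
  Ω-at : Fin n → (Fin n → Fin n) → ℤ
  Ω-at v μ = + 2 * Ω μ + ⟦ isBad μ v ⟧

  best-at : ∀ v → ∃ λ M → ∀ M′ → Ω-at v (mate M′) ≤ Ω-at v (mate M)
  best-at v = argmax (Ω-at v) (λ μ ν e → cong₂ (λ s t → + 2 * s + ⟦ t ⟧) (Ω-ext μ ν e) (isBad-ext μ ν e v))

  bad-Ω-at : ∀ v M → Bad (mate M) v →
    + 2 * Ω (mate M) + 1ℤ ≤ + 2 * Ω (mate (proj₁ (best-at v))) + ⟦ isBad (mate (proj₁ (best-at v))) v ⟧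
  bad-Ω-at v M bad = subst (λ t → + 2 * Ω (mate M) + ⟦ t ⟧ ≤ Ω-at v (mate (proj₁ (best-at v))))
    (does-true (bad? (mate M) v) bad) (proj₂ (best-at v) M)

  opaque
    critical? : ∀ v → Dec (Critical v)
    critical? v = decide (Ω (mate best) ℤₚ.≤? Ω (mate M₀)) (bad? (mate M₀) v)
      where
      M₀ : Matching
      M₀ = proj₁ (best-at v)
      r₁ : ∀ a b t → + 2 * b + (+ 2 * a + 1ℤ + t) ≡ + 2 * a + (+ 2 * b + t + 1ℤ)
      r₁ = solve-∀
      r₂ : ∀ a b → 0ℤ + (+ 2 * a + 1ℤ + + 2 * b) ≡ 1ℤ + (+ 2 * b + 0ℤ + + 2 * a)
      r₂ = solve-∀
      decide : Dec (Ω (mate best) ≤ Ω (mate M₀)) → Dec (Bad (mate M₀) v) → Dec (Critical v)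
      decide (yes p) (yes b) = yes (M₀ , (λ M′ → ≤-trans (best-optimal M′) p) , b)
      decide (no ¬p) _ = no λ { (M′ , opt , b) → ¬p (≤-trans (opt best) (*-cancelˡ {+ 2} (+<+ (ℕ.s≤s ℕ.z≤n))
        (lin (bad-Ω-at v M′ b ⊕ ⟦ isBad (mate M₀) v ⟧≤1) (r₁ (Ω (mate M′)) (Ω (mate M₀)) ⟦ isBad (mate M₀) v ⟧)))) }
      decide (yes p) (no ¬b) = no λ { (M′ , opt , b) → contradiction
        (lin {1ℤ} {0ℤ} (subst (λ t → + 2 * Ω (mate M′) + 1ℤ ≤ + 2 * Ω (mate M₀) + ⟦ t ⟧) (not-does (bad? (mate M₀) v) ¬b) (bad-Ω-at v M′ b)
             ⊕ (2 ⊛ opt M₀)) (r₂ (Ω (mate M′)) (Ω (mate M₀)))) λ { (+≤+ ()) } }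

  -- A bad `u` is closed, so it is also adjacent to the mate of `v`; taking that mate releases
  -- exactly `v`.
  critical-out : ∀ u v → Critical u → h u v ≡ true → Critical v
  critical-out u v (M , opt , bad) uv = R.result , R.optimal-result ,
    subst (Bad R.stolen) (invol M v) R.bad-x
    where
    u~v : nbr u v ≡ true
    u~v rewrite uv = refl
    module R = Rotation M opt u (mate M v) bad (proj₁ (proj₂ (proj₂ bad)) v u~v)

  no-critical : ∀ v → ¬ Critical v
  no-critical v cv = contradiction (lin {1ℤ} {0ℤ} (gap ⊕ flow ⊕ some) (r (∑ Qin) (∑ Qout) (∑ (⟦_⟧ ∘ q)))) λ { (+≤+ ()) }
    where
    q : Fin n → Bool
    q u = does (critical? u)
    Qin Qout : Fin n → ℤ
    Qin u = ⟦ q u ⟧ * indegree u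
    Qout u = ⟦ q u ⟧ * outdegree u
    deficit : ∀ u → ⟦ q u ⟧ * indegree u + ⟦ q u ⟧ ≤ ⟦ q u ⟧ * outdegree u
    deficit u with critical? u
    ... | no _ = ≤-refl
    ... | yes (M , opt , bad) = subst₂ _≤_ (cong (λ t → t + 1ℤ) {indegree u} {1ℤ * indegree u} (sym (*-identityˡ (indegree u)))) (sym (*-identityˡ (outdegree u))) (bad⇒in<out M opt bad)
    closed : ∀ u → ⟦ q u ⟧ * outdegree u ≤ ∑ (λ w → ⟦ h u w ⟧ * ⟦ q w ⟧)
    closed u = subst (_≤ ∑ (λ w → ⟦ h u w ⟧ * ⟦ q w ⟧)) (∑-* ⟦ q u ⟧ _) (∑-mono arc)
      where
      arc : ∀ w → ⟦ q u ⟧ * ⟦ h u w ⟧ ≤ ⟦ h u w ⟧ * ⟦ q w ⟧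
      arc w with critical? u | h u w in uw | critical? w
      ... | no _  | b     | d     = *-nonneg 0≤⟦ b ⟧ 0≤⟦ does d ⟧
      ... | yes _ | false | _     = ≤-refl
      ... | yes _ | true  | yes _ = ≤-refl
      ... | yes c | true  | no ¬c = contradiction (critical-out u w c uw) ¬c
    back : ∀ w → ∑ (λ u → ⟦ h u w ⟧ * ⟦ q w ⟧) ≡ ⟦ q w ⟧ * indegree w
    back w = trans (∑-*ʳ ⟦ q w ⟧ _) (*-comm (indegree w) ⟦ q w ⟧)
    gap : ∑ Qin + ∑ (⟦_⟧ ∘ q) ≤ ∑ Qout
    gap = subst (_≤ ∑ Qout) (∑-+ Qin (⟦_⟧ ∘ q)) (∑-mono deficit)
    flow : ∑ Qout ≤ ∑ Qin
    flow = ≤-trans (∑-mono closed)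
      (≤-reflexive (trans (∑-swap (λ u w → ⟦ h u w ⟧ * ⟦ q w ⟧)) (∑-cong back)))
    some : 1ℤ ≤ ∑ (⟦_⟧ ∘ q)
    some = subst (_≤ ∑ (⟦_⟧ ∘ q)) (cong ⟦_⟧ (does-true (critical? v) cv)) (∑-term≤ (λ u → 0≤⟦ q u ⟧) v)
    r : ∀ i o q → 0ℤ + (i + q + (o + 1ℤ)) ≡ 1ℤ + (o + (i + q))
    r = solve-∀

  -- From the optimal matching to induced stars

  μ : Fin n → Fin n
  μ = mate best

  μ-inv : ∀ v → μ (μ v) ≡ v
  μ-inv = invol best

  Open : Fin n → Set
  Open u = Exposed best u × ∃ λ v → nbr u v ≡ true × nbr u (μ v) ≡ false

  opaque
    exposed? : ∀ u → Dec (Exposed best u)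
    exposed? u = (small u 𝔹ₚ.≟ true) ×-dec (μ u ≟ u)

    open? : ∀ u → Dec (Open u)
    open? u = exposed? u ×-dec any? (λ v → (nbr u v 𝔹ₚ.≟ true) ×-dec (nbr u (μ v) 𝔹ₚ.≟ false))

  target : ∀ {u} → Open u → Fin n
  target (_ , v , _) = v

  target-mate : ∀ {u} (o : Open u) → μ (target o) ≢ target o × small (μ (target o)) ≡ true
  target-mate (ex , v , uv , _) = nbr-mate-small best best-optimal ex uv

  -- Depends on the decision rather than on an arbitrary witness, so each open vertex has one fixed
  -- target, shared by `Chosen` and `root`.
  attach : ∀ u → Dec (Open u) → Fin n
  attach u (yes o) = target o
  attach u (no _)  = u

  Chosen : Fin n → Set
  Chosen y = ∃ λ u → Open u × attach u (open? u) ≡ y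

  opaque
    chosen? : ∀ y → Dec (Chosen y)
    chosen? y = any? (λ u → open? u ×-dec (attach u (open? u) ≟ y))

  chosen-by : ∀ {y} → Chosen y → ∃ λ u → Σ (Open u) λ o → target o ≡ y
  chosen-by (u , o , e) with open? u
  ... | yes o′ = u , o′ , e
  ... | no ¬o  = contradiction o ¬o

  chosen-mate : ∀ {y} → Chosen y → μ y ≢ y × small (μ y) ≡ true
  chosen-mate ch with chosen-by ch
  ... | u , o , refl = target-mate o

  -- Two different vertices attached to the two ends would give an augmenting path, and a single
  -- vertex has only one target.
  chosen-once : ∀ {y} → Chosen y → Chosen (μ y) → ⊥
  chosen-once {y} (u , ou , eu) (w , ow , ew) with u ≟ w
  ... | yes refl = proj₁ (chosen-mate (u , ou , eu)) (trans (sym ew) eu)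
  ... | no u≢w with chosen-by (u , ou , eu) | chosen-by (w , ow , ew)
  ... | _ | _ with open? u | open? w
  ... | yes (exu , _ , uy , _) | yes (exw , _ , wx , _) =
    no-augmenting-path best best-optimal u≢w exu exw
      (subst (λ t → nbr u t ≡ true) eu uy) (subst (λ t → nbr w t ≡ true) ew wx)
  ... | no ¬o | _ = ¬o ou
  ... | yes _ | no ¬o = ¬o ow

  chosen : Fin n → Bool
  chosen y = does (chosen? y)

  opaque
    centre : Fin n → Bool
    centre v = prefer (chosen v) (chosen (μ v)) (not (small v)) (not (small (μ v))) (does (v <? μ v))

    chosen-centre : ∀ {v} → Chosen v → centre v ≡ true
    chosen-centre {v} ch rewrite does-true (chosen? v) ch = refl

    centre-mate : ∀ {v} → μ v ≢ v → centre (μ v) ≡ not (centre v)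
    centre-mate {v} ne rewrite μ-inv v = prefer-anti (chosen v) (chosen (μ v)) (not (small v)) (not (small (μ v)))
      both one (flip (Fₚ.<-cmp v (μ v)))
      where
      both : chosen v ≡ true → chosen (μ v) ≡ true → ⊥
      both p q with chosen? v | chosen? (μ v)
      ... | yes c | yes d = chosen-once c d
      one : not (small v) ≡ true → not (small (μ v)) ≡ true → ⊥
      one p q with small v in s | small (μ v) in t
      ... | false | false = true≢false (nbr-touches v (μ v) (adjacent best v ne) s) t
      flip : Tri (v Fin.< μ v) (v ≡ μ v) (μ v Fin.< v) → does (μ v <? v) ≡ not (does (v <? μ v))
      flip (tri< l _ g) = trans (not-does (μ v <? v) g) (cong not (sym (does-true (v <? μ v) l)))
      flip (tri≈ _ e _) = contradiction (sym e) ne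
      flip (tri> l _ g) = trans (does-true (μ v <? v) g) (cong not (sym (not-does (v <? μ v) l)))

    -- A vertex that is not small can lose the centre only to a chosen mate; but the mate of a
    -- chosen vertex is small.
    leaf-is-small : ∀ {v} → centre v ≡ false → small v ≡ true
    leaf-is-small {v} p with small v in s
    ... | true = refl
    ... | false with chosen? v | chosen? (μ v)
    leaf-is-small () | false | yes _ | _
    leaf-is-small () | false | no _  | no _
    ... | no _ | yes ch = trans (sym s) (subst (λ t → small t ≡ true) (μ-inv v) (proj₂ (chosen-mate ch)))

  opaque
    root : Fin n → Fin n
    root v with μ v ≟ v
    ... | yes _ = attach v (open? v)
    ... | no _  = if centre v then v else μ v

    root-open : ∀ {v} → (o : Open v) → ∃ λ o′ → root v ≡ target {v} o′
    root-open {v} o with μ v ≟ v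
    ... | no p  = contradiction (proj₂ (proj₁ o)) p
    ... | yes _ with open? v
    ... | yes o′ = o′ , refl
    ... | no ¬o  = contradiction o ¬o

    root-centre : ∀ {v} → μ v ≢ v → centre v ≡ true → root v ≡ v
    root-centre {v} ne c with μ v ≟ v
    ... | yes p = contradiction p ne
    ... | no _ rewrite c = refl

    root-mate : ∀ {v} → μ v ≢ v → centre v ≡ false → root v ≡ μ v
    root-mate {v} ne c with μ v ≟ v
    ... | yes p = contradiction p ne
    ... | no _ rewrite c = refl

    root-chosen : ∀ {v} → μ v ≡ v → root v ≢ v → Σ (Open v) λ o → root v ≡ target o × Chosen (root v)
    root-chosen {v} e ne with μ v ≟ v
    ... | no p  = contradiction e p
    ... | yes _ with open? v in eq
    ... | no _  = contradiction refl ne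
    ... | yes o = o , refl , v , o , cong (attach v) eq

  data Leaf (v : Fin n) : Set where
    attached : (o : Open v) → root v ≡ target o → Chosen (root v) → Leaf v
    paired   : μ v ≢ v → centre v ≡ false → root v ≡ μ v → Leaf v

  leaf : ∀ {v} → root v ≢ v → Leaf v
  leaf {v} ne with μ v ≟ v
  ... | yes e = let (o , p , ch) = root-chosen e ne in attached o p ch
  ... | no p with centre v in c
  ... | true  = contradiction (root-centre p c) ne
  ... | false = paired p c (root-mate p c)

  isStarMap : IsStarMap h small root
  isStarMap = record { root-root = rr ; leaf-small = ls ; leaf-nbr = ln ; independent = ind }
    where
    rr : ∀ {v} → root v ≢ v → root (root v) ≡ root v
    rr ne with leaf ne
    ... | attached o e ch = root-centre (proj₁ (chosen-mate ch)) (chosen-centre ch)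
    ... | paired p c e rewrite e = root-centre (λ q → p (trans (sym q) (μ-inv _))) (trans (centre-mate p) (cong not c))
    ls : ∀ {v} → root v ≢ v → small v ≡ true
    ls ne with leaf ne
    ... | attached o _ _ = proj₁ (proj₁ o)
    ... | paired _ c _   = leaf-is-small c
    ln : ∀ {v} → root v ≢ v → nbr v (root v) ≡ true
    ln {v} ne with leaf ne
    ... | attached (_ , _ , uv , _) e _ = subst (λ t → nbr v t ≡ true) (sym e) uv
    ... | paired p _ e = subst (λ t → nbr v t ≡ true) (sym e) (adjacent best v p)
    -- An open vertex is attached to an end whose mate it does not see, and `v` is that mate.
    mixed : ∀ {u v} (o : Open u) → root u ≡ target o → root v ≡ μ v → root u ≡ root v → nbr u v ≡ false
    mixed {u} {v} (_ , y , _ , uy) e f g = subst (λ t → nbr u t ≡ false)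
      (trans (cong μ (trans (sym e) (trans g f))) (μ-inv v)) uy
    ind : ∀ {u v} → root u ≢ u → root v ≢ v → root u ≡ root v → nbr u v ≡ false
    ind {u} {v} nu nv e with leaf nu | leaf nv
    ... | attached o p _ | paired _ _ q = mixed o p q e
    ... | paired _ _ p | attached o q _ = trans (nbr-sym u v) (mixed o q p (sym e))
    ... | paired _ _ p | paired _ _ q with trans (sym (μ-inv u)) (trans (cong μ (trans (sym p) (trans e q))) (μ-inv v))
    ... | refl rewrite irreflexive u = refl
    -- Both leaves are exposed, and in an optimal matching two exposed vertices are never adjacent.
    ind {u} {v} nu nv e | attached o _ _ | attached o′ _ _ with nbr u v in uv
    ... | false = refl
    ... | true  = contradiction (proj₂ (proj₁ o′)) (proj₁ (nbr-mate-small best best-optimal (proj₁ o) uv))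

  not-bad : ∀ v → ¬ Bad μ v
  not-bad v b = no-critical v (best , best-optimal , b)

  -- Discharging: the arcs inside stars pay all demands

  isClosed : Fin n → Bool
  isClosed v = does (exposed? v) ∧ not (does (open? v))

  gain : Fin n → ℤ
  gain v = + 14 * a v (root v)

  surplus : Fin n → ℤ
  surplus w = + 7 * a w (μ w) - + 2 * c w

  -- Means available to `v`: the part of its edge reserved for a matched vertex, the own edge of an
  -- attached leaf, the claims of a closed vertex.
  share : Fin n → ℤ
  share v = ⟦ matched μ v ⟧ * (+ 2 * c v) + (1ℤ - ⟦ matched μ v ⟧) * gain v + ⟦ isClosed v ⟧ * ∑ (claim μ v)

  0≤gain : ∀ v → 0ℤ ≤ gain v
  0≤gain v = 14 ⊛ 0≤a v (root v)

  -- The case with content is a closed vertex: if its claims fell short it would be bad, which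
  -- `not-bad` excludes. An attached leaf has 14 for a demand of at most 6.
  2c≤share : ∀ v → + 2 * c v ≤ share v
  2c≤share v with μ v ≟ v
  ... | no p = subst (+ 2 * c v ≤_) (r (+ 2 * c v) (gain v) (∑ (claim μ v)) ⟦ isClosed v ⟧ flag) ≤-refl
    where
    flag : ⟦ isClosed v ⟧ ≡ 0ℤ
    flag = cong (λ t → ⟦ t ∧ not (does (open? v)) ⟧) (not-does (exposed? v) (λ ex → p (proj₂ ex)))
    r : ∀ x g s f → f ≡ 0ℤ → x ≡ 1ℤ * x + (1ℤ - 1ℤ) * g + f * s
    r x g s _ refl = r′ x g s
      where
      r′ : ∀ x g s → x ≡ 1ℤ * x + (1ℤ - 1ℤ) * g + 0ℤ * s
      r′ = solve-∀
  ... | yes e = subst (+ 2 * c v ≤_) (r (+ 2 * c v) (gain v) (⟦ isClosed v ⟧ * ∑ (claim μ v))) bound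
    where
    r : ∀ x g s → g + s ≡ 0ℤ * x + (1ℤ - 0ℤ) * g + s
    r = solve-∀
    bound : + 2 * c v ≤ gain v + ⟦ isClosed v ⟧ * ∑ (claim μ v)
    bound with exposed? v | open? v
    ... | no ¬ex | o with small v in s
    ... | true  = contradiction (refl , e) ¬ex
    ... | false rewrite c-small v s = 0≤gain v ⊕ ≤-refl {0ℤ}
    bound | yes _ | yes o = ≤-trans (2 ⊛ c≤3 v) (≤-trans (+≤+ (ℕₚ.m≤m+n 6 8)) (≤-trans (14 ⊛ root-nbr) (≤-reflexive (sym (ℤₚ.+-identityʳ _)))))
      where
      root-nbr : 1ℤ ≤ a v (root v)
      root-nbr with root-open o
      ... | (_ , y , uy , _) , q = subst (λ t → 1ℤ ≤ a v t) (sym q) (nbr⇒1≤a v y uy)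
    bound | yes ex | no ¬o = ≤-trans enough (subst₂ _≤_ (ℤₚ.+-identityˡ _) refl (0≤gain v ⊕ ≤-reflexive (sym (*-identityˡ _))))
      where
      closed : Closed μ v
      closed w vw with nbr v (μ w) in q
      ... | true  = refl
      ... | false = contradiction (ex , w , vw , q) ¬o
      enough : + 2 * c v ≤ ∑ (claim μ v)
      enough with + 2 * c v ℤₚ.≤? ∑ (claim μ v)
      ... | yes p = p
      ... | no ¬p = contradiction (proj₁ ex , proj₂ ex , closed , ≰⇒suc≤ ¬p) (not-bad v)

  -- A matched vertex is claimed by at most one closed vertex, since there is no augmenting path.
  claims≤ : ∀ w → ∑ (λ v → ⟦ isClosed v ⟧ * claim μ v w) ≤ ⟦ matched μ w ⟧ * surplus w
  claims≤ w = subst (_≤ ⟦ matched μ w ⟧ * surplus w)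
    (trans (sym (∑-*ʳ (surplus w) (λ v → ⟦ claims v ⟧))) (∑-cong (λ v → split (isClosed v) (nbr v w ∧ nbr v (μ w)) (surplus w))))
    bound
    where
    claims : Fin n → Bool
    claims v = isClosed v ∧ (nbr v w ∧ nbr v (μ w))
    split : ∀ p q s → ⟦ p ∧ q ⟧ * s ≡ ⟦ p ⟧ * (⟦ q ⟧ * s)
    split true  q s = sym (*-identityˡ (⟦ q ⟧ * s))
    split false q s = refl
    claims-sound : ∀ v → claims v ≡ true → Exposed best v × nbr v w ≡ true × nbr v (μ w) ≡ true
    claims-sound v p with exposed? v | open? v | nbr v w | nbr v (μ w)
    ... | yes ex | no _ | true | true = ex , refl , refl
    bound : ∑ (λ v → ⟦ claims v ⟧) * surplus w ≤ ⟦ matched μ w ⟧ * surplus w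
    bound with μ w ≟ w
    ... | yes e = ≤-reflexive (cong (_* surplus w) (trans (∑-cong none) (∑-0 {n})))
      where
      none : ∀ v → ⟦ claims v ⟧ ≡ 0ℤ
      none v with claims v in p
      ... | false = refl
      ... | true  = let (ex , vw , _) = claims-sound v p in
                    contradiction e (proj₁ (nbr-mate-small best best-optimal ex vw))
    ... | no ne = ℤₚ.*-monoʳ-≤-nonNeg (surplus w) {{ℤ.nonNegative 0≤surplus}} (∑-unique claims unique)
      where
      0≤surplus : 0ℤ ≤ surplus w
      0≤surplus = lin ((7 ⊛ nbr⇒1≤a w (μ w) (adjacent best w ne)) ⊕ (2 ⊛ c≤3 w) ⊕ 0≤+ {1}) (r (a w (μ w)) (c w))
        where
        r : ∀ a c → + 7 * a - + 2 * c + (+ 7 * 1ℤ + (+ 2 * c + 0ℤ)) ≡ 0ℤ + (+ 7 * a + (+ 2 * + 3 + 1ℤ))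
        r = solve-∀
      unique : ∀ u v → claims u ≡ true → claims v ≡ true → u ≡ v
      unique u v p q with u ≟ v
      ... | yes e = e
      ... | no u≢v = let (exu , uw , _) = claims-sound u p ; (exv , _ , vx) = claims-sound v q in
                     ⊥-elim (no-augmenting-path best best-optimal u≢v exu exv uw vx)

  pairGain : Fin n → ℤ
  pairGain v = ⟦ matched μ v ⟧ * gain v

  pairGain-free : ∀ {v} → μ v ≡ v → pairGain v ≡ 0ℤ
  pairGain-free {v} e = cong (λ t → ⟦ not t ⟧ * gain v) (does-true (μ v ≟ v) e)

  pairGain-matched : ∀ {v} → μ v ≢ v → pairGain v ≡ gain v
  pairGain-matched {v} ne = trans (cong (λ t → ⟦ not t ⟧ * gain v) (not-does (μ v ≟ v) ne)) (*-identityˡ (gain v))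

  -- Exactly one end of a matching edge is a leaf, and only a leaf has a nonzero gain.
  pairGain-sum : ∀ v → pairGain v + pairGain (μ v) ≡ + 14 * a v (μ v)
  pairGain-sum v = by-mate (μ v ≟ v)
    where
    by-mate : Dec (μ v ≡ v) → pairGain v + pairGain (μ v) ≡ + 14 * a v (μ v)
    by-mate (yes e) = trans (cong₂ _+_ (pairGain-free e) (pairGain-free (cong μ e)))
                            (sym (trans (cong (λ t → + 14 * a v t) e) (cong (+ 14 *_) (a-irr v))))
    by-mate (no ne) = trans (cong₂ _+_ (pairGain-matched ne) (pairGain-matched ne′)) (by-centre (centre v) refl)
      where
      ne′ : μ (μ v) ≢ μ v
      ne′ e = ne (trans (sym e) (μ-inv v))
      zero-gain : ∀ {u} → root u ≡ u → gain u ≡ 0ℤ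
      zero-gain {u} e = trans (cong (λ t → + 14 * a u t) e) (cong (+ 14 *_) (a-irr u))
      by-centre : ∀ b → centre v ≡ b → gain v + gain (μ v) ≡ + 14 * a v (μ v)
      by-centre true cv = trans (cong₂ _+_ (zero-gain (root-centre ne cv))
          (cong (λ t → + 14 * a (μ v) t) (trans (root-mate ne′ (trans (centre-mate ne) (cong not cv))) (μ-inv v))))
        (trans (ℤₚ.+-identityˡ _) (cong (+ 14 *_) (a-sym (μ v) v)))
      by-centre false cv = trans (cong₂ _+_ (cong (λ t → + 14 * a v t) (root-mate ne cv))
          (zero-gain (root-centre ne′ (trans (centre-mate ne) (cong not cv)))))
        (ℤₚ.+-identityʳ _)

  -- In units of 14, an edge of μ is worth 14 and covers its two ends, whose demands are at most 6 each;
  -- the rest goes to the closed vertex claiming it, while an attached leaf pays for itself.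
  star-bound : ∑ c ≤ + 7 * ∑ (λ v → a v (root v))
  star-bound = *-cancelˡ {+ 2} (+<+ (ℕ.s≤s ℕ.z≤n)) (lin
    (demand ⊕ supply ⊕ ≤-reflexive pairs ⊕ ≤-reflexive total)
    (r (∑ c) (∑ need) (∑ singleGain) (∑ (λ v → ⟦ isClosed v ⟧ * ∑ (claim μ v)))
       (∑ (λ w → ⟦ matched μ w ⟧ * surplus w)) (∑ pairGain) (∑ (λ v → a v (root v)))))
    where
    singleGain : Fin n → ℤ
    singleGain v = (1ℤ - ⟦ matched μ v ⟧) * gain v
    need : Fin n → ℤ
    need v = ⟦ matched μ v ⟧ * (+ 2 * c v)
    demand : + 2 * ∑ c ≤ ∑ need + ∑ singleGain + ∑ (λ v → ⟦ isClosed v ⟧ * ∑ (claim μ v))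
    demand = subst₂ _≤_ (∑-* (+ 2) c)
      (trans (∑-+ (λ v → need v + singleGain v) _) (cong (λ t → t + ∑ (λ v → ⟦ isClosed v ⟧ * ∑ (claim μ v))) (∑-+ need singleGain)))
      (∑-mono 2c≤share)
    supply : ∑ (λ v → ⟦ isClosed v ⟧ * ∑ (claim μ v)) ≤ ∑ (λ w → ⟦ matched μ w ⟧ * surplus w)
    supply = ≤-trans (≤-reflexive (trans (∑-cong (λ v → sym (∑-* ⟦ isClosed v ⟧ (claim μ v))))
                                         (∑-swap (λ v w → ⟦ isClosed v ⟧ * claim μ v w))))
                     (∑-mono claims≤)
    r : ∀ c N S C U G A → + 2 * (+ 7 * A) + (+ 2 * c + (C + (N + U + (G + S)))) ≡ + 2 * c + (N + S + C + (U + (G + + 14 * A)))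
    r = solve-∀
    edge : ∀ w → need w + ⟦ matched μ w ⟧ * surplus w ≡ + 7 * a w (μ w)
    edge w with μ w ≟ w
    ... | yes e = sym (trans (cong (λ t → + 7 * a w t) e) (cong (+ 7 *_) (a-irr w)))
    ... | no _  = r′ (a w (μ w)) (c w)
      where
      r′ : ∀ a c → 1ℤ * (+ 2 * c) + 1ℤ * (+ 7 * a - + 2 * c) ≡ + 7 * a
      r′ = solve-∀
    -- The left side sees each edge at both ends with 7 `a`, the right side once with 14 `a`;
    -- reindexing by `μ` compares the two.
    pairs : ∑ need + ∑ (λ w → ⟦ matched μ w ⟧ * surplus w) ≡ ∑ pairGain
    pairs = trans (sym (∑-+ need _)) (trans (∑-cong edge) (ℤₚ.*-cancelˡ-≡ (+ 2) _ _ (begin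
      + 2 * ∑ (λ w → + 7 * a w (μ w))          ≡⟨ sym (∑-* (+ 2) _) ⟩
      ∑ (λ w → + 2 * (+ 7 * a w (μ w)))        ≡⟨ ∑-cong (λ w → r₂ (a w (μ w))) ⟩
      ∑ (λ w → + 14 * a w (μ w))               ≡⟨ ∑-cong (λ w → sym (pairGain-sum w)) ⟩
      ∑ (λ w → pairGain w + pairGain (μ w))    ≡⟨ ∑-+ pairGain (pairGain ∘ μ) ⟩
      ∑ pairGain + ∑ (pairGain ∘ μ)            ≡⟨ cong (λ t → ∑ pairGain + t) (∑-involution μ μ-inv pairGain) ⟩
      ∑ pairGain + ∑ pairGain                  ≡⟨ r₃ (∑ pairGain) ⟩
      + 2 * ∑ pairGain                         ∎)))
      where
      open ≡-Reasoning
      r₂ : ∀ a → + 2 * (+ 7 * a) ≡ + 14 * a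
      r₂ = solve-∀
      r₃ : ∀ a → a + a ≡ + 2 * a
      r₃ = solve-∀
    total : ∑ pairGain + ∑ singleGain ≡ + 14 * ∑ (λ v → a v (root v))
    total = trans (sym (∑-+ pairGain singleGain))
      (trans (∑-cong (λ v → r₄ ⟦ matched μ v ⟧ (gain v))) (∑-* (+ 14) (λ v → a v (root v))))
      where
      r₄ : ∀ m g → m * g + (1ℤ - m) * g ≡ g
      r₄ = solve-∀

-- Partitions of the digraph

sq-mono : ∀ {x y} → x ≤ y → - x ≤ y → x * x ≤ y * y
sq-mono {x} {y} p q = lin (*-nonneg (i≤j⇒0≤j-i p) (i≤j⇒0≤j-i q)) (r x y)
  where
  r : ∀ x y → y * y + 0ℤ ≡ x * x + (y - x) * (y - - x)
  r = solve-∀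

opaque
  unfolding ∑

  -- Each further item gets the sign that opposes the sum so far, so the sum never leaves the
  -- interval from -L to L.
  greedy-signs : ∀ {n} (y : Fin n → ℤ) {L} → 0ℤ ≤ L → (∀ v → y v ≤ L) → (∀ v → - y v ≤ L) →
    ∃ λ (q : Fin n → Bool) → ∑ (λ v → sgn (q v) * y v) ≤ L × - ∑ (λ v → sgn (q v) * y v) ≤ L
  greedy-signs {zero} y 0≤L _ _ = (λ ()) , 0≤L , 0≤L
  greedy-signs {suc n} y {L} 0≤L up lo with greedy-signs (y ∘ suc) 0≤L (up ∘ suc) (lo ∘ suc)
  ... | q , hi , lw = by-signs (0ℤ ℤₚ.≤? s) (0ℤ ℤₚ.≤? y zero)
    where
    s : ℤ
    s = ∑ (λ v → sgn (q v) * y (suc v))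
    by-signs : Dec (0ℤ ≤ s) → Dec (0ℤ ≤ y zero) →
      ∃ λ (q : Fin (suc n) → Bool) → sgn (q zero) * y zero + ∑ (λ v → sgn (q (suc v)) * y (suc v)) ≤ L
        × - (sgn (q zero) * y zero + ∑ (λ v → sgn (q (suc v)) * y (suc v))) ≤ L
    by-signs (yes p) (yes x) = (false ◂ q) , lin (hi ⊕ x) (b₁ (y zero) s L) , lin (up zero ⊕ p) (b₂ (y zero) s L)
      where
      b₁ : ∀ x s L → L + (s + 0ℤ) ≡ - 1ℤ * x + s + (L + x)
      b₁ = solve-∀
      b₂ : ∀ x s L → L + (x + 0ℤ) ≡ - (- 1ℤ * x + s) + (L + s)
      b₂ = solve-∀
    by-signs (yes p) (no x) = (true ◂ q) , lin (hi ⊕ ≰⇒≥ x) (b₁ (y zero) s L) , lin (lo zero ⊕ p) (b₂ (y zero) s L)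
      where
      b₁ : ∀ x s L → L + (s + x) ≡ 1ℤ * x + s + (L + 0ℤ)
      b₁ = solve-∀
      b₂ : ∀ x s L → L + (- x + 0ℤ) ≡ - (1ℤ * x + s) + (L + s)
      b₂ = solve-∀
    by-signs (no p) (yes x) = (true ◂ q) , lin (up zero ⊕ ≰⇒≥ p) (b₁ (y zero) s L) , lin (lw ⊕ x) (b₂ (y zero) s L)
      where
      b₁ : ∀ x s L → L + (x + s) ≡ 1ℤ * x + s + (L + 0ℤ)
      b₁ = solve-∀
      b₂ : ∀ x s L → L + (- s + 0ℤ) ≡ - (1ℤ * x + s) + (L + x)
      b₂ = solve-∀
    by-signs (no p) (no x) = (false ◂ q) , lin (lo zero ⊕ ≰⇒≥ p) (b₁ (y zero) s L) , lin (lw ⊕ ≰⇒≥ x) (b₂ (y zero) s L)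
      where
      b₁ : ∀ x s L → L + (- x + s) ≡ - 1ℤ * x + s + (L + 0ℤ)
      b₁ = solve-∀
      b₂ : ∀ x s L → L + (- s + x) ≡ - (- 1ℤ * x + s) + (L + 0ℤ)
      b₂ = solve-∀

  -- `p` marks the items before the first one that lifts twice the partial sum above `t`; `c`
  -- carries that sum. Items may be negative, so the sum over `p` may be as well.
  crossing-index : ∀ {n} (y : Fin n → ℤ) c t → + 2 * c ≤ t → t + 1ℤ ≤ + 2 * (c + ∑ y) →
    ∃ λ (p : Fin n → Bool) → ∃ λ j → p j ≡ false
      × + 2 * (c + ∑ (λ v → ⟦ p v ⟧ * y v)) ≤ t × t + 1ℤ ≤ + 2 * (c + ∑ (λ v → ⟦ p v ⟧ * y v) + y j)
  crossing-index {zero} y c t lo hi =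
    contradiction (≤-trans hi (≤-trans (≤-reflexive (cong (+ 2 *_) (ℤₚ.+-identityʳ c))) lo)) suc≰
  crossing-index {suc n} y c t lo hi with t + 1ℤ ℤₚ.≤? + 2 * (c + y zero)
  ... | yes le = (λ _ → false) , zero , refl , subst (λ x → + 2 * x ≤ t) (sym none) lo
               , subst (λ x → t + 1ℤ ≤ + 2 * (x + y zero)) (sym none) le
    where
    none : c + ∑ {suc n} (λ v → ⟦ false ⟧ * y v) ≡ c
    none = trans (cong (λ t → c + t) (∑-0 {suc n})) (ℤₚ.+-identityʳ c)
  ... | no ¬le with crossing-index (y ∘ suc) (c + y zero) t (below ¬le) (subst (λ x → t + 1ℤ ≤ + 2 * x) (sym (ℤₚ.+-assoc c (y zero) _)) hi)
    where
    below : ¬ (t + 1ℤ ≤ + 2 * (c + y zero)) → + 2 * (c + y zero) ≤ t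
    below ¬p = lin (≰⇒suc≤ ¬p) (r t (+ 2 * (c + y zero)))
      where
      r : ∀ t x → t + (x + 1ℤ) ≡ x + (t + 1ℤ)
      r = solve-∀
  ... | p , j , pj , lo′ , hi′ = (true ◂ p) , suc j , pj , subst (λ x → + 2 * x ≤ t) shift lo′
      , subst (λ x → t + 1ℤ ≤ + 2 * (x + y (suc j))) shift hi′
    where
    shift : c + y zero + ∑ (λ v → ⟦ p v ⟧ * y (suc v)) ≡ c + (1ℤ * y zero + ∑ (λ v → ⟦ p v ⟧ * y (suc v)))
    shift = r c (y zero) _
      where
      r : ∀ c y s → c + y + s ≡ c + (1ℤ * y + s)
      r = solve-∀

pos-factor : ∀ {c a k} → 0ℤ ≤ c → 0ℤ ≤ a → c + 1ℤ ≤ + 7 * (a * k) → 0ℤ ≤ k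
pos-factor {c} {a} {k} 0≤c 0≤a p with 0ℤ ℤₚ.≤? k
... | yes q = q
... | no ¬q = contradiction (lin (p ⊕ 0≤c ⊕ (7 ⊛ *-nonneg 0≤a (ℤₚ.neg-mono-≤ (≰⇒≥ ¬q)))) (r c a k)) (suc≰ {0ℤ})
  where
  r : ∀ c a k → 0ℤ + (c + 1ℤ + (0ℤ + + 7 * 0ℤ)) ≡ 0ℤ + 1ℤ + (+ 7 * (a * k) + (c + + 7 * (a * - k)))
  r = solve-∀

-- AM–GM for a₁k₂ and a₂k₁, whose product is (a₁k₁)(a₂k₂).
mixed-sum : ∀ {c a₁ k₁ a₂ k₂} → 0ℤ ≤ c → 0ℤ ≤ a₁ → 0ℤ ≤ k₁ → 0ℤ ≤ a₂ → 0ℤ ≤ k₂ →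
  c + 1ℤ ≤ + 7 * (a₁ * k₁) → c + 1ℤ ≤ + 7 * (a₂ * k₂) → + 2 * c + 1ℤ ≤ + 7 * (a₁ * k₂ + a₂ * k₁)
mixed-sum {c} {a₁} {k₁} {a₂} {k₂} 0≤c 0≤a₁ 0≤k₁ 0≤a₂ 0≤k₂ p q with + 2 * c + 1ℤ ℤₚ.≤? + 7 * (a₁ * k₂ + a₂ * k₁)
... | yes r = r
... | no ¬r = contradiction
  -- x² = (a₁k₂ - a₂k₁)² + 4 a₁k₁a₂k₂, so 49x² ≥ 4(c + 1)², which exceeds (2c)².
  (lin (sq-mono {+ 7 * x} {+ 2 * c} small (≤-trans (ℤₚ.neg-mono-≤ 0≤7x) (2 ⊛ 0≤c))
      ⊕ (49 ⊛ square-nonneg (a₁ * k₂ - a₂ * k₁)) ⊕ (4 ⊛ product) ⊕ (8 ⊛ 0≤c) ⊕ 0≤+ {3})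
    (r c a₁ k₁ a₂ k₂))
  (suc≰ {0ℤ})
  where
  x : ℤ
  x = a₁ * k₂ + a₂ * k₁
  0≤7x : 0ℤ ≤ + 7 * x
  0≤7x = 7 ⊛ (*-nonneg 0≤a₁ 0≤k₂ ⊕ *-nonneg 0≤a₂ 0≤k₁)
  small : + 7 * x ≤ + 2 * c
  small = lin (≰⇒suc≤ ¬r) (r₁ (+ 7 * x) (+ 2 * c))
    where
    r₁ : ∀ x c → c + (x + 1ℤ) ≡ x + (c + 1ℤ)
    r₁ = solve-∀
  product : (c + 1ℤ) * (c + 1ℤ) ≤ + 7 * (a₁ * k₁) * (+ 7 * (a₂ * k₂))
  product = ≤-trans (*-monoˡ (0≤c ⊕ 0≤+ {1}) q)
    (≤-trans (≤-reflexive (*-comm (c + 1ℤ) _)) (≤-trans (*-monoˡ (7 ⊛ *-nonneg 0≤a₂ 0≤k₂) p) (≤-reflexive (*-comm (+ 7 * (a₂ * k₂)) _))))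
  r : ∀ c a₁ k₁ a₂ k₂ → 0ℤ + (+ 7 * (a₁ * k₂ + a₂ * k₁) * (+ 7 * (a₁ * k₂ + a₂ * k₁)) + (+ 49 * 0ℤ + (+ 4 * ((c + 1ℤ) * (c + 1ℤ)) + (+ 8 * 0ℤ + 0ℤ))))
    ≡ 0ℤ + 1ℤ + (+ 2 * c * (+ 2 * c) + (+ 49 * ((a₁ * k₂ - a₂ * k₁) * (a₁ * k₂ - a₂ * k₁)) + (+ 4 * (+ 7 * (a₁ * k₁) * (+ 7 * (a₂ * k₂))) + (+ 8 * c + + 3))))
  r = solve-∀

-- Expand the product: the diagonal terms exceed c/7 each and a mixed pair exceeds 2c/7. Three
-- diagonal terms and two mixed pairs already pass 7c/7, so the third pair need only be nonnegative.
three-products : ∀ {a₁ a₂ a₃ k₁ k₂ k₃ c} → (a₁ + a₂ + a₃) * (k₁ + k₂ + k₃) ≡ c → 0ℤ ≤ c →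
  0ℤ ≤ a₁ → 0ℤ ≤ a₂ → 0ℤ ≤ a₃ →
  c + 1ℤ ≤ + 7 * (a₁ * k₁) → c + 1ℤ ≤ + 7 * (a₂ * k₂) → c + 1ℤ ≤ + 7 * (a₃ * k₃) → ⊥
three-products {a₁} {a₂} {a₃} {k₁} {k₂} {k₃} refl 0≤c p₁ p₂ p₃ h₁ h₂ h₃ = contradiction
  (lin (h₁ ⊕ h₂ ⊕ h₃ ⊕ mixed-sum 0≤c p₁ 0≤k₁ p₂ 0≤k₂ h₁ h₂ ⊕ mixed-sum 0≤c p₁ 0≤k₁ p₃ 0≤k₃ h₁ h₃
      ⊕ (7 ⊛ (*-nonneg p₂ 0≤k₃ ⊕ *-nonneg p₃ 0≤k₂)) ⊕ 0≤+ {4})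
    (r a₁ a₂ a₃ k₁ k₂ k₃))
  (suc≰ {0ℤ})
  where
  0≤k₁ : 0ℤ ≤ k₁
  0≤k₁ = pos-factor 0≤c p₁ h₁
  0≤k₂ : 0ℤ ≤ k₂
  0≤k₂ = pos-factor 0≤c p₂ h₂
  0≤k₃ : 0ℤ ≤ k₃
  0≤k₃ = pos-factor 0≤c p₃ h₃
  r : ∀ a₁ a₂ a₃ k₁ k₂ k₃ → let c = (a₁ + a₂ + a₃) * (k₁ + k₂ + k₃) in
    0ℤ + (c + 1ℤ + (c + 1ℤ + (c + 1ℤ + (+ 2 * c + 1ℤ + (+ 2 * c + 1ℤ + (+ 7 * (0ℤ + 0ℤ) + 0ℤ))))))
    ≡ 0ℤ + 1ℤ + (+ 7 * (a₁ * k₁) + (+ 7 * (a₂ * k₂) + (+ 7 * (a₃ * k₃) + (+ 7 * (a₁ * k₂ + a₂ * k₁)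
      + (+ 7 * (a₁ * k₃ + a₃ * k₁) + (+ 7 * (a₂ * k₃ + a₃ * k₂) + + 4))))))
  r = solve-∀

-- The condition under which the group with y-sum s and degree sum g, placed against all other big
-- vertices, can be balanced exactly by a bias of (T - 2s) / T of the remaining vertices.
record Biased (T D m s g : ℤ) : Set where
  constructor biased
  field bound : + 7 * ((T - + 2 * s) * ((D - + 2 * g) * T + (T - + 2 * s) * (m - D))) ≤ m * (T * T)

Biased-bound : ∀ {T D m s g Δ X S μ} → Biased T D m s g → Δ ≡ T - + 2 * s →
  X ≡ - (T * Δ) * (+ 2 * g - D) + Δ * Δ * (m - D) → S ≡ 0ℤ → 0ℤ ≤ μ → + 7 * (X + T * ∥ S ∥) ≤ T * T * (m + + 3 * μ)
Biased-bound {T} {D} {m} {s} {g} {μ = μ} (biased p) refl refl refl 0≤μ =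
  lin (p ⊕ *-monoˡ (square-nonneg T) (3 ⊛ 0≤μ)) (r T (T - + 2 * s) g D m μ)
  where
  r : ∀ T Δ g D m μ → T * T * (m + + 3 * μ) + (+ 7 * (Δ * ((D - + 2 * g) * T + Δ * (m - D))) + T * T * (+ 3 * 0ℤ))
    ≡ + 7 * (- (T * Δ) * (+ 2 * g - D) + Δ * Δ * (m - D) + T * 0ℤ) + (m * (T * T) + T * T * (+ 3 * μ))
  r = solve-∀

-- Since the groups exhaust both `T` and `D`, the factors `α` sum to T and the factors `κ` to mT.
three-groups : ∀ {T D m s₁ s₂ s₃ g₁ g₂ g₃} → s₁ + s₂ + s₃ ≡ T → g₁ + g₂ + g₃ ≡ D → 0ℤ ≤ m →
  + 2 * s₁ ≤ T → + 2 * s₂ ≤ T → + 2 * s₃ ≤ T →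
  Biased T D m s₁ g₁ ⊎ Biased T D m s₂ g₂ ⊎ Biased T D m s₃ g₃
three-groups {T} {D} {m} {s₁} {s₂} {s₃} {g₁} {g₂} {g₃} refl refl 0≤m p₁ p₂ p₃ =
  choose (_ ℤₚ.≤? c) (_ ℤₚ.≤? c) (_ ℤₚ.≤? c)
  where
  c : ℤ
  c = m * (T * T)
  α : ℤ → ℤ
  α s = T - + 2 * s
  κ : ℤ → ℤ → ℤ
  κ s g = (D - + 2 * g) * T + α s * (m - D)
  total : (α s₁ + α s₂ + α s₃) * (κ s₁ g₁ + κ s₂ g₂ + κ s₃ g₃) ≡ c
  total = r m s₁ s₂ s₃ g₁ g₂ g₃
    where
    r : ∀ m s₁ s₂ s₃ g₁ g₂ g₃ → let T = s₁ + s₂ + s₃ ; D = g₁ + g₂ + g₃ in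
      (T - + 2 * s₁ + (T - + 2 * s₂) + (T - + 2 * s₃)) *
        ((D - + 2 * g₁) * T + (T - + 2 * s₁) * (m - D) + ((D - + 2 * g₂) * T + (T - + 2 * s₂) * (m - D))
          + ((D - + 2 * g₃) * T + (T - + 2 * s₃) * (m - D))) ≡ m * (T * T)
    r = solve-∀
  choose : Dec (+ 7 * (α s₁ * κ s₁ g₁) ≤ c) → Dec (+ 7 * (α s₂ * κ s₂ g₂) ≤ c) → Dec (+ 7 * (α s₃ * κ s₃ g₃) ≤ c) →
    Biased T D m s₁ g₁ ⊎ Biased T D m s₂ g₂ ⊎ Biased T D m s₃ g₃
  choose (yes b) _ _ = inj₁ (biased b)
  choose _ (yes b) _ = inj₂ (inj₁ (biased b))
  choose _ _ (yes b) = inj₂ (inj₂ (biased b))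
  choose (no b₁) (no b₂) (no b₃) = ⊥-elim (three-products
    {α s₁} {α s₂} {α s₃} {κ s₁ g₁} {κ s₂ g₂} {κ s₃ g₃}
    total (*-nonneg 0≤m (square-nonneg T)) (i≤j⇒0≤j-i p₁) (i≤j⇒0≤j-i p₂) (i≤j⇒0≤j-i p₃)
    (≰⇒suc≤ b₁) (≰⇒suc≤ b₂) (≰⇒suc≤ b₃))

-- Crossing numbers when the big vertices are independent

module Core {n : ℕ} (g : Fin n → Fin n → Bool) (irreflexive : ∀ v → g v v ≡ false)
            (big : Fin n → Bool) (big-independent : ∀ u v → big u ≡ true → big v ≡ true → g u v ≡ false)
            (N : ℕ) (M : ℤ) (0<M : 0ℤ < M) where

  e : Fin n → Fin n → ℤ
  e u v = ⟦ g u v ⟧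

  out inn deg b : Fin n → ℤ
  out v = ∑ (e v)
  inn v = ∑ (λ w → e w v)
  deg v = out v + inn v
  b v = out v - inn v

  m : ℤ
  m = ∑ out

  small : Fin n → Bool
  small v = not (big v) ∧ does (deg v ℤₚ.≤? + N)

  -- Neither big nor allowed as a leaf. Their degrees exceed N, so N times their number is at most
  -- 2m.
  medium : Fin n → ℤ
  medium v = ⟦ not (big v) ∧ not (small v) ⟧

  h : Fin n → Fin n → Bool
  h u v = g u v ∧ ((not (big u) ∧ not (big v)) ∧ (small u ∨ small v))

  0≤e : ∀ u v → 0ℤ ≤ e u v
  0≤e u v = 0≤⟦ g u v ⟧

  0≤out : ∀ v → 0ℤ ≤ out v
  0≤out v = ∑-nonneg (0≤e v)

  0≤inn : ∀ v → 0ℤ ≤ inn v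
  0≤inn v = ∑-nonneg (λ w → 0≤e w v)

  0≤deg : ∀ v → 0ℤ ≤ deg v
  0≤deg v = 0≤out v ⊕ 0≤inn v

  ∑-inn : ∑ inn ≡ m
  ∑-inn = sym (∑-swap e)

  ∑-deg : ∑ deg ≡ m + m
  ∑-deg = trans (∑-+ out inn) (cong (λ t → m + t) ∑-inn)

  small-deg : ∀ v → small v ≡ true → deg v ≤ + N
  small-deg v p with big v | deg v ℤₚ.≤? + N
  ... | false | yes q = q

  medium-deg : ∀ v → + N * medium v ≤ deg v
  medium-deg v with big v | deg v ℤₚ.≤? + N
  ... | true  | _     = subst (_≤ deg v) (sym (*-zeroʳ (+ N))) (0≤deg v)
  ... | false | yes _ = subst (_≤ deg v) (sym (*-zeroʳ (+ N))) (0≤deg v)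
  ... | false | no p  = subst (_≤ deg v) (sym (ℤₚ.*-identityʳ (+ N))) (≰⇒≥ p)

  crossing : (Fin n → Bool) → Bool → ℤ
  crossing side x = ∑ (λ u → ∑ (λ v → ⟦ not (side u xor x) ⟧ * (⟦ side v xor x ⟧ * e u v)))

  -- 3m/14 up to 13M/(28N): of the 13, rounding costs 7 and the medium vertices cost 6.
  Good : Set
  Good = ∃ λ (side : Fin n → Bool) → ∀ x → + 6 * + N * m ≤ + 28 * + N * crossing side x + + 13 * M

  -- For x = ±1 the product (1 + x s_u)(1 - x s_v) is 4 on the arcs that are counted and 0 on all
  -- others.
  crossing≡ : ∀ side x → + 4 * crossing side x ≡
    m + sgn x * ∑ (λ v → b v * sgn (side v)) - ∑ (λ u → ∑ (λ v → e u v * (sgn (side u) * sgn (side v))))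
  crossing≡ side x = begin
    + 4 * crossing side x
      ≡⟨ sym (∑-* (+ 4) _) ⟩
    ∑ (λ u → + 4 * ∑ (λ v → ⟦ not (side u xor x) ⟧ * (⟦ side v xor x ⟧ * e u v)))
      ≡⟨ ∑-cong (λ u → trans (sym (∑-* (+ 4) _)) (trans (∑-cong (λ v → four (side u) (side v) x (e u v))) (split u))) ⟩
    ∑ (λ u → out u + sgn x * (sgn (side u) * out u) + - sgn x * ∑ (λ v → e u v * sgn (side v)) + - ∑ (λ v → e u v * (sgn (side u) * sgn (side v))))
      ≡⟨ trans (∑-+ _ _) (cong₂ _+_ (trans (∑-+ _ _) (cong₂ _+_ (trans (∑-+ _ _) (cong (λ t → m + t) (∑-* (sgn x) _))) (∑-* (- sgn x) _))) (∑-neg _)) ⟩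
    m + sgn x * ∑ (λ u → sgn (side u) * out u) + - sgn x * ∑ (λ u → ∑ (λ v → e u v * sgn (side v))) + - X
      ≡⟨ cong (λ t → m + sgn x * ∑ (λ u → sgn (side u) * out u) + - sgn x * t + - X)
           (trans (∑-swap (λ u v → e u v * sgn (side v))) (∑-cong (λ v → ∑-*ʳ (sgn (side v)) (λ u → e u v)))) ⟩
    m + sgn x * ∑ (λ u → sgn (side u) * out u) + - sgn x * ∑ (λ v → inn v * sgn (side v)) + - X
      ≡⟨ collect m (sgn x) _ _ X ⟩
    m + sgn x * (∑ (λ u → sgn (side u) * out u) + - ∑ (λ v → inn v * sgn (side v))) - X
      ≡⟨ cong (λ t → m + sgn x * t - X) (trans (cong (λ t → ∑ (λ u → sgn (side u) * out u) + t) (sym (∑-neg _)))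
           (trans (sym (∑-+ _ _)) (∑-cong (λ v → fold (sgn (side v)) (out v) (inn v))))) ⟩
    m + sgn x * ∑ (λ v → b v * sgn (side v)) - X ∎
    where
    open ≡-Reasoning
    X : ℤ
    X = ∑ (λ u → ∑ (λ v → e u v * (sgn (side u) * sgn (side v))))
    bit₁ : ∀ p q e → + 4 * (⟦ not (p xor q) ⟧ * e) ≡ + 2 * (1ℤ + sgn q * sgn p) * e
    bit₁ true  true  e = r e where
      r : ∀ e → + 4 * (1ℤ * e) ≡ + 2 * (1ℤ + 1ℤ * 1ℤ) * e
      r = solve-∀
    bit₁ true  false e = r e where
      r : ∀ e → + 4 * (0ℤ * e) ≡ + 2 * (1ℤ + - 1ℤ * 1ℤ) * e
      r = solve-∀
    bit₁ false true  e = r e where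
      r : ∀ e → + 4 * (0ℤ * e) ≡ + 2 * (1ℤ + 1ℤ * - 1ℤ) * e
      r = solve-∀
    bit₁ false false e = r e where
      r : ∀ e → + 4 * (1ℤ * e) ≡ + 2 * (1ℤ + - 1ℤ * - 1ℤ) * e
      r = solve-∀
    bit₂ : ∀ p q → + 2 * ⟦ p xor q ⟧ ≡ 1ℤ - sgn q * sgn p
    bit₂ true  true  = refl
    bit₂ true  false = refl
    bit₂ false true  = refl
    bit₂ false false = refl
    four : ∀ p q x e → + 4 * (⟦ not (p xor x) ⟧ * (⟦ q xor x ⟧ * e)) ≡
      e + sgn x * (sgn p * e) + - sgn x * (e * sgn q) + - (e * (sgn p * sgn q))
    four p q x e = begin
      + 4 * (⟦ not (p xor x) ⟧ * (⟦ q xor x ⟧ * e)) ≡⟨ bit₁ p x _ ⟩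
      + 2 * (1ℤ + sgn x * sgn p) * (⟦ q xor x ⟧ * e) ≡⟨ r₁ (1ℤ + sgn x * sgn p) ⟦ q xor x ⟧ e ⟩
      (1ℤ + sgn x * sgn p) * (+ 2 * ⟦ q xor x ⟧) * e ≡⟨ cong (λ t → (1ℤ + sgn x * sgn p) * t * e) (bit₂ q x) ⟩
      (1ℤ + sgn x * sgn p) * (1ℤ - sgn x * sgn q) * e ≡⟨ r₂ (sgn x) (sgn p) (sgn q) e ⟩
      e + sgn x * (sgn p * e) + - sgn x * (e * sgn q) + - (sgn x * sgn x * (e * (sgn p * sgn q)))
        ≡⟨ cong (λ t → e + sgn x * (sgn p * e) + - sgn x * (e * sgn q) + - t) (trans (cong (_* (e * (sgn p * sgn q))) (sgn² x)) (*-identityˡ _)) ⟩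
      e + sgn x * (sgn p * e) + - sgn x * (e * sgn q) + - (e * (sgn p * sgn q)) ∎
      where
      r₁ : ∀ a b e → + 2 * a * (b * e) ≡ a * (+ 2 * b) * e
      r₁ = solve-∀
      r₂ : ∀ x p q e → (1ℤ + x * p) * (1ℤ - x * q) * e ≡ e + x * (p * e) + - x * (e * q) + - (x * x * (e * (p * q)))
      r₂ = solve-∀
    split : ∀ u → ∑ (λ v → e u v + sgn x * (sgn (side u) * e u v) + - sgn x * (e u v * sgn (side v)) + - (e u v * (sgn (side u) * sgn (side v)))) ≡
      out u + sgn x * (sgn (side u) * out u) + - sgn x * ∑ (λ v → e u v * sgn (side v)) + - ∑ (λ v → e u v * (sgn (side u) * sgn (side v)))
    split u = trans (∑-+ _ _) (cong₂ _+_ (trans (∑-+ _ _) (cong₂ _+_ (trans (∑-+ _ _) (cong (λ t → out u + t)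
      (trans (∑-* (sgn x) _) (cong (sgn x *_) (∑-* (sgn (side u)) (e u)))))) (∑-* (- sgn x) _))) (∑-neg _))
    collect : ∀ m x a c X → m + x * a + - x * c + - X ≡ m + x * (a + - c) - X
    collect = solve-∀
    fold : ∀ s o i → s * o + - (i * s) ≡ (o - i) * s
    fold = solve-∀

  module FromSpins (m≤M : m ≤ M) (sparse : ∀ v → big v ≡ false → + 2 * (+ N * + N) * (+ N + 1ℤ) * deg v ≤ M)
                   (root : Fin n → Fin n) (stars : IsStarMap h small root)
                   (W : ℤ) (0<W : 0ℤ < W) (d : Fin n → ℤ) (-W≤d : ∀ v → 0ℤ ≤ W + d v) (d≤W : ∀ v → 0ℤ ≤ W - d v)
                   (fixed : ∀ v → big v ≡ true → d v * d v ≡ W * W) where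

    open IsStarMap stars

    ε : Fin n → ℤ
    ε v = sgn (root v == v)

    open Spins W d e root ε b public

    γ : Fin n → ℤ
    γ r = ∑ (λ v → ⟦ root v == r ⟧ * deg v)

    ∑-γ : ∑ γ ≡ m + m
    ∑-γ = begin
      ∑ γ ≡⟨ ∑-cong (λ r → sym (ℤₚ.*-identityʳ (γ r))) ⟩
      ∑ (λ r → γ r * 1ℤ) ≡⟨ ∑-fibre root deg (λ _ → 1ℤ) ⟩
      ∑ (λ v → deg v * 1ℤ) ≡⟨ ∑-cong (λ v → ℤₚ.*-identityʳ (deg v)) ⟩
      ∑ deg ≡⟨ ∑-deg ⟩
      m + m ∎
      where open ≡-Reasoning

    bε≤deg : ∀ v → b v * ε v ≤ deg v
    bε≤deg v with root v == v
    ... | true  = lin (0≤inn v ⊕ 0≤inn v) (r (out v) (inn v))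
      where
      r : ∀ o i → o + i + (0ℤ + 0ℤ) ≡ (o - i) * 1ℤ + (i + i)
      r = solve-∀
    ... | false = lin (0≤out v ⊕ 0≤out v) (r (out v) (inn v))
      where
      r : ∀ o i → o + i + (0ℤ + 0ℤ) ≡ (o - i) * - 1ℤ + (o + o)
      r = solve-∀

    -bε≤deg : ∀ v → - (b v * ε v) ≤ deg v
    -bε≤deg v with root v == v
    ... | true  = lin (0≤out v ⊕ 0≤out v) (r (out v) (inn v))
      where
      r : ∀ o i → o + i + (0ℤ + 0ℤ) ≡ - ((o - i) * 1ℤ) + (o + o)
      r = solve-∀
    ... | false = lin (0≤inn v ⊕ 0≤inn v) (r (out v) (inn v))
      where
      r : ∀ o i → o + i + (0ℤ + 0ℤ) ≡ - ((o - i) * - 1ℤ) + (i + i)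
      r = solve-∀

    0≤γ : ∀ r → 0ℤ ≤ γ r
    0≤γ r = ∑-nonneg (λ v → *-nonneg 0≤⟦ root v == r ⟧ (0≤deg v))

    β≤γ : ∀ r → β r ≤ γ r
    β≤γ r = ∑-mono (λ v → *-monoˡ 0≤⟦ root v == r ⟧ (bε≤deg v))

    -β≤γ : ∀ r → - β r ≤ γ r
    -β≤γ r = subst (_≤ γ r) (∑-neg (λ v → ⟦ root v == r ⟧ * (b v * ε v)))
      (∑-mono (λ v → subst (_≤ ⟦ root v == r ⟧ * deg v) (sym (ℤₚ.neg-distribʳ-* ⟦ root v == r ⟧ (b v * ε v)))
                       (*-monoˡ 0≤⟦ root v == r ⟧ (-bε≤deg v))))

    -- Leaves are adjacent to the centre, so there are at most `deg r` of them, and being small each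
    -- has degree at most N.
    star-degree : ∀ r → γ r ≤ (+ N + 1ℤ) * deg r
    star-degree r = ≤-trans (∑-mono pointwise) (≤-reflexive (begin
      ∑ (λ v → ⟦ r == v ⟧ * deg v + + N * (e v r + e r v))
        ≡⟨ trans (∑-+ (λ v → ⟦ r == v ⟧ * deg v) _) (cong₂ _+_ (∑-δ r deg) (trans (∑-* (+ N) _) (cong (+ N *_) (∑-+ (λ v → e v r) (e r))))) ⟩
      deg r + + N * (inn r + out r) ≡⟨ r₁ (out r) (inn r) (+ N) ⟩
      (+ N + 1ℤ) * deg r ∎))
      where
      open ≡-Reasoning
      r₁ : ∀ o i N → o + i + N * (i + o) ≡ (N + 1ℤ) * (o + i)
      r₁ = solve-∀
      h≤e : ∀ u v → h u v ≡ true → 1ℤ ≤ e u v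
      h≤e u v p with g u v
      ... | true = ≤-refl
      adjacent : ∀ u v → h u v ∨ h v u ≡ true → 1ℤ ≤ e u v + e v u
      adjacent u v p with h u v in q
      ... | true  = h≤e u v q ⊕ 0≤e v u
      ... | false = 0≤e u v ⊕ h≤e v u p
      0≤N* : ∀ v → 0ℤ ≤ + N * (e v r + e r v)
      0≤N* v = *-nonneg (0≤+ {N}) (0≤e v r ⊕ 0≤e r v)
      pointwise : ∀ v → ⟦ root v == r ⟧ * deg v ≤ ⟦ r == v ⟧ * deg v + + N * (e v r + e r v)
      pointwise v with root v ≟ r | r ≟ v
      ... | no _ | d = *-nonneg 0≤⟦ does d ⟧ (0≤deg v) ⊕ 0≤N* v
      ... | yes _ | yes _ = subst (_≤ 1ℤ * deg v + + N * (e v r + e r v)) (ℤₚ.+-identityʳ (1ℤ * deg v)) (≤-refl {1ℤ * deg v} ⊕ 0≤N* v)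
      ... | yes refl | no ne = begin′
        where
        begin′ : 1ℤ * deg v ≤ 0ℤ * deg v + + N * (e v (root v) + e (root v) v)
        begin′ = ≤-trans (≤-reflexive (*-identityˡ (deg v))) (≤-trans (small-deg v (leaf-small ne))
          (≤-trans (≤-trans (≤-reflexive (sym (ℤₚ.*-identityʳ (+ N)))) (N ⊛ adjacent v (root v) (leaf-nbr ne)))
            (≤-reflexive (sym (ℤₚ.+-identityˡ _)))))

    private
      k : ℤ
      k = + N + 1ℤ

      0<k : 0ℤ < + 2 * k
      0<k = subst (0ℤ <_) (cong (λ t → + 2 * t) (ℤₚ.+-comm 1ℤ (+ N))) (+<+ (ℕ.s≤s ℕ.z≤n))

      0≤k : 0ℤ ≤ k
      0≤k = 0≤+ {N} ⊕ 0≤+ {1}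

      C : ℤ
      C = + 2 * (+ N * + N) * k

      0≤C : 0ℤ ≤ C
      0≤C = *-nonneg (2 ⊛ *-nonneg (0≤+ {N}) (0≤+ {N})) 0≤k

      0≤WW : 0ℤ ≤ W * W
      0≤WW = square-nonneg W

    -- A big centre has a deterministic sign. Otherwise `star-degree` and `sparse` give 2N² `γ r` ≤
    -- M; this bounds one factor of `γ r` squared, and the other is summed by `∑-γ`.
    variance-term : ∀ r → C * (β r * β r * (W * W - d r * d r)) ≤ k * M * (W * W) * γ r
    variance-term r with big r in br
    ... | true = subst (_≤ k * M * (W * W) * γ r)
          (sym (trans (cong (λ t → C * (β r * β r * (W * W - t))) (fixed r br)) (r₁ C (β r * β r) (W * W))))
          (*-nonneg (*-nonneg (*-nonneg 0≤k (ℤₚ.<⇒≤ 0<M)) 0≤WW) (0≤γ r))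
      where
      r₁ : ∀ C x w → C * (x * (w - w)) ≡ 0ℤ
      r₁ = solve-∀
    ... | false = ≤-trans (*-monoˡ 0≤C (*-monoˡ (square-nonneg (β r)) drop))
        (≤-trans (*-monoˡ 0≤C (mono (W * W) 0≤WW (sq-mono (β≤γ r) (-β≤γ r))))
        (≤-trans (≤-reflexive (r₁ C (γ r) (W * W)))
        (≤-trans (*-monoˡ (*-nonneg 0≤WW (0≤γ r)) (≤-trans (*-monoˡ 0≤C (star-degree r)) (≤-trans (≤-reflexive (r₃ C k (deg r))) (*-monoˡ 0≤k (sparse r br)))))
        (≤-reflexive (r₂ (W * W) (γ r) k M)))))
      where
      drop : W * W - d r * d r ≤ W * W
      drop = lin (square-nonneg (d r)) (r₀ (W * W) (d r * d r))
        where
        r₀ : ∀ w d → w + 0ℤ ≡ (w - d) + d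
        r₀ = solve-∀
      mono : ∀ k {a b} → 0ℤ ≤ k → a ≤ b → a * k ≤ b * k
      mono k {a} {b} p q = subst₂ _≤_ (*-comm k a) (*-comm k b) (*-monoˡ p q)
      r₁ : ∀ C x w → C * (x * x * w) ≡ w * x * (C * x)
      r₁ = solve-∀
      r₂ : ∀ w x k M → w * x * (k * M) ≡ k * M * w * x
      r₂ = solve-∀
      r₃ : ∀ C k x → C * (k * x) ≡ k * (C * x)
      r₃ = solve-∀

    variance : + N * + N * V ≤ M * M * (W * W)
    variance = *-cancelˡ 0<k (≤-trans (≤-reflexive (r₁ (+ N) V k)) (≤-trans total
        (≤-trans (≤-reflexive (r₂ k M (W * W) m)) (≤-trans (*-monoˡ (*-nonneg (*-nonneg (*-nonneg 0≤k (ℤₚ.<⇒≤ 0<M)) 0≤WW) (0≤+ {2})) m≤M)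
        (≤-reflexive (r₃ k M (W * W)))))))
      where
      r₁ : ∀ N V k → + 2 * k * (N * N * V) ≡ + 2 * (N * N) * k * V
      r₁ = solve-∀
      r₂ : ∀ k M w m → k * M * w * (m + m) ≡ k * M * w * + 2 * m
      r₂ = solve-∀
      r₃ : ∀ k M w → k * M * w * + 2 * M ≡ + 2 * k * (M * M * w)
      r₃ = solve-∀
      total : C * V ≤ k * M * (W * W) * (m + m)
      total = subst₂ _≤_ (∑-* C _) (trans (∑-* (k * M * (W * W)) γ) (cong (k * M * (W * W) *_) ∑-γ)) (∑-mono variance-term)

    -- The hypothesis bounds the mean of X plus the absolute value of the mean of S by m/7, up to
    -- medium vertices; rounding adds M/N.
    good : + 7 * (X̄ + W * ∥ S̄ ∥) ≤ W * W * (m + + 3 * ∑ medium) → Good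
    good hyp = side , λ x → lin
        (*-monoˡ {+ 7 * + N} (7 ⊛ 0≤+ {N}) (signed x) ⊕ rounded ⊕ (3 ⊛ mediums) ⊕ (6 ⊛ m≤M)
          ⊕ ≤-reflexive (cong (+ 7 * + N *_) (sym (four x))))
        (r (+ N) m M (X s) (∥ S s ∥) (sgn x * S s) (∑ medium) (crossing side x))
      where
      att : ∃ λ s → + N * (W * W * (X s + ∥ S s ∥)) ≤ + N * (X̄ + W * ∥ S̄ ∥) + M * (W * W)
      att = rounding 0<W -W≤d d≤W (0≤+ {N}) 0<M variance
      s : Fin n → Bool
      s = proj₁ att
      side : Fin n → Bool
      side v = not ((root v == v) xor s (root v))
      side-spin : ∀ v → sgn (side v) ≡ spin s v
      side-spin v with root v == v | s (root v)
      ... | true  | true  = refl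
      ... | true  | false = refl
      ... | false | true  = refl
      ... | false | false = refl
      four : ∀ x → + 4 * crossing side x ≡ m + sgn x * S s - X s
      four x = trans (crossing≡ side x) (cong₂ (λ p q → m + sgn x * p - q)
        (∑-cong (λ v → cong (b v *_) (side-spin v)))
        (∑-cong (λ u → ∑-cong (λ v → cong₂ (λ p q → e u v * (p * q)) (side-spin u) (side-spin v)))))
      0<WW : 0ℤ < W * W
      0<WW = pos W 0<W
        where
        pos : ∀ W → 0ℤ < W → 0ℤ < W * W
        pos (+ suc w) _ = +<+ (ℕ.s≤s ℕ.z≤n)
        pos (+ 0) (+<+ ())
      rounded : + 7 * (+ N * (X s + ∥ S s ∥)) ≤ + N * (m + + 3 * ∑ medium) + + 7 * M
      rounded = *-cancelˡ 0<WW (lin ((7 ⊛ proj₂ att) ⊕ (N ⊛ hyp)) (r₁ (+ N) W (X s) (∥ S s ∥) X̄ (W * ∥ S̄ ∥) m (∑ medium) M))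
        where
        r₁ : ∀ N W x y X̄ s̄ m μ M →
          W * W * (N * (m + + 3 * μ) + + 7 * M) + (+ 7 * (N * (W * W * (x + y))) + N * (+ 7 * (X̄ + s̄)))
          ≡ W * W * (+ 7 * (N * (x + y))) + (+ 7 * (N * (X̄ + s̄) + M * (W * W)) + N * (W * W * (m + + 3 * μ)))
        r₁ = solve-∀
      mediums : + N * ∑ medium ≤ m + m
      mediums = subst₂ _≤_ (∑-* (+ N) medium) ∑-deg (∑-mono medium-deg)
      signed : ∀ x → - (sgn x * S s) ≤ ∥ S s ∥
      signed true  = subst (_≤ ∥ S s ∥) (cong -_ (sym (*-identityˡ (S s)))) (-a≤∥a∥ (S s))
      signed false = subst (_≤ ∥ S s ∥) (r₂ (S s)) (a≤∥a∥ (S s))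
        where
        r₂ : ∀ a → a ≡ - (- 1ℤ * a)
        r₂ = solve-∀
      r : ∀ N m M x y σ μ c → + 28 * N * c + + 13 * M
        + (+ 7 * N * - σ + (+ 7 * (N * (x + y)) + (+ 3 * (N * μ) + (+ 6 * m + + 7 * N * (m + σ - x)))))
        ≡ + 6 * N * m + (+ 7 * N * y + (N * (m + + 3 * μ) + + 7 * M + (+ 3 * (m + m) + (+ 6 * M + + 7 * N * (+ 4 * c)))))
      r = solve-∀

  -- Unbiased signs: demands, stars and prescribed signs of big vertices

  y : Fin n → ℤ
  y v = ⟦ big v ⟧ * (inn v - out v)

  T nB n₁ : ℤ
  T = ∑ y
  nB = ∑ (λ v → ⟦ not (big v) ⟧)

  outBig outRest demand : Fin n → ℤ
  outBig u = ∑ (λ v → ⟦ big v ⟧ * e u v)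
  outRest u = ∑ (λ v → ⟦ not (big v) ⟧ * e u v)
  demand u = outRest u ℤ.⊓ + 3

  sendsToBig : Fin n → Bool
  sendsToBig u = not (big u) ∧ does (1ℤ ℤₚ.≤? outBig u)

  n₁ = ∑ (λ u → ⟦ sendsToBig u ⟧)

  c : Fin n → ℤ
  c v = ⟦ small v ⟧ * demand v

  0≤outBig : ∀ v → 0ℤ ≤ outBig v
  0≤outBig v = ∑-nonneg (λ w → *-nonneg 0≤⟦ big w ⟧ (0≤e v w))

  0≤demand : ∀ v → 0ℤ ≤ demand v
  0≤demand v = ℤₚ.⊓-glb (∑-nonneg (λ w → *-nonneg 0≤⟦ not (big w) ⟧ (0≤e v w))) 0≤+

  out-split : ∀ u → outBig u + outRest u ≡ out u
  out-split u = trans (sym (∑-+ _ _)) (∑-cong (λ v → both (big v) (e u v)))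
    where
    both : ∀ p x → ⟦ p ⟧ * x + ⟦ not p ⟧ * x ≡ x
    both true  = solve-∀
    both false = solve-∀

  small⇒¬big : ∀ {v} → small v ≡ true → big v ≡ false
  small⇒¬big {v} p with big v
  ... | false = refl

  h-ends : ∀ u v → h u v ≡ true → big u ≡ false × big v ≡ false
  h-ends u v p with g u v | big u | big v
  ... | true | false | false = refl , refl

  h-intro : ∀ {p q r s t} → p ≡ true → q ≡ false → r ≡ false → s ≡ true →
    p ∧ ((not q ∧ not r) ∧ (s ∨ t)) ≡ true
  h-intro refl refl refl refl = refl

  private
    h-irreflexive : ∀ v → h v v ≡ false
    h-irreflexive v rewrite irreflexive v = refl

    h-touches : ∀ u v → h u v ≡ true → small u ≡ false → small v ≡ true
    h-touches u v p q with g u v | not (big u) ∧ not (big v) | small u | small v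
    ... | true | true | false | true = refl

    0≤c : ∀ v → 0ℤ ≤ c v
    0≤c v = *-nonneg 0≤⟦ small v ⟧ (0≤demand v)

    c≤demand : ∀ v → c v ≤ demand v
    c≤demand v with small v
    ... | true  = ≤-reflexive (*-identityˡ (demand v))
    ... | false = 0≤demand v

    c≤out : ∀ v → c v ≤ ∑ (λ w → ⟦ h v w ⟧)
    c≤out v with small v in s
    ... | false = ∑-nonneg (λ w → 0≤⟦ g v w ∧ ((not (big v) ∧ not (big w)) ∧ small w) ⟧)
    ... | true  = ≤-trans (≤-reflexive (*-identityˡ (demand v))) (≤-trans (ℤₚ.i⊓j≤i (outRest v) (+ 3)) (∑-mono arc))
      where
      arc : ∀ w → ⟦ not (big w) ⟧ * e v w ≤ ⟦ g v w ∧ ((not (big v) ∧ not (big w)) ∧ true) ⟧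
      arc w rewrite small⇒¬big {v} s with g v w | big w
      ... | true  | true  = ≤-refl
      ... | true  | false = ≤-refl
      ... | false | true  = ≤-refl
      ... | false | false = ≤-refl

    c-small : ∀ v → small v ≡ false → c v ≡ 0ℤ
    c-small v s rewrite s = refl

  open Stars h h-irreflexive small h-touches c 0≤c (λ v → ≤-trans (c≤demand v) (ℤₚ.i⊓j≤j (outRest v) (+ 3))) c≤out c-small
    using (root; isStarMap; star-bound)

  -- If x ≤ 3 the right side is 2(x + z) ≥ 8. If x ≥ 3 it is at least 3 + 4, and at least 3 + 3 + 2
  -- when z ≥ 1.
  degree-count : ∀ {x z} → 0ℤ ≤ z → + 4 ≤ z + x → + 7 + ⟦ does (1ℤ ℤₚ.≤? z) ⟧ ≤ x ℤ.⊓ + 3 + (z + x) + z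
  degree-count {x} {z} 0≤z p with ℤₚ.≤-total x (+ 3)
  ... | inj₁ x≤3 rewrite ℤₚ.i≤j⇒i⊓j≡i x≤3 = lin ((2 ⊛ p) ⊕ ⟦ does (1ℤ ℤₚ.≤? z) ⟧≤1) (r x z ⟦ does (1ℤ ℤₚ.≤? z) ⟧)
    where
    r : ∀ x z f → x + (z + x) + z + (+ 2 * + 4 + f) ≡ + 7 + f + (+ 2 * (z + x) + 1ℤ)
    r = solve-∀
  ... | inj₂ 3≤x rewrite ℤₚ.i≥j⇒i⊓j≡j 3≤x with 1ℤ ℤₚ.≤? z
  ... | yes 1≤z = lin (3≤x ⊕ (2 ⊛ 1≤z)) (r x z)
    where
    r : ∀ x z → + 3 + (z + x) + z + (+ 3 + + 2 * 1ℤ) ≡ + 7 + 1ℤ + (x + + 2 * z)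
    r = solve-∀
  ... | no _ = lin (p ⊕ 0≤z) (r x z)
    where
    r : ∀ x z → + 3 + (z + x) + z + (+ 4 + 0ℤ) ≡ + 7 + 0ℤ + (z + x + z)
    r = solve-∀

  module WithOutdegree (m≤M : m ≤ M) (sparse : ∀ v → big v ≡ false → + 2 * (+ N * + N) * (+ N + 1ℤ) * deg v ≤ M)
                       (outdegree≥4 : ∀ v → big v ≡ false → + 4 ≤ out v) where

    -- Adding `T` removes from `m` the arcs leaving big vertices and counts those entering them
    -- twice.
    m+T : m + T ≡ ∑ (λ u → ⟦ not (big u) ⟧ * out u + outBig u)
    m+T = begin
      m + T
        ≡⟨ cong (λ t → m + t) (trans (∑-cong (λ v → r₁ ⟦ big v ⟧ (inn v) (out v))) (∑-+ _ _)) ⟩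
      m + (∑ (λ v → ⟦ big v ⟧ * inn v) + ∑ (λ v → - (⟦ big v ⟧ * out v)))
        ≡⟨ cong (λ t → m + (t + ∑ (λ v → - (⟦ big v ⟧ * out v))))
             (trans (∑-cong (λ v → sym (∑-* ⟦ big v ⟧ _))) (∑-swap (λ v u → ⟦ big v ⟧ * e u v))) ⟩
      m + (∑ outBig + ∑ (λ v → - (⟦ big v ⟧ * out v)))
        ≡⟨ r₂ m (∑ outBig) _ ⟩
      (m + ∑ (λ v → - (⟦ big v ⟧ * out v))) + ∑ outBig
        ≡⟨ trans (cong (λ t → t + ∑ outBig) (sym (∑-+ out _))) (sym (∑-+ _ outBig)) ⟩
      ∑ (λ u → out u + - (⟦ big u ⟧ * out u) + outBig u)
        ≡⟨ ∑-cong (λ u → cong (λ t → t + outBig u) (rest (big u) (out u))) ⟩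
      ∑ (λ u → ⟦ not (big u) ⟧ * out u + outBig u) ∎
      where
      open ≡-Reasoning
      r₁ : ∀ a i o → a * (i - o) ≡ a * i + - (a * o)
      r₁ = solve-∀
      r₂ : ∀ m a b → m + (a + b) ≡ m + b + a
      r₂ = solve-∀
      rest : ∀ p x → x + - (⟦ p ⟧ * x) ≡ ⟦ not p ⟧ * x
      rest true  = solve-∀
      rest false = solve-∀

    demand-bound : + 7 * nB + n₁ ≤ ∑ c + + 3 * ∑ medium + (m + T)
    demand-bound = subst₂ _≤_ (trans (∑-+ _ _) (cong (λ t → t + n₁) (∑-* (+ 7) _)))
      (trans (∑-+ _ _) (cong₂ _+_ (trans (∑-+ c _) (cong (λ t → ∑ c + t) (∑-* (+ 3) medium))) (sym m+T)))
      (∑-mono pointwise)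
      where
      0≤3medium : ∀ u → 0ℤ ≤ + 3 * medium u
      0≤3medium u = 3 ⊛ 0≤⟦ not (big u) ∧ not (small u) ⟧
      served : ∀ u → big u ≡ false → demand u ≤ c u + + 3 * medium u
      served u p with small u
      ... | true  = ≤-reflexive (trans (sym (*-identityˡ (demand u))) (trans (sym (ℤₚ.+-identityʳ (1ℤ * demand u))) (cong (λ t → 1ℤ * demand u + t) (sym (nil (not (big u)))))))
        where
        nil : ∀ p → + 3 * ⟦ p ∧ false ⟧ ≡ 0ℤ
        nil true  = refl
        nil false = refl
      ... | false rewrite p = ℤₚ.i⊓j≤j (outRest u) (+ 3)
      rest : ∀ u → big u ≡ false → + 7 * ⟦ not (big u) ⟧ + ⟦ sendsToBig u ⟧
        ≤ c u + + 3 * medium u + (⟦ not (big u) ⟧ * out u + outBig u)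
      rest u p = subst (λ t → + 7 * ⟦ not t ⟧ + ⟦ not t ∧ does (1ℤ ℤₚ.≤? outBig u) ⟧ ≤ c u + + 3 * medium u + (⟦ not t ⟧ * out u + outBig u)) (sym p)
        (lin (degree-count {outRest u} {outBig u} (0≤outBig u) (≤-trans (outdegree≥4 u p) (≤-reflexive (sym (out-split u)))) ⊕ served u p)
          (trans (cong (λ t → c u + + 3 * medium u + (1ℤ * t + outBig u) + (+ 7 + ⟦ does (1ℤ ℤₚ.≤? outBig u) ⟧ + demand u)) (sym (out-split u)))
            (r (c u + + 3 * medium u) (demand u) (outRest u) (outBig u) ⟦ does (1ℤ ℤₚ.≤? outBig u) ⟧)))
        where
        r : ∀ c d x z f → c + (1ℤ * (z + x) + z) + (+ 7 + f + d) ≡ + 7 * 1ℤ + f + (d + (z + x) + z + c)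
        r = solve-∀
      pointwise : ∀ u → + 7 * ⟦ not (big u) ⟧ + ⟦ sendsToBig u ⟧
        ≤ c u + + 3 * medium u + (⟦ not (big u) ⟧ * out u + outBig u)
      pointwise u = by-size (big u) refl
        where
        by-size : ∀ t → big u ≡ t → + 7 * ⟦ not (big u) ⟧ + ⟦ sendsToBig u ⟧
          ≤ c u + + 3 * medium u + (⟦ not (big u) ⟧ * out u + outBig u)
        by-size false p = rest u p
        by-size true  p = ≤-trans (≤-reflexive (cong (λ t → + 7 * ⟦ not t ⟧ + ⟦ not t ∧ does (1ℤ ℤₚ.≤? outBig u) ⟧) p))
          ((*-nonneg 0≤⟦ small u ⟧ (0≤demand u) ⊕ 0≤3medium u) ⊕ (*-nonneg 0≤⟦ not (big u) ⟧ (0≤out u) ⊕ 0≤outBig u))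

    signedSum : (Fin n → Bool) → ℤ
    signedSum q = ∑ (λ v → sgn (q v) * y v)

    big-root : ∀ v → big v ≡ true → root v ≡ v
    big-root v p with root v ≟ v
    ... | yes e = e
    ... | no ne = ⊥-elim (true≢false p (small⇒¬big {v} (IsStarMap.leaf-small isStarMap ne)))

    root-big : ∀ v → big (root v) ≡ true → root v ≡ v
    root-big v p with root v ≟ v
    ... | yes e = e
    ... | no ne with h v (root v) in q | IsStarMap.leaf-nbr isStarMap ne
    ... | true  | _ = ⊥-elim (true≢false p (proj₂ (h-ends v (root v) q)))
    ... | false | r = ⊥-elim (true≢false p (proj₁ (h-ends (root v) v r)))

    -- Ordinary stars have mean 0 and W = 1, so `X̄` is at most minus the number of arcs along star
    -- edges. Then `star-bound`, `demand-bound` and the hypothesis add up to what `good` asks.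
    structure : ∀ q → + 7 * ∥ signedSum q ∥ ≤ + 7 * nB + n₁ - T → Good
    structure q hyp = good (lin
        ((7 ⊛ X̄-bound) ⊕ star-bound ⊕ demand-bound ⊕ hyp)
        (trans (cong (λ t → 1ℤ * 1ℤ * (m + + 3 * ∑ medium) + (+ 7 * X̄ + (∑ c + (+ 7 * nB + n₁ + + 7 * t)))) (sym abs))
          (r m (∑ medium) X̄ (∑ c) (+ 7 * nB + n₁) (∥ S̄ ∥) G T)))
      where
      d : Fin n → ℤ
      d v = ⟦ big v ⟧ * sgn (q v)
      lower : ∀ v → 0ℤ ≤ 1ℤ + d v
      lower v with big v | q v
      ... | true  | true  = 0≤+
      ... | true  | false = 0≤+
      ... | false | true  = 0≤+
      ... | false | false = 0≤+
      upper : ∀ v → 0ℤ ≤ 1ℤ - d v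
      upper v with big v | q v
      ... | true  | true  = 0≤+
      ... | true  | false = 0≤+
      ... | false | true  = 0≤+
      ... | false | false = 0≤+
      fixed : ∀ v → big v ≡ true → d v * d v ≡ 1ℤ * 1ℤ
      fixed v p rewrite p with q v
      ... | true  = refl
      ... | false = refl
      open FromSpins m≤M sparse root isStarMap 1ℤ (+<+ (ℕ.s≤s ℕ.z≤n)) d lower upper fixed
      G : ℤ
      G = ∑ (λ v → ⟦ h v (root v) ⟧ + ⟦ h (root v) v ⟧)
      r : ∀ m μ X̄ C D s G T → 1ℤ * 1ℤ * (m + + 3 * μ) + (+ 7 * X̄ + (C + (D + + 7 * s)))
        ≡ + 7 * (X̄ + 1ℤ * s) + (+ 7 * - G + (+ 7 * G + (C + + 3 * μ + (m + T) + (D - T))))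
      r = solve-∀
      open IsStarMap isStarMap
      -- Arcs between different stars have mean 0, as two big roots would force two adjacent big
      -- vertices. Inside a star only arcs between centre and leaf occur, and their signs are
      -- opposite.
      arc : ∀ u v → e u v * (ε u * ε v * kernel u v) ≤ - (⟦ root u == v ⟧ * ⟦ h u v ⟧ + ⟦ root v == u ⟧ * ⟦ h u v ⟧)
      arc u v = by-arc (g u v) refl
        where
        r₁ : ∀ k p q → 0ℤ * k ≡ - (p * 0ℤ + q * 0ℤ)
        r₁ = solve-∀
        ends : Bool
        ends = (not (big u) ∧ not (big v)) ∧ (small u ∨ small v)
        module Arc (guv : g u v ≡ true) where
          u≢v : u ≢ v
          u≢v refl = true≢false guv (irreflexive u)
          nil : ∀ {w z} → root w ≢ z → ⟦ root w == z ⟧ * ⟦ ends ⟧ ≡ 0ℤ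
          nil ne = cong (λ t → ⟦ t ⟧ * ⟦ ends ⟧) (==-neq ne)
          one : ∀ {w z} → root w ≡ z → ⟦ root w == z ⟧ * ⟦ ends ⟧ ≡ ⟦ ends ⟧
          one {w} {z} e = trans (cong (λ t → ⟦ t ⟧ * ⟦ ends ⟧) (does-true (root w ≟ z) e)) (*-identityˡ ⟦ ends ⟧)
          ε-centre : ∀ {w} → root w ≡ w → ε w ≡ 1ℤ
          ε-centre {w} e = cong sgn (does-true (root w ≟ w) e)
          ε-leaf : ∀ {w} → root w ≢ w → ε w ≡ - 1ℤ
          ε-leaf ne = cong sgn (==-neq ne)
          Bound : Set
          Bound = 1ℤ * (ε u * ε v * kernel u v) ≤ - (⟦ root u == v ⟧ * ⟦ ends ⟧ + ⟦ root v == u ⟧ * ⟦ ends ⟧)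
          kernel-same : root u ≡ root v → kernel u v ≡ 1ℤ
          kernel-same e = cong (λ t → if t then 1ℤ * 1ℤ else d (root u) * d (root v)) (does-true (root u ≟ root v) e)
          kernel-distinct : root u ≢ root v → kernel u v ≡ 0ℤ
          kernel-distinct ne = trans (cong (λ t → if t then 1ℤ * 1ℤ else d (root u) * d (root v)) (==-neq ne)) product
            where
            product : d (root u) * d (root v) ≡ 0ℤ
            product with big (root u) in p | big (root v) in p′
            ... | false | _ = refl
            ... | true | false = *-zeroʳ (1ℤ * sgn (q (root u)))
            ... | true | true = ⊥-elim (true≢false guv (big-independent u v
              (subst (λ t → big t ≡ true) (root-big u p) p) (subst (λ t → big t ≡ true) (root-big v p′) p′)))
          distinct : root u ≢ root v → Bound
          distinct ne = ≤-reflexive (trans (cong (λ t → 1ℤ * (ε u * ε v * t)) (kernel-distinct ne))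
            (trans (r₂ (ε u * ε v)) (sym (cong₂ (λ s t → - (s + t)) (nil {u} u↛v) (nil {v} v↛u)))))
            where
            r₂ : ∀ a → 1ℤ * (a * 0ℤ) ≡ - (0ℤ + 0ℤ)
            r₂ = solve-∀
            u↛v : root u ≢ v
            u↛v e = ne (trans (sym (root-root (λ e′ → u≢v (trans (sym e′) e)))) (cong root e))
            v↛u : root v ≢ u
            v↛u e = ne (sym (trans (sym (root-root (λ e′ → u≢v (trans (sym e) e′)))) (cong root e)))
          opposite : ∀ {s t x y} → ε u * ε v ≡ - 1ℤ → kernel u v ≡ 1ℤ → s ≡ x → t ≡ y → x + y ≡ ⟦ ends ⟧ →
            1ℤ * (ε u * ε v * kernel u v) ≤ - (s + t)
          opposite p q refl refl sum = subst₂ _≤_ (sym (cong₂ (λ s t → 1ℤ * (s * t)) p q)) (cong -_ (sym sum)) (ℤₚ.neg-mono-≤ ⟦ ends ⟧≤1)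
          same : root u ≡ root v → Dec (root u ≡ u) → Dec (root v ≡ v) → Bound
          same e (yes p) (yes q) = contradiction (trans (sym p) (trans e q)) u≢v
          same e (yes p) (no q) = opposite (cong₂ _*_ (ε-centre p) (ε-leaf q)) (kernel-same e)
            (nil {u} (λ e′ → q (trans (sym e) e′))) (one {v} (trans (sym e) p)) (ℤₚ.+-identityˡ _)
          same e (no p) (yes q) = opposite (cong₂ _*_ (ε-leaf p) (ε-centre q)) (kernel-same e)
            (one {u} (trans e q)) (nil {v} (λ e′ → p (trans e e′))) (ℤₚ.+-identityʳ _)
          same e (no p) (no q) = ⊥-elim (true≢false h-arc (independent p q e))
            where
            h-arc : h u v ∨ h v u ≡ true
            h-arc = cong (_∨ h v u) (h-intro guv (small⇒¬big {u} (leaf-small p)) (small⇒¬big {v} (leaf-small q)) (leaf-small p))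
          by-root : Dec (root u ≡ root v) → Bound
          by-root (yes e) = same e (root u ≟ u) (root v ≟ v)
          by-root (no ne) = distinct ne
        by-arc : ∀ x → g u v ≡ x → ⟦ x ⟧ * (ε u * ε v * kernel u v)
          ≤ - (⟦ root u == v ⟧ * ⟦ x ∧ ends ⟧ + ⟦ root v == u ⟧ * ⟦ x ∧ ends ⟧)
        by-arc false _   = ≤-reflexive (r₁ (ε u * ε v * kernel u v) ⟦ root u == v ⟧ ⟦ root v == u ⟧)
        by-arc true  guv = Arc.by-root guv (root u ≟ root v)
      S̄-value : S̄ ≡ - signedSum q
      S̄-value = trans (∑-cong pointwise) (∑-neg _)
        where
        pointwise : ∀ v → b v * ε v * d (root v) ≡ - (sgn (q v) * y v)
        pointwise v with big v in p
        ... | true rewrite big-root v p | p | ==-refl v = r₁ (out v) (inn v) (sgn (q v))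
          where
          r₁ : ∀ o i s → (o - i) * 1ℤ * (1ℤ * s) ≡ - (s * (1ℤ * (i - o)))
          r₁ = solve-∀
        ... | false with big (root v) in p′
        ... | true  = ⊥-elim (true≢false (subst (λ t → big t ≡ true) (root-big v p′) p′) p)
        ... | false = r₁ (b v * ε v) (sgn (q (root v))) (sgn (q v)) (inn v - out v)
          where
          r₁ : ∀ b s t i → b * (0ℤ * s) ≡ - (t * (0ℤ * i))
          r₁ = solve-∀
      X̄-bound : X̄ ≤ - G
      X̄-bound = subst (X̄ ≤_) total (∑-mono (λ u → ∑-mono (arc u)))
        where
        total : ∑ (λ u → ∑ (λ v → - (⟦ root u == v ⟧ * ⟦ h u v ⟧ + ⟦ root v == u ⟧ * ⟦ h u v ⟧))) ≡ - G
        total = begin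
          ∑ (λ u → ∑ (λ v → - (⟦ root u == v ⟧ * ⟦ h u v ⟧ + ⟦ root v == u ⟧ * ⟦ h u v ⟧)))
            ≡⟨ trans (∑-cong (λ u → ∑-neg _)) (∑-neg _) ⟩
          - ∑ (λ u → ∑ (λ v → ⟦ root u == v ⟧ * ⟦ h u v ⟧ + ⟦ root v == u ⟧ * ⟦ h u v ⟧))
            ≡⟨ cong -_ (trans (∑-cong (λ u → ∑-+ _ _)) (∑-+ _ _)) ⟩
          - (∑ (λ u → ∑ (λ v → ⟦ root u == v ⟧ * ⟦ h u v ⟧)) + ∑ (λ u → ∑ (λ v → ⟦ root v == u ⟧ * ⟦ h u v ⟧)))
            ≡⟨ cong₂ (λ s t → - (s + t)) (∑-cong (λ u → ∑-δ (root u) (λ v → ⟦ h u v ⟧)))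
                 (trans (∑-swap (λ u v → ⟦ root v == u ⟧ * ⟦ h u v ⟧)) (∑-cong (λ v → ∑-δ (root v) (λ u → ⟦ h u v ⟧)))) ⟩
          - (∑ (λ u → ⟦ h u (root u) ⟧) + ∑ (λ v → ⟦ h (root v) v ⟧))
            ≡⟨ cong -_ (sym (∑-+ _ _)) ⟩
          - G ∎
          where open ≡-Reasoning
      abs : ∥ S̄ ∥ ≡ ∥ signedSum q ∥
      abs = trans (cong ∥_∥ S̄-value) (cong +_ (ℤₚ.∣-i∣≡∣i∣ (signedSum q)))

    -- The number of arcs with a big end, since no arc joins two big vertices.
    D : ℤ
    D = ∑ (λ v → ⟦ big v ⟧ * deg v)

    yPart degPart : (Fin n → Bool) → ℤ
    yPart q = ∑ (λ v → ⟦ q v ⟧ * y v)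
    degPart q = ∑ (λ v → ⟦ q v ⟧ * (⟦ big v ⟧ * deg v))

    sgn≡ : ∀ p → sgn p ≡ + 2 * ⟦ p ⟧ - 1ℤ
    sgn≡ true  = refl
    sgn≡ false = refl

    signed≡ : (q : Fin n → Bool) (x : Fin n → ℤ) → ∑ (λ v → sgn (q v) * x v) ≡ + 2 * ∑ (λ v → ⟦ q v ⟧ * x v) - ∑ x
    signed≡ q x = trans (∑-cong (λ v → trans (cong (_* x v) (sgn≡ (q v))) (r ⟦ q v ⟧ (x v))))
      (trans (∑-+ _ _) (cong₂ _+_ (∑-* (+ 2) _) (∑-neg x)))
      where
      r : ∀ p x → (+ 2 * p - 1ℤ) * x ≡ + 2 * (p * x) + - x
      r = solve-∀

    -- Biased signs: balancing the two crossing numbers exactly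

    trivialStars : IsStarMap h small (λ v → v)
    trivialStars = record
      { root-root   = λ ne → contradiction refl ne
      ; leaf-small  = λ ne → contradiction refl ne
      ; leaf-nbr    = λ ne → contradiction refl ne
      ; independent = λ ne → contradiction refl ne
      }

    -- Here `W` is `T`: big vertices in `q` get +1, other big vertices -1, and every ordinary vertex
    -- is independent with mean -Δ/T.
    module Bias (q : Fin n → Bool) (Δ : ℤ) (Δ≡ : Δ ≡ T - + 2 * yPart q) (0<T : 0ℤ < T) (0≤Δ : 0ℤ ≤ Δ) (Δ≤T : Δ ≤ T)
      (biased : Biased T D m (yPart q) (degPart q)) where

      α κ d : Fin n → ℤ
      α v = ⟦ big v ⟧ * sgn (q v)
      κ v = ⟦ not (big v) ⟧
      d v = T * α v - Δ * κ v

      0≤T : 0ℤ ≤ T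
      0≤T = ℤₚ.<⇒≤ 0<T

      range : ∀ p s T Δ → 0ℤ ≤ T → 0ℤ ≤ Δ → Δ ≤ T →
        0ℤ ≤ T + (T * (⟦ p ⟧ * sgn s) - Δ * ⟦ not p ⟧) × 0ℤ ≤ T - (T * (⟦ p ⟧ * sgn s) - Δ * ⟦ not p ⟧)
      range true true T Δ p _ _ = lin (2 ⊛ p) (r₁ T Δ) , ≤-reflexive (r₂ T Δ)
        where
        r₁ : ∀ T Δ → T + (T * (1ℤ * 1ℤ) - Δ * 0ℤ) + + 2 * 0ℤ ≡ 0ℤ + + 2 * T
        r₁ = solve-∀
        r₂ : ∀ T Δ → 0ℤ ≡ T - (T * (1ℤ * 1ℤ) - Δ * 0ℤ)
        r₂ = solve-∀
      range true false T Δ p _ _ = ≤-reflexive (r₂ T Δ) , lin (2 ⊛ p) (r₁ T Δ)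
        where
        r₁ : ∀ T Δ → T - (T * (1ℤ * - 1ℤ) - Δ * 0ℤ) + + 2 * 0ℤ ≡ 0ℤ + + 2 * T
        r₁ = solve-∀
        r₂ : ∀ T Δ → 0ℤ ≡ T + (T * (1ℤ * - 1ℤ) - Δ * 0ℤ)
        r₂ = solve-∀
      range false s T Δ p x z = lin z (r₁ T Δ (sgn s)) , lin (p ⊕ x) (r₂ T Δ (sgn s))
        where
        r₁ : ∀ T Δ s → T + (T * (0ℤ * s) - Δ * 1ℤ) + Δ ≡ 0ℤ + T
        r₁ = solve-∀
        r₂ : ∀ T Δ s → T - (T * (0ℤ * s) - Δ * 1ℤ) + (0ℤ + 0ℤ) ≡ 0ℤ + (T + Δ)
        r₂ = solve-∀

      fixed : ∀ v → big v ≡ true → d v * d v ≡ T * T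
      fixed v p rewrite p = trans (r T (sgn (q v)) Δ) (trans (cong (T * T *_) (sgn² (q v))) (ℤₚ.*-identityʳ (T * T)))
        where
        r : ∀ T s Δ → (T * (1ℤ * s) - Δ * 0ℤ) * (T * (1ℤ * s) - Δ * 0ℤ) ≡ T * T * (s * s)
        r = solve-∀

      open FromSpins m≤M sparse (λ v → v) trivialStars T 0<T d
        (λ v → proj₁ (range (big v) (q v) T Δ 0≤T 0≤Δ Δ≤T)) (λ v → proj₂ (range (big v) (q v) T Δ 0≤T 0≤Δ Δ≤T)) fixed

      ε≡1 : ∀ v → ε v ≡ 1ℤ
      ε≡1 v = cong sgn (==-refl v)

      arc : ∀ u v → e u v * (ε u * ε v * kernel u v) ≡
        - (T * Δ) * (α u * e u v + e u v * α v) + Δ * Δ * (e u v + - (⟦ big u ⟧ * e u v) + - (e u v * ⟦ big v ⟧))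
      arc u v = trans (cong₂ (λ s t → e u v * (s * t * kernel u v)) (ε≡1 u) (ε≡1 v)) by-arc
        where
        r₀ : ∀ T Δ k a b p q → 0ℤ * k ≡ - (T * Δ) * (a * 0ℤ + 0ℤ * b) + Δ * Δ * (0ℤ + - (p * 0ℤ) + - (0ℤ * q))
        r₀ = solve-∀
        by-ends : ∀ p q s t T Δ → (p ≡ true → q ≡ true → ⊥) →
          1ℤ * (1ℤ * 1ℤ * ((T * (⟦ p ⟧ * s) - Δ * ⟦ not p ⟧) * (T * (⟦ q ⟧ * t) - Δ * ⟦ not q ⟧))) ≡
          - (T * Δ) * (⟦ p ⟧ * s * 1ℤ + 1ℤ * (⟦ q ⟧ * t)) + Δ * Δ * (1ℤ + - (⟦ p ⟧ * 1ℤ) + - (1ℤ * ⟦ q ⟧))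
        by-ends true  true  s t T Δ ¬both = contradiction refl (¬both refl)
        by-ends true  false s t T Δ _ = r s t T Δ
          where
          r : ∀ s t T Δ → 1ℤ * (1ℤ * 1ℤ * ((T * (1ℤ * s) - Δ * 0ℤ) * (T * (0ℤ * t) - Δ * 1ℤ))) ≡
            - (T * Δ) * (1ℤ * s * 1ℤ + 1ℤ * (0ℤ * t)) + Δ * Δ * (1ℤ + - (1ℤ * 1ℤ) + - (1ℤ * 0ℤ))
          r = solve-∀
        by-ends false true  s t T Δ _ = r s t T Δ
          where
          r : ∀ s t T Δ → 1ℤ * (1ℤ * 1ℤ * ((T * (0ℤ * s) - Δ * 1ℤ) * (T * (1ℤ * t) - Δ * 0ℤ))) ≡
            - (T * Δ) * (0ℤ * s * 1ℤ + 1ℤ * (1ℤ * t)) + Δ * Δ * (1ℤ + - (0ℤ * 1ℤ) + - (1ℤ * 1ℤ))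
          r = solve-∀
        by-ends false false s t T Δ _ = r s t T Δ
          where
          r : ∀ s t T Δ → 1ℤ * (1ℤ * 1ℤ * ((T * (0ℤ * s) - Δ * 1ℤ) * (T * (0ℤ * t) - Δ * 1ℤ))) ≡
            - (T * Δ) * (0ℤ * s * 1ℤ + 1ℤ * (0ℤ * t)) + Δ * Δ * (1ℤ + - (0ℤ * 1ℤ) + - (1ℤ * 0ℤ))
          r = solve-∀
        kernel≡ : u ≢ v → kernel u v ≡ d u * d v
        kernel≡ ne = cong (λ t → if t then T * T else d u * d v) (==-neq ne)
        by-arc : e u v * (1ℤ * 1ℤ * kernel u v) ≡
          - (T * Δ) * (α u * e u v + e u v * α v) + Δ * Δ * (e u v + - (⟦ big u ⟧ * e u v) + - (e u v * ⟦ big v ⟧))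
        by-arc with g u v in guv
        ... | false = r₀ T Δ (1ℤ * 1ℤ * kernel u v) (α u) (α v) ⟦ big u ⟧ ⟦ big v ⟧
        ... | true  = trans (cong (λ t → 1ℤ * (1ℤ * 1ℤ * t)) (kernel≡ (λ { refl → true≢false guv (irreflexive u) })))
          (by-ends (big u) (big v) (sgn (q u)) (sgn (q v)) T Δ (λ p p′ → true≢false guv (big-independent u v p p′)))

      ∑α : ∑ (λ v → α v * out v) + ∑ (λ v → α v * inn v) ≡ + 2 * degPart q - D
      ∑α = trans (sym (∑-+ _ _)) (trans (∑-cong (λ v → r ⟦ big v ⟧ (sgn (q v)) (out v) (inn v))) (signed≡ q (λ v → ⟦ big v ⟧ * deg v)))
        where
        r : ∀ p s o i → p * s * o + p * s * i ≡ s * (p * (o + i))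
        r = solve-∀

      E≡ : m + - ∑ (λ v → ⟦ big v ⟧ * out v) + - ∑ (λ v → ⟦ big v ⟧ * inn v) ≡ m - D
      E≡ = trans (r m _ _) (cong (λ t → m - t) (trans (sym (∑-+ _ _)) (∑-cong (λ v → sym (ℤₚ.*-distribˡ-+ ⟦ big v ⟧ (out v) (inn v))))))
        where
        r : ∀ m a b → m + - a + - b ≡ m - (a + b)
        r = solve-∀

      -- Scaled by T², an arc between a big vertex of sign s and an ordinary one has mean -sTΔ, and
      -- each of the m - D arcs between ordinary vertices has mean Δ².
      X̄≡ : X̄ ≡ - (T * Δ) * (+ 2 * degPart q - D) + Δ * Δ * (m - D)
      X̄≡ = begin
        X̄ ≡⟨ ∑-cong (λ u → trans (∑-cong (arc u)) (row u)) ⟩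
        ∑ (λ u → - (T * Δ) * (α u * out u + ∑ (λ v → e u v * α v))
               + Δ * Δ * (out u + - (⟦ big u ⟧ * out u) + - ∑ (λ v → e u v * ⟦ big v ⟧)))
          ≡⟨ trans (∑-+ _ _) (cong₂ _+_
               (trans (∑-* (- (T * Δ)) _) (cong (- (T * Δ) *_) (trans (∑-+ _ _) (cong (λ t → ∑ (λ u → α u * out u) + t) (column α)))))
               (trans (∑-* (Δ * Δ) _) (cong (Δ * Δ *_) (trans (∑-+ _ _) (cong₂ _+_ (trans (∑-+ _ _) (cong (λ t → m + t) (∑-neg _)))
                 (trans (∑-neg _) (cong -_ (column (⟦_⟧ ∘ big))))))))) ⟩
        - (T * Δ) * (∑ (λ v → α v * out v) + ∑ (λ v → α v * inn v))
          + Δ * Δ * (m + - ∑ (λ v → ⟦ big v ⟧ * out v) + - ∑ (λ v → ⟦ big v ⟧ * inn v))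
          ≡⟨ cong₂ (λ s t → - (T * Δ) * s + Δ * Δ * t) ∑α E≡ ⟩
        - (T * Δ) * (+ 2 * degPart q - D) + Δ * Δ * (m - D) ∎
        where
        open ≡-Reasoning
        column : (x : Fin n → ℤ) → ∑ (λ u → ∑ (λ v → e u v * x v)) ≡ ∑ (λ v → x v * inn v)
        column x = trans (∑-swap (λ u v → e u v * x v)) (∑-cong (λ v → trans (∑-*ʳ (x v) (λ u → e u v)) (*-comm (inn v) (x v))))
        row : ∀ u → ∑ (λ v → - (T * Δ) * (α u * e u v + e u v * α v) + Δ * Δ * (e u v + - (⟦ big u ⟧ * e u v) + - (e u v * ⟦ big v ⟧)))
          ≡ - (T * Δ) * (α u * out u + ∑ (λ v → e u v * α v)) + Δ * Δ * (out u + - (⟦ big u ⟧ * out u) + - ∑ (λ v → e u v * ⟦ big v ⟧))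
        row u = trans (∑-+ _ _) (cong₂ _+_
          (trans (∑-* (- (T * Δ)) _) (cong (- (T * Δ) *_) (trans (∑-+ _ _) (cong (λ t → t + ∑ (λ v → e u v * α v)) (∑-* (α u) (e u))))))
          (trans (∑-* (Δ * Δ) _) (cong (Δ * Δ *_) (trans (∑-+ _ _) (cong₂ _+_ (trans (∑-+ _ _) (cong (λ t → out u + t)
            (trans (∑-neg _) (cong -_ (∑-* ⟦ big u ⟧ (e u)))))) (∑-neg _))))))

      -- The `b v` sum to 0 overall, hence to T over the ordinary vertices. Their bias contributes
      -- -Δ, which cancels the T - 2ν of the big vertices, ν being `yPart q`.
      S̄≡0 : S̄ ≡ 0ℤ
      S̄≡0 = begin
        S̄ ≡⟨ ∑-cong (λ v → trans (cong (λ t → b v * t * d v) (ε≡1 v)) (term (big v) (sgn (q v)) (inn v) (out v) T Δ)) ⟩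
        ∑ (λ v → - T * (sgn (q v) * y v) + - Δ * (out v + - inn v + y v))
          ≡⟨ trans (∑-+ _ _) (cong₂ _+_ (trans (∑-* (- T) _) (cong (- T *_) (signed≡ q y)))
               (trans (∑-* (- Δ) _) (cong (- Δ *_) (trans (∑-+ _ _) (cong (λ t → t + T) (trans (∑-+ _ _) (cong (λ t → m + t) (trans (∑-neg inn) (cong -_ ∑-inn))))))))) ⟩
        - T * (+ 2 * yPart q - T) + - Δ * (m + - m + T)
          ≡⟨ cong (λ t → - T * (+ 2 * yPart q - T) + - t * (m + - m + T)) Δ≡ ⟩
        - T * (+ 2 * yPart q - T) + - (T - + 2 * yPart q) * (m + - m + T)
          ≡⟨ r T (yPart q) m ⟩
        0ℤ ∎
        where
        open ≡-Reasoning
        r : ∀ T ν m → - T * (+ 2 * ν - T) + - (T - + 2 * ν) * (m + - m + T) ≡ 0ℤ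
        r = solve-∀
        term : ∀ p s i o T Δ → (o - i) * 1ℤ * (T * (⟦ p ⟧ * s) - Δ * ⟦ not p ⟧)
          ≡ - T * (s * (⟦ p ⟧ * (i - o))) + - Δ * (o + - i + ⟦ p ⟧ * (i - o))
        term true = r₁
          where
          r₁ : ∀ s i o T Δ → (o - i) * 1ℤ * (T * (1ℤ * s) - Δ * 0ℤ) ≡ - T * (s * (1ℤ * (i - o))) + - Δ * (o + - i + 1ℤ * (i - o))
          r₁ = solve-∀
        term false = r₁
          where
          r₁ : ∀ s i o T Δ → (o - i) * 1ℤ * (T * (0ℤ * s) - Δ * 1ℤ) ≡ - T * (s * (0ℤ * (i - o))) + - Δ * (o + - i + 0ℤ * (i - o))
          r₁ = solve-∀

      bias-good : Good
      bias-good = good (Biased-bound biased Δ≡ X̄≡ S̄≡0 (∑-nonneg (λ v → 0≤⟦ not (big v) ∧ not (small v) ⟧)))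

    y≤inn : ∀ v → y v ≤ ⟦ big v ⟧ * inn v
    y≤inn v = *-monoˡ 0≤⟦ big v ⟧ (lin (0≤out v) (r (inn v) (out v)))
      where
      r : ∀ i o → i + 0ℤ ≡ i - o + o
      r = solve-∀

    y≤n₁ : ∀ v → y v ≤ n₁
    y≤n₁ v = ≤-trans (y≤inn v) (subst (_≤ n₁) (∑-* ⟦ big v ⟧ (λ u → e u v)) (∑-mono arc))
      where
      arc : ∀ u → ⟦ big v ⟧ * e u v ≤ ⟦ sendsToBig u ⟧
      arc u with big v in bv | g u v in guv
      ... | false | _     = 0≤⟦ sendsToBig u ⟧
      ... | true  | false = 0≤⟦ sendsToBig u ⟧
      ... | true  | true with big u in bu
      ... | true  = ⊥-elim (true≢false guv (big-independent u v bu bv))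
      ... | false = ≤-reflexive (cong ⟦_⟧ (sym (does-true (1ℤ ℤₚ.≤? outBig u)
          (≤-trans (≤-reflexive (sym (cong₂ (λ s t → ⟦ s ⟧ * ⟦ t ⟧) bv guv)))
                   (∑-term≤ (λ w → *-nonneg 0≤⟦ big w ⟧ (0≤e u w)) v)))))

    n₁≤nB : n₁ ≤ nB
    n₁≤nB = ∑-mono (λ u → le (not (big u)) (does (1ℤ ℤₚ.≤? outBig u)))
      where
      le : ∀ p q → ⟦ p ∧ q ⟧ ≤ ⟦ p ⟧
      le true  q = ⟦ q ⟧≤1
      le false q = ≤-refl

    -y≤nB : ∀ v → - y v ≤ nB
    -y≤nB v = ≤-trans (lin (*-nonneg 0≤⟦ big v ⟧ (0≤inn v)) (r ⟦ big v ⟧ (inn v) (out v)))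
      (subst (_≤ nB) (∑-* ⟦ big v ⟧ (e v)) (∑-mono arc))
      where
      r : ∀ p i o → p * o + 0ℤ ≡ - (p * (i - o)) + p * i
      r = solve-∀
      arc : ∀ w → ⟦ big v ⟧ * e v w ≤ ⟦ not (big w) ⟧
      arc w with big v in bv | g v w in gvw | big w in bw
      ... | false | _     | b     = 0≤⟦ not b ⟧
      ... | true  | false | b     = 0≤⟦ not b ⟧
      ... | true  | true  | false = ≤-refl
      ... | true  | true  | true  = ⊥-elim (true≢false gvw (big-independent v w bv bw))

    -- No `y v` exceeds `nB` in absolute value, so greedy signs stay within `nB`, and n₁ - T ≥ 0
    -- does the rest.
    few-senders : T ≤ n₁ → Good
    few-senders T≤n₁ = sign (greedy-signs y (∑-nonneg (λ v → 0≤⟦ not (big v) ⟧)) (λ v → ≤-trans (y≤n₁ v) n₁≤nB) -y≤nB)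
      where
      r : ∀ s B k T → + 7 * B + k - T + (+ 7 * s + T) ≡ + 7 * s + (+ 7 * B + k)
      r = solve-∀
      sign : (∃ λ q → signedSum q ≤ nB × - signedSum q ≤ nB) → Good
      sign (q , hi , lw) = structure q (lin ((7 ⊛ ∥a∥≤ hi lw) ⊕ T≤n₁) (r (∥ signedSum q ∥) nB n₁ T))

    module ManySenders (n₁≤T : n₁ ≤ T) (0<T : 0ℤ < T) (p : Fin n → Bool) (j : Fin n) (pj : p j ≡ false)
      (lo : + 2 * yPart p ≤ T) (hi : T + 1ℤ ≤ + 2 * (yPart p + y j)) where

      single joined remainder : Fin n → Bool
      single v = j == v
      joined v = p v ∨ (j == v)
      remainder v = not (joined v)

      part-single : ∀ (x : Fin n → ℤ) → ∑ (λ v → ⟦ single v ⟧ * x v) ≡ x j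
      part-single = ∑-δ j

      part-joined : ∀ (x : Fin n → ℤ) → ∑ (λ v → ⟦ joined v ⟧ * x v) ≡ ∑ (λ v → ⟦ p v ⟧ * x v) + x j
      part-joined x = trans (∑-cong pointwise) (trans (∑-+ _ _) (cong (λ t → ∑ (λ v → ⟦ p v ⟧ * x v) + t) (part-single x)))
        where
        pointwise : ∀ v → ⟦ joined v ⟧ * x v ≡ ⟦ p v ⟧ * x v + ⟦ single v ⟧ * x v
        pointwise v with j ≟ v | p v in pv
        ... | yes refl | true  = ⊥-elim (true≢false pv pj)
        ... | yes refl | false = sym (ℤₚ.+-identityˡ _)
        ... | no _     | true  = sym (ℤₚ.+-identityʳ _)
        ... | no _     | false = refl

      part-remainder : ∀ (x : Fin n → ℤ) → ∑ (λ v → ⟦ remainder v ⟧ * x v) ≡ ∑ x - (∑ (λ v → ⟦ p v ⟧ * x v) + x j)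
      part-remainder x = trans (trans (∑-cong (λ v → flip (joined v) (x v))) (trans (∑-+ x _) (cong (λ t → ∑ x + t) (∑-neg _))))
        (cong (λ t → ∑ x - t) (part-joined x))
        where
        flip : ∀ p x → ⟦ not p ⟧ * x ≡ x + - (⟦ p ⟧ * x)
        flip true  = solve-∀
        flip false = solve-∀

      -- 7(2ν - T) ≤ 14n₁ - 7T, where ν is `yPart q`; this suffices because 13n₁ ≤ 6T + 7nB, as n₁
      -- is at most T and at most nB.
      unbalanced : ∀ q → 0ℤ ≤ + 2 * yPart q - T → yPart q ≤ y j → Good
      unbalanced q nonneg le = structure q (lin ((7 ⊛ ∥a∥≤ upper lower) ⊕ (14 ⊛ le) ⊕ (14 ⊛ y≤n₁ j) ⊕ (6 ⊛ n₁≤T) ⊕ (7 ⊛ n₁≤nB))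
        (r (∥ signedSum q ∥) (yPart q) (y j) n₁ nB T))
        where
        upper : signedSum q ≤ + 2 * yPart q - T
        upper = ≤-reflexive (signed≡ q y)
        lower : - signedSum q ≤ + 2 * yPart q - T
        lower = ≤-trans (≤-reflexive (cong -_ (signed≡ q y))) (≤-trans (ℤₚ.neg-mono-≤ nonneg) nonneg)
        r : ∀ s ν z k B T → + 7 * B + k - T + (+ 7 * s + (+ 14 * ν + (+ 14 * z + (+ 6 * k + + 7 * k))))
          ≡ + 7 * s + (+ 7 * (+ 2 * ν - T) + (+ 14 * z + (+ 14 * k + (+ 6 * T + + 7 * B))))
        r = solve-∀

      by-bias : ∀ q → 0ℤ ≤ yPart q → + 2 * yPart q ≤ T → Biased T D m (yPart q) (degPart q) → Good
      by-bias q 0≤ν 2ν≤T = Bias.bias-good q (T - + 2 * yPart q) refl 0<T (i≤j⇒0≤j-i 2ν≤T)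
        (lin (2 ⊛ 0≤ν) (r T (yPart q)))
        where
        r : ∀ T ν → T + + 2 * 0ℤ ≡ T - + 2 * ν + + 2 * ν
        r = solve-∀

      balanced : 0ℤ ≤ yPart p → + 2 * y j ≤ T → Good
      balanced 0≤s 2z≤T = choose (three-groups ν-sum deg-sum (∑-nonneg 0≤out) lo 2ν₂≤T 2ν₃≤T)
        where
        0≤z : 0ℤ ≤ y j
        0≤z = *-cancelˡ {+ 2} (+<+ (ℕ.s≤s ℕ.z≤n)) (lin (lo ⊕ hi ⊕ 0≤+ {1}) (r (yPart p) (y j) T))
          where
          r : ∀ s z T → + 2 * z + (+ 2 * s + (T + 1ℤ + 0ℤ)) ≡ + 2 * 0ℤ + (T + (+ 2 * (s + z) + 1ℤ))
          r = solve-∀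
        ν₂ : yPart single ≡ y j
        ν₂ = part-single y
        ν₃ : yPart remainder ≡ T - (yPart p + y j)
        ν₃ = part-remainder y
        0≤ν₃ : 0ℤ ≤ yPart remainder
        0≤ν₃ = subst (0ℤ ≤_) (sym ν₃) (*-cancelˡ {+ 2} (+<+ (ℕ.s≤s ℕ.z≤n)) (lin (lo ⊕ 2z≤T) (r (yPart p) (y j) T)))
          where
          r : ∀ s z T → + 2 * (T - (s + z)) + (+ 2 * s + + 2 * z) ≡ + 2 * 0ℤ + (T + T)
          r = solve-∀
        2ν₃≤T : + 2 * yPart remainder ≤ T
        2ν₃≤T = subst (λ t → + 2 * t ≤ T) (sym ν₃) (lin (hi ⊕ 0≤+ {1}) (r (yPart p) (y j) T))
          where
          r : ∀ s z T → T + (T + 1ℤ + 0ℤ) ≡ + 2 * (T - (s + z)) + (+ 2 * (s + z) + 1ℤ)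
          r = solve-∀
        2ν₂≤T : + 2 * yPart single ≤ T
        2ν₂≤T = subst (λ t → + 2 * t ≤ T) (sym ν₂) 2z≤T
        sum-parts : ∀ a {b c z t} → b ≡ z → c ≡ t - (a + z) → a + b + c ≡ t
        sum-parts a {z = z} {t} refl refl = r a z t
          where
          r : ∀ x z t → x + z + (t - (x + z)) ≡ t
          r = solve-∀
        ν-sum : yPart p + yPart single + yPart remainder ≡ T
        ν-sum = sum-parts (yPart p) ν₂ ν₃
        deg-sum : degPart p + degPart single + degPart remainder ≡ D
        deg-sum = sum-parts (degPart p) (part-single (λ v → ⟦ big v ⟧ * deg v)) (part-remainder (λ v → ⟦ big v ⟧ * deg v))
        choose : Biased T D m (yPart p) (degPart p) ⊎ Biased T D m (yPart single) (degPart single)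
          ⊎ Biased T D m (yPart remainder) (degPart remainder) → Good
        choose (inj₁ b)        = by-bias p 0≤s lo b
        choose (inj₂ (inj₁ b)) = by-bias single (subst (0ℤ ≤_) (sym ν₂) 0≤z) 2ν₂≤T b
        choose (inj₂ (inj₂ b)) = by-bias remainder 0≤ν₃ 2ν₃≤T b

      conclusion : Good
      conclusion with 0ℤ ℤₚ.≤? yPart p | + 2 * y j ℤₚ.≤? T
      ... | yes 0≤s | yes 2z≤T = balanced 0≤s 2z≤T
      ... | yes _   | no ¬2z≤T = unbalanced single
        (subst (λ t → 0ℤ ≤ + 2 * t - T) (sym (part-single y)) (i≤j⇒0≤j-i (≰⇒≥ ¬2z≤T))) (≤-reflexive (part-single y))
      -- A negative prefix keeps the joined sum below `y j`, while by `hi` it still exceeds T/2.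
      ... | no ¬0≤s | _ = unbalanced joined
        (subst (λ t → 0ℤ ≤ + 2 * t - T) (sym (part-joined y)) (lin (hi ⊕ 0≤+ {1}) (r (yPart p) (y j) T)))
        (subst (_≤ y j) (sym (part-joined y)) (lin (≰⇒≥ ¬0≤s) (r₂ (yPart p) (y j))))
        where
        r : ∀ s z T → + 2 * (s + z) - T + (T + 1ℤ + 0ℤ) ≡ 0ℤ + (+ 2 * (s + z) + 1ℤ)
        r = solve-∀
        r₂ : ∀ s z → z + s ≡ s + z + 0ℤ
        r₂ = solve-∀

    good-cut : Good
    good-cut = by-senders (T ℤₚ.≤? n₁)
      where
      r : ∀ T → + 2 * (0ℤ + T) + (0ℤ + 1ℤ) ≡ T + 1ℤ + T
      r = solve-∀
      cross : n₁ ≤ T → 0ℤ < T → (∃ λ (p : Fin n → Bool) → ∃ λ j → p j ≡ false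
        × + 2 * (0ℤ + yPart p) ≤ T × T + 1ℤ ≤ + 2 * (0ℤ + yPart p + y j)) → Good
      cross n₁≤T 0<T (p , j , pj , lo , hi) = ManySenders.conclusion n₁≤T 0<T p j pj
        (subst (λ t → + 2 * t ≤ T) (ℤₚ.+-identityˡ (yPart p)) lo)
        (subst (λ t → T + 1ℤ ≤ + 2 * (t + y j)) (ℤₚ.+-identityˡ (yPart p)) hi)
      by-senders : Dec (T ≤ n₁) → Good
      by-senders (yes T≤n₁) = few-senders T≤n₁
      by-senders (no ¬T≤n₁) = cross (≰⇒≥ ¬T≤n₁) 0<T
        (crossing-index y 0ℤ T (ℤₚ.<⇒≤ 0<T) (lin (suc-≤ 0<T) (r T)))
        where
        0<T : 0ℤ < T
        0<T = ℤₚ.≤-<-trans (∑-nonneg (λ u → 0≤⟦ sendsToBig u ⟧)) (ℤₚ.≰⇒> ¬T≤n₁)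

-- Splitting off the vertices of large degree

opaque
  unfolding ∑

  +-sumFin : ∀ n (f : Fin n → ℕ) → + sumFin n f ≡ ∑ (λ i → + f i)
  +-sumFin zero    f = refl
  +-sumFin (suc n) f = cong (λ t → + f zero + t) (+-sumFin n (f ∘ suc))

b2n≡⟦⟧ : ∀ p → + b2n p ≡ ⟦ p ⟧
b2n≡⟦⟧ true  = refl
b2n≡⟦⟧ false = refl

module Assembly {n : ℕ} (G : Digraph n) (k : ℕ) (outdeg≥4 : ∀ v → outdeg G v ℕ.≥ 4)
  (many : + 24 * + suc k * ((+ 2 * (+ suc k * + suc k) * (+ suc k + 1ℤ)) * (+ 2 * (+ suc k * + suc k) * (+ suc k + 1ℤ))) ≤ + arcs G)
  (nonempty : 0ℤ < + arcs G) where

  N : ℤ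
  N = + suc k

  C M : ℤ
  C = + 2 * (N * N) * (N + 1ℤ)
  M = + arcs G

  a : Fin n → Fin n → ℤ
  a u v = ⟦ adj G u v ⟧

  degree : Fin n → ℤ
  degree v = ∑ (a v) + ∑ (λ w → a w v)

  +outdeg : ∀ v → + outdeg G v ≡ ∑ (a v)
  +outdeg v = trans (+-sumFin n _) (∑-cong (λ w → b2n≡⟦⟧ (adj G v w)))

  +arcs : M ≡ ∑ (λ v → ∑ (a v))
  +arcs = trans (+-sumFin n _) (∑-cong +outdeg)

  big : Fin n → Bool
  big v = not (does (C * degree v ℤₚ.≤? M))

  -- Deleting the arcs between big vertices makes these independent and leaves the outdegrees of all
  -- other vertices intact.
  g : Fin n → Fin n → Bool
  g u v = adj G u v ∧ not (big u ∧ big v)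

  ∧-≤ : ∀ p q → ⟦ p ∧ q ⟧ ≤ ⟦ p ⟧
  ∧-≤ true  q = ⟦ q ⟧≤1
  ∧-≤ false q = ≤-refl

  g≤a : ∀ u v → ⟦ g u v ⟧ ≤ a u v
  g≤a u v = ∧-≤ (adj G u v) (not (big u ∧ big v))

  irreflexive : ∀ v → g v v ≡ false
  irreflexive v rewrite noLoops G v = refl

  independent : ∀ u v → big u ≡ true → big v ≡ true → g u v ≡ false
  independent u v p q rewrite p | q with adj G u v
  ... | true  = refl
  ... | false = refl

  open Core g irreflexive big independent (suc k) M nonempty

  0≤C : 0ℤ ≤ C
  0≤C = *-nonneg (2 ⊛ *-nonneg {N} {N} 0≤+ 0≤+) (0≤+ {suc k} ⊕ 0≤+ {1})

  m≤M : m ≤ M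
  m≤M = subst (m ≤_) (sym +arcs) (∑-mono (λ u → ∑-mono (g≤a u)))

  sparse : ∀ v → big v ≡ false → C * deg v ≤ M
  sparse v p = ≤-trans (*-monoˡ 0≤C (∑-mono (g≤a v) ⊕ ∑-mono (λ w → g≤a w v))) (lem p)
    where
    lem : big v ≡ false → C * degree v ≤ M
    lem p with C * degree v ℤₚ.≤? M
    ... | yes q = q

  outdegree≥4 : ∀ v → big v ≡ false → + 4 ≤ out v
  outdegree≥4 v p = subst (+ 4 ≤_) (trans (+outdeg v) (∑-cong same)) (+≤+ (outdeg≥4 v))
    where
    same : ∀ w → a v w ≡ ⟦ g v w ⟧
    same w rewrite p with adj G v w
    ... | true  = refl
    ... | false = refl

  bigs : ℤ
  bigs = ∑ (λ v → ⟦ big v ⟧)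

  -- Each big vertex takes more than M/C of the total degree 2M.
  bigs≤ : bigs ≤ + 2 * C
  bigs≤ = *-cancelˡ nonempty (≤-trans (≤-reflexive (*-comm M bigs)) (≤-trans (subst₂ _≤_ (∑-*ʳ M _) total (∑-mono term)) (≤-reflexive (r C M))))
    where
    term : ∀ v → ⟦ big v ⟧ * M ≤ C * degree v
    term v with C * degree v ℤₚ.≤? M
    ... | yes _ = *-nonneg 0≤C (∑-nonneg (λ w → 0≤⟦ adj G v w ⟧) ⊕ ∑-nonneg (λ w → 0≤⟦ adj G w v ⟧))
    ... | no p  = ≤-trans (≤-reflexive (*-identityˡ M)) (≰⇒≥ p)
    total : ∑ (λ v → C * degree v) ≡ C * (M + M)
    total = trans (∑-* C degree) (cong (C *_) (trans (∑-+ _ _) (cong₂ _+_ (sym +arcs) (trans (sym (∑-swap a)) (sym +arcs)))))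
    r : ∀ C M → C * (M + M) ≡ M * (+ 2 * C)
    r = solve-∀

  lost-arcs : M ≤ m + bigs * bigs
  lost-arcs = subst₂ _≤_ (sym +arcs)
    (trans (∑-cong (λ u → ∑-+ _ _)) (trans (∑-+ _ _) (cong (λ t → m + t)
      (trans (∑-cong (λ u → ∑-* ⟦ big u ⟧ _)) (∑-*ʳ bigs _)))))
    (∑-mono (λ u → ∑-mono (λ v → arc (adj G u v) (big u) (big v))))
    where
    arc : ∀ p q r → ⟦ p ⟧ ≤ ⟦ p ∧ not (q ∧ r) ⟧ + ⟦ q ⟧ * ⟦ r ⟧
    arc false q     r     = 0≤⟦ false ⟧ ⊕ *-nonneg 0≤⟦ q ⟧ 0≤⟦ r ⟧
    arc true  true  true  = ≤-refl
    arc true  true  false = ≤-refl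
    arc true  false r     = ≤-refl

  few-lost : + 6 * N * (bigs * bigs) ≤ M
  few-lost = ≤-trans (*-monoˡ (6 ⊛ 0≤+ {suc k}) (sq-mono bigs≤ (≤-trans (ℤₚ.neg-mono-≤ (∑-nonneg (λ v → 0≤⟦ big v ⟧))) (2 ⊛ 0≤C))))
    (≤-trans (≤-reflexive (r N C)) many)
    where
    r : ∀ N C → + 6 * N * (+ 2 * C * (+ 2 * C)) ≡ + 24 * N * (C * C)
    r = solve-∀

  side : Fin n → Bool
  side = proj₁ (WithOutdegree.good-cut m≤M sparse outdegree≥4)

  crossing≤eSides : ∀ x → crossing side x ≤ + eSides G side x (not x)
  crossing≤eSides x = subst (crossing side x ≤_)
    (sym (trans (+-sumFin n _) (∑-cong (λ u → trans (+-sumFin n _) (∑-cong (λ v → arc (side u) (side v) x (adj G u v)))))))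
    (∑-mono (λ u → ∑-mono (λ v → *-monoˡ 0≤⟦ not (side u xor x) ⟧ (*-monoˡ 0≤⟦ side v xor x ⟧ (g≤a u v)))))
    where
    arc : ∀ p q x r → + (if sameB p x then (if sameB q (not x) then b2n r else 0) else 0) ≡ ⟦ not (p xor x) ⟧ * (⟦ q xor x ⟧ * ⟦ r ⟧)
    arc true  true  true  r = refl
    arc true  false true  r = trans (b2n≡⟦⟧ r) (sym (trans (*-identityˡ _) (*-identityˡ _)))
    arc false q     true  r = refl
    arc true  q     false r = refl
    arc false true  false r = trans (b2n≡⟦⟧ r) (sym (trans (*-identityˡ _) (*-identityˡ _)))
    arc false false false r = refl

  -- In doubled units the losses are 13M from `Good` and M from the deleted arcs; the remaining 14M
  -- of the allowance is slack.
  many-crossing : ∀ x → + 3 * N * M ≤ + 14 * N * + eSides G side x (not x) + + 14 * M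
  many-crossing x = *-cancelˡ {+ 2} (+<+ (ℕ.s≤s ℕ.z≤n)) (lin
    (proj₂ (WithOutdegree.good-cut m≤M sparse outdegree≥4) x ⊕ *-monoˡ (28*N) (crossing≤eSides x) ⊕ few-lost
      ⊕ *-monoˡ (6 ⊛ 0≤+ {suc k}) lost-arcs ⊕ (14 ⊛ ℤₚ.<⇒≤ nonempty))
    (r N M m (bigs * bigs) (crossing side x) (+ eSides G side x (not x))))
    where
    28*N : 0ℤ ≤ + 28 * N
    28*N = 28 ⊛ 0≤+ {suc k}
    r : ∀ N M m b c E → + 2 * (+ 14 * N * E + + 14 * M)
      + (+ 6 * N * m + (+ 28 * N * c + (+ 6 * N * b + (+ 6 * N * M + + 14 * 0ℤ))))
      ≡ + 2 * (+ 3 * N * M) + (+ 28 * N * c + + 13 * M + (+ 28 * N * E + (M + (+ 6 * N * (m + b) + + 14 * M))))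
    r = solve-∀

-- A positive ε is at least 1 over its denominator, which is the N of the integer estimate.
rational-bound : ∀ ε → Positive ε → ∀ a e →
  + 3 * ℚ.↧ ε * + a ≤ + 14 * ℚ.↧ ε * + e + + 14 * + a →
  ((+ 3 / 14) ℚ.- ε) ℚ.* (+ a / 1) ℚ.≤ + e / 1
rational-bound ε@(mkℚ (+ suc p) q _) _ a e h = ℚₚ.toℚᵘ-cancel-≤
  (ℚᵘₚ.≤-respˡ-≃ (ℚᵘₚ.≃-sym left)
    (ℚᵘₚ.≤-respʳ-≃ (ℚᵘₚ.≃-sym (ℚₚ.toℚᵘ-fromℚᵘ (mkℚᵘ (+ e) 0))) (*≤* cross)))
  where
  left : toℚᵘ (((+ 3 / 14) ℚ.- ε) ℚ.* (+ a / 1)) ℚᵘ.≃ (mkℚᵘ (+ 3) 13 ℚᵘ.- mkℚᵘ (+ suc p) q) ℚᵘ.* mkℚᵘ (+ a) 0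
  left = ℚᵘₚ.≃-trans (ℚₚ.toℚᵘ-homo-* ((+ 3 / 14) ℚ.- ε) (+ a / 1))
    (ℚᵘₚ.*-cong (ℚᵘₚ.≃-trans (ℚₚ.toℚᵘ-homo-+ (+ 3 / 14) (ℚ.- ε)) (ℚᵘₚ.+-congʳ (mkℚᵘ (+ 3) 13) (ℚₚ.toℚᵘ-homo‿- ε)))
                (ℚₚ.toℚᵘ-fromℚᵘ (mkℚᵘ (+ a) 0)))
  denominator : + (14 ℕ.* suc q ℕ.* 1) ≡ + 14 * + suc q * + 1
  denominator = trans (ℤₚ.pos-* (14 ℕ.* suc q) 1) (cong (_* + 1) (ℤₚ.pos-* 14 (suc q)))
  cross : (+ 3 * + suc q + - (+ suc p) * + 14) * + a * + 1 ≤ + e * + (14 ℕ.* suc q ℕ.* 1)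
  cross = subst (λ t → (+ 3 * + suc q + - (+ suc p) * + 14) * + a * + 1 ≤ + e * t) (sym denominator)
    (lin (h ⊕ *-nonneg {+ p} {+ 14 * + a} 0≤+ (14 ⊛ 0≤+ {a})) (r (+ suc q) (+ p) (+ a) (+ e)))
    where
    r : ∀ N p a e → e * (+ 14 * N * + 1) + (+ 3 * N * a + 0ℤ)
      ≡ (+ 3 * N + - (1ℤ + p) * + 14) * a * + 1 + (+ 14 * N * e + + 14 * a + p * (+ 14 * a))
    r = solve-∀

-- 24NC² = 6N(2C)²: with at most 2C big vertices, the deleted arcs then number at most M/(6N).
threshold : ℕ → ℤ
threshold k = + 24 * + suc k * ((+ 2 * (+ suc k * + suc k) * (+ suc k + 1ℤ)) * (+ 2 * (+ suc k * + suc k) * (+ suc k + 1ℤ)))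

theorem1p3 : (ε : ℚ) → Positive ε →
    ∃ λ (m₀ : ℕ) → ∀ (n : ℕ) (D : Digraph n) →
    arcs D ℕ.≥ m₀ → (∀ v → outdeg D v ℕ.≥ 4) →
    ∃ λ (side : Fin n → Bool) →
    ((+ 3 / 14) ℚ.- ε) ℚ.* ((+ arcs D) / 1)
    ℚ.≤ ((+ (eSides D side true false ℕ.⊓ eSides D side false true)) / 1)
-- The successor makes the number of arcs positive without evaluating the threshold.
theorem1p3 ε ε>0 = suc ℤ.∣ threshold (ℚ.denominator-1 ε) ∣ , cut
  where
  cut : ∀ n (D : Digraph n) → arcs D ℕ.≥ suc ℤ.∣ threshold (ℚ.denominator-1 ε) ∣ → (∀ v → outdeg D v ℕ.≥ 4) →
    ∃ λ (side : Fin n → Bool) → ((+ 3 / 14) ℚ.- ε) ℚ.* ((+ arcs D) / 1)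
      ℚ.≤ ((+ (eSides D side true false ℕ.⊓ eSides D side false true)) / 1)
  cut n D many outdeg≥4 = side ,
    by-min (enough true) (enough false) (ℕₚ.⊓-sel (eSides D side true false) (eSides D side false true))
    where
    open Assembly D (ℚ.denominator-1 ε) outdeg≥4
      (≤-trans (a≤∥a∥ (threshold (ℚ.denominator-1 ε))) (+≤+ (ℕₚ.≤-trans (ℕₚ.n≤1+n _) many)))
      (ℤₚ.<-≤-trans (+<+ (ℕ.s≤s ℕ.z≤n)) (+≤+ many))
    Enough : ℕ → Set
    Enough e = ((+ 3 / 14) ℚ.- ε) ℚ.* ((+ arcs D) / 1) ℚ.≤ + e / 1
    enough : ∀ x → Enough (eSides D side x (not x))
    enough x = rational-bound ε ε>0 (arcs D) (eSides D side x (not x)) (many-crossing x)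
    by-min : ∀ {x y z} → Enough x → Enough y → z ≡ x ⊎ z ≡ y → Enough z
    by-min p _ (inj₁ refl) = p
    by-min _ q (inj₂ refl) = q
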